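{- Let $\mathcal{C}_d$ be the set system on $\{0,1\}^d$ consisting of all subsets of the form $R\cap\{0,1\}^d$ with $R$ an axis-parallel box in $\mathbb{R}^d$ (equivalently, all subcubes of $\{0,1\}^d$). Then, as $d\to\infty$, \[ \operatorname{herdisc}\mathcal{C}_d=2^{c_0d+o(d)},\qquad c_0=\log_2(2/\sqrt3). \] The same holds for the set system $\mathcal{A}_d(\{0,1\}^d)=\{A\cap\{0,1\}^d: A=[0,b_1]\times\cdots\times[0,b_d],\ b_i\ge0\}$ induced by anchored boxes.
   Context: For a set system $\mathcal{F}$ on ground set $V$, $\operatorname{disc}\mathcal{F}=\min_{x\in\{ -1,1\}^V}\max_{F\in\mathcal{F}}\bigl|\sum_{v\in F}x_v\bigr|$, and $\operatorname{herdisc}\mathcal{F}=\max_{J\subseteq V}\operatorname{disc}(\mathcal{F}|_J)$, where $\mathcal{F}|_J=\{F\cap J:F\in\mathcal{F}\}$. -}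

module Defs where

open import Algebra.Properties.CommutativeMonoid.Sum as Sum using ()
open import Data.Bool.Base using (if_then_else_)
open import Data.Fin.Base using (Fin; toℕ; finToFun)
open import Data.Fin.Subset using (Subset; _∈_; _∩_)
open import Data.Integer.Base as ℤ using (ℤ; _◃_; 0ℤ; +_)
open import Data.Integer.Properties as ℤ using ()
open import Data.Nat.Base as ℕ using (ℕ; suc; _*_; _^_; _≤_; NonZero)
open import Data.Product.Base using (_×_; ∃-syntax; Σ-syntax)
open import Data.Rational.Base as ℚ using (ℚ; 0ℚ)
open import Data.Rational.Properties as ℚ using ()
open import Data.Sign.Base using (Sign)
open import Data.Vec.Base using (Vec; lookup)
open import Function.Bundles using (_⇔_)
open import Level using (0ℓ)
open import Relation.Binary.PropositionalEquality using (_≡_; subst; sym; cong)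
open import Relation.Unary using (Pred)

-- Real numbers, as Bishop's regular sequences of rationals.

1/1+_ : ℕ → ℚ
1/1+ n = + 1 ℚ./ suc n

record ℝ : Set where
  field
    seq     : ℕ → ℚ
    regular : ∀ m n → ℚ.∣ seq m ℚ.- seq n ∣ ℚ.≤ (1/1+ m) ℚ.+ (1/1+ n)

open ℝ public

-- |x - xₙ| ≤ 1/(n+1), so x ≤ y iff xₙ ≤ yₙ + 2/(n+1) for every n.
infix 4 _≤ℝ_
_≤ℝ_ : ℝ → ℝ → Set
x ≤ℝ y = ∀ n → seq x n ℚ.≤ seq y n ℚ.+ ((1/1+ n) ℚ.+ (1/1+ n))

fromℚ : ℚ → ℝ
fromℚ q = record
  { seq     = λ _ → q
  ; regular = λ m n → subst (ℚ._≤ (1/1+ m) ℚ.+ (1/1+ n))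
      (sym (cong ℚ.∣_∣ (ℚ.+-inverseʳ q)))
      (ℚ.+-mono-≤ (0≤1/1+ m) (0≤1/1+ n))
  }
  where
  0≤1/1+_ : ∀ n → 0ℚ ℚ.≤ 1/1+ n
  0≤1/1+ n = ℚ.nonNegative⁻¹ (1/1+ n) {{ℚ.normalize-nonNeg 1 (suc n)}}

fromℕ : ℕ → ℝ
fromℕ n = fromℚ (+ n ℚ./ 1)

-- A set system on the ground set Fin n.
SetSystem : ℕ → Set₁
SetSystem n = Pred (Subset n) 0ℓ

_∣ˢ_ : ∀ {n} → SetSystem n → Subset n → SetSystem n
(𝓕 ∣ˢ J) G = ∃[ F ] (𝓕 F × G ≡ F ∩ J)

IsMax : Pred ℕ 0ℓ → ℕ → Set
IsMax P m = P m × (∀ k → P k → k ≤ m)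

IsMin : Pred ℕ 0ℓ → ℕ → Set
IsMin P m = P m × (∀ k → P k → m ≤ k)

Colouring : ℕ → Set
Colouring n = Vec Sign n

-- The sum of x_v over v ∈ F, with x_v = ±1.
colourSum : ∀ {n} → Colouring n → Subset n → ℤ
colourSum x F = Sum.sum ℤ.+-0-commutativeMonoid
  (λ v → if lookup F v then lookup x v ◃ 1 else 0ℤ)

-- Minima and maxima are given by their graphs: Disc 𝓕 m says disc 𝓕 = m, etc.

MaxImbalance : ∀ {n} → SetSystem n → Colouring n → ℕ → Set
MaxImbalance 𝓕 x = IsMax (λ k → ∃[ F ] (𝓕 F × k ≡ ℤ.∣ colourSum x F ∣))

Disc : ∀ {n} → SetSystem n → ℕ → Set
Disc 𝓕 = IsMin (λ k → ∃[ x ] MaxImbalance 𝓕 x k)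

-- 𝓕 ∣ˢ J is kept on the ground set Fin n: its members lie inside J, so the
-- colours outside J do not affect the discrepancy.
HerDisc : ∀ {n} → SetSystem n → ℕ → Set
HerDisc 𝓕 = IsMax (λ k → ∃[ J ] Disc (𝓕 ∣ˢ J) k)

ℝ^_ : ℕ → Set
ℝ^ d = Fin d → ℝ

-- finToFun is the bijection Fin (2 ^ d) ≅ {0,1}ᵈ, so the ground set {0,1}ᵈ is
-- Fin (2 ^ d).
point : ∀ {d} → Fin (2 ^ d) → ℝ^ d
point v i = fromℕ (toℕ (finToFun v i))

-- F = R ∩ {0,1}ᵈ.
IsTrace : ∀ {d} → Pred (ℝ^ d) 0ℓ → Subset (2 ^ d) → Set
IsTrace R F = ∀ v → v ∈ F ⇔ R (point v)

Box : ∀ {d} → ℝ^ d → ℝ^ d → Pred (ℝ^ d) 0ℓ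
Box a b y = ∀ i → a i ≤ℝ y i × y i ≤ℝ b i

𝓒 : ∀ d → SetSystem (2 ^ d)
𝓒 d F = Σ[ a ∈ ℝ^ d ] Σ[ b ∈ ℝ^ d ] IsTrace (Box a b) F

𝓐 : ∀ d → SetSystem (2 ^ d)
𝓐 d F = Σ[ b ∈ ℝ^ d ] ((∀ i → fromℕ 0 ≤ℝ b i) × IsTrace (Box (λ _ → fromℕ 0) b) F)

-- h d = 2^(c₀ d + o(d)) with c₀ = log₂ (2/√3): for every ε = 1/k and all large d,
--   2^((c₀ - 1/k) d) ≤ h d ≤ 2^((c₀ + 1/k) d).
-- As 2^(2 c₀) = 4/3, raising to the power 2k turns the outer terms into
-- (4/3)^(k d) · 4^(-d) and (4/3)^(k d) · 4^d; denominators are then cleared.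
Is2^[c₀d+o[d]] : (ℕ → ℕ) → Set
Is2^[c₀d+o[d]] h = ∀ k → .{{NonZero k}} → ∃[ D ] (∀ d → D ≤ d →
    (4 ^ (k * d) ≤ h d ^ (2 * k) * 3 ^ (k * d) * 4 ^ d)
  × (h d ^ (2 * k) * 3 ^ (k * d) ≤ 4 ^ (k * d) * 4 ^ d))

{-# OPTIONS --safe #-}

-- Upper bound.  The incidence matrix of {0}, {1}, {0,1} on {0,1} factors through two unit vectors at
-- angle 60° and functionals of squared length 4/3; tensor powers give points of {0,1}ᵈ unit vectors v_x
-- and subcubes functionals u_F with |u_F|² ≤ γ = (4/3)ᵈ.  A Gram–Schmidt walk colours any J: among the
-- Gram–Schmidt residuals of the m uncoloured vectors, Bessel's inequality finds one along which the
-- potential Σ_F (R + ⟨u_F, s⟩²)ᵖ, R = O_p(γ), has second derivative at most a 1/m fraction of itself.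
-- Moving along it, with the sign that makes the first derivative nonpositive, until some coordinate
-- reaches ±1 multiplies the potential by at most 1 + 1/m, so by at most 2ᵈ + 1 in total.  Taking p
-- large makes the loss of (8ᵈ)^(1/p) subexponential.
--
-- Lower bound.  With suitable product weights the d-th tensor power of the anchored matrix [1 0; 1 1]
-- has trace norm close to (2/√3)ᵈ, and one class of K equal singular values σ carries a 1/(d+1) fraction
-- of it.  Greedily choosing points whose columns are far from the span of the previous ones yields K/2
-- columns with Gram–Schmidt squared norms of order σ²K.  For such a system some sub-collection J has no balanced
-- colouring: decide membership point by point, latest first, keeping the sum over colourings of
-- 8^(-#{i : the i-th Gram–Schmidt coefficient is at least 1/2 in absolute value}) small.  The weights
-- that would be optimal involve √3, which is approximated by solutions of Pell's equation.
module Submission where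

open import Defs
open import Algebra.Bundles using (CommutativeRing)
import Algebra.Properties.CommutativeMonoid.Sum as CommutativeMonoidSum
import Algebra.Properties.CommutativeSemiring.Exp as Exp
import Algebra.Properties.Semiring.Sum as SemiringSum
open import Data.Bool.Base using (Bool; true; false; _∧_; if_then_else_; T)
import Data.Bool.Properties as Bool
open import Data.Empty using (⊥; ⊥-elim)
open import Data.Fin.Base as Fin using (Fin; zero; suc; toℕ; fromℕ<; punchIn; _↑ˡ_; _↑ʳ_; combine; remainder; finToFun; funToFin)
open import Data.Fin.Patterns using (0F; 1F; 2F; 3F)
open import Data.Fin.Properties as Fin using (_≟_; any?; ¬∀⟶∃¬; punchInᵢ≢i; toℕ-fromℕ<; toℕ-injective; remQuot-combine; combine-remQuot; finToFun-funToFin)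
open import Data.Fin.Subset using (Subset; _∈_; _∩_)
open import Data.Integer.Base as ℤ using (ℤ; _◃_; 0ℤ)
open import Data.Integer.Properties as ℤ using ()
open import Data.Nat.Base as ℕ using (ℕ; zero; suc; _∸_; ⌈_/2⌉)
open import Data.Nat.Coprimality as Coprime using ()
open import Data.Nat.Properties as ℕ using ()
open import Data.Product.Base using (_×_; _,_; ∃-syntax; Σ-syntax; proj₁; proj₂)
open import Data.Sign.Base as Sign using (Sign)
open import Data.Sum.Base using (_⊎_; inj₁; inj₂; [_,_]′)
open import Data.Vec.Base as V using ([]; _∷_; lookup; tabulate; _[_]≔_)
open import Data.Vec.Functional using (Vector; removeAt; insertAt; updateAt)
open import Data.Vec.Functional.Properties using (insertAt-lookup; insertAt-punchIn; updateAt-updates; updateAt-minimal)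
open import Data.Vec.Properties using (lookup∘tabulate; tabulate∘lookup; tabulate-cong; lookup-zipWith; lookup-replicate; lookup∘update; lookup∘update′; []=⇒lookup; lookup⇒[]=)
open import Function.Base using (_∘_; const)
open import Function.Bundles using (_⇔_; mk⇔; Equivalence)
open import Level using (0ℓ)
open import Relation.Binary.Definitions using (tri<; tri≈; tri>)
open import Relation.Binary.PropositionalEquality
open import Relation.Nullary using (¬_; Dec; yes; no; contradiction)
open import Relation.Unary using (Pred)

-- Both bounds evaluate one quantity, the factorisation norm γ₂, which equals the largest trace norm
-- obtainable by weighting rows and columns with unit mass and is multiplicative under tensor
-- powers. The upper bound exhibits a factorisation, the lower bound exhibits weights, and for a
-- single coordinate both sides meet at 2/√3. The lower bound is proved for anchored boxes and the
-- upper bound for all subcubes, so the inclusion of 𝓐 in 𝓒 settles both systems. Working over ℚ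
-- shapes the details: norms occur only squared, orthogonal families are never normalised, and inner
-- products carry rational weights, which give unit vectors at 60° and singular vectors without
-- square roots. A power takes the place of an exponential in the potential for the same reason, and
-- its degree is fixed by the required precision 1/k before d grows. The order on Bishop reals is
-- undecidable, so extrema over boxes are reached only after each system has been replaced by a
-- finite enumeration by words.

-- Natural-number estimates: from the two combinatorial bounds to the growth rate.

module Arithmetic where
  open import Data.Nat.Base
  open import Data.Nat.Properties
  open import Data.Nat.Solver using (module +-*-Solver)
  open +-*-Solver using (solve; _:=_; _:+_; _:*_; con)

  ^-distribʳ-*ℕ : ∀ k m n → (m * n) ^ k ≡ m ^ k * n ^ k
  ^-distribʳ-*ℕ zero m n = refl
  ^-distribʳ-*ℕ (suc k) m n = trans (cong (m * n *_) (^-distribʳ-*ℕ k m n))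
    ([m*n]*[o*p]≡[m*o]*[n*p] m n (m ^ k) (n ^ k))

  -- The coefficient of t² in the second-order estimate `taylor-≤`; the recursion is what the
  -- inductive step there consumes. It is exponential in q, which is harmless because q stays fixed
  -- while d grows.
  taylor : ℕ → ℕ
  taylor zero = 1
  taylor (suc q) = 3 * taylor q + (5 * suc q + 1)

  n<2^n : ∀ n → n < 2 ^ n
  n<2^n zero = s≤s z≤n
  n<2^n (suc n) = begin
    suc (suc n)        ≡⟨ +-comm 1 (suc n) ⟩
    suc n + 1          ≤⟨ +-mono-≤ (n<2^n n) (m^n>0 2 n) ⟩
    2 ^ n + 2 ^ n      ≡⟨ cong (2 ^ n +_) (+-identityʳ (2 ^ n)) ⟨
    2 ^ suc n ∎
    where open ≤-Reasoning

  ^-swap : ∀ b m n → (b ^ m) ^ n ≡ (b ^ n) ^ m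
  ^-swap b m n = trans (^-*-assoc b m n) (trans (cong (b ^_) (*-comm m n)) (sym (^-*-assoc b n m)))

  -- Bernoulli's inequality (1 - 1/(x+1))^κ ≥ 1 - κ/(x+1), multiplied by (x+1)^(κ+1).
  bernoulli : ∀ x κ → suc x * suc x ^ κ ≤ suc x * x ^ κ + κ * suc x ^ κ
  bernoulli x zero = m≤m+n (suc x * 1) 0
  bernoulli x (suc κ) = begin
    suc x * (suc x * y)
      ≡⟨ solve 2 (λ x y → (con 1 :+ x) :* ((con 1 :+ x) :* y) := x :* ((con 1 :+ x) :* y) :+ (con 1 :+ x) :* y) refl x y ⟩
    x * (suc x * y) + suc x * y
      ≤⟨ +-monoˡ-≤ (suc x * y) (*-monoʳ-≤ x (bernoulli x κ)) ⟩
    x * (suc x * z + κ * y) + suc x * y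
      ≡⟨ solve 4 (λ x y z k → x :* ((con 1 :+ x) :* z :+ k :* y) :+ (con 1 :+ x) :* y
           := (con 1 :+ x) :* (x :* z) :+ ((con 1 :+ x) :* y :+ k :* (x :* y))) refl x y z κ ⟩
    suc x * (x * z) + (suc x * y + κ * (x * y))
      ≤⟨ +-monoʳ-≤ (suc x * (x * z)) (+-monoʳ-≤ (suc x * y) (*-monoʳ-≤ κ (*-monoˡ-≤ y (n≤1+n x)))) ⟩
    suc x * (x * z) + suc κ * (suc x * y) ∎
    where
    open ≤-Reasoning
    y = suc x ^ κ
    z = x ^ κ

  suc^≤2* : ∀ x κ → 2 * κ ≤ suc x → suc x ^ κ ≤ 2 * x ^ κ
  suc^≤2* x κ 2κ≤ = *-cancelˡ-≤ (suc x) (+-cancelʳ-≤ (suc x * y) (suc x * y) (suc x * (2 * z)) (begin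
    suc x * y + suc x * y
      ≡⟨ solve 1 (λ y → y :+ y := con 2 :* y) refl (suc x * y) ⟩
    2 * (suc x * y)
      ≤⟨ *-monoʳ-≤ 2 (bernoulli x κ) ⟩
    2 * (suc x * z + κ * y)
      ≡⟨ solve 4 (λ x y z k → con 2 :* (x :* z :+ k :* y) := x :* (con 2 :* z) :+ con 2 :* k :* y) refl (suc x) y z κ ⟩
    suc x * (2 * z) + 2 * κ * y
      ≤⟨ +-monoʳ-≤ (suc x * (2 * z)) (*-monoˡ-≤ y 2κ≤) ⟩
    suc x * (2 * z) + suc x * y ∎))
    where
    open ≤-Reasoning
    y = suc x ^ κ
    z = x ^ κ

  -- As soon as 2κ ≤ d + 2, passing from d to d + 1 at most doubles the left side (`suc^≤2*`);
  -- before that, the constant alone dominates.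
  poly≤exp : ∀ κ d → suc d ^ κ ≤ suc (2 * κ) ^ κ * 2 ^ d
  poly≤exp κ zero = begin
    1 ^ κ                    ≤⟨ ^-monoˡ-≤ κ (s≤s z≤n) ⟩
    suc (2 * κ) ^ κ          ≡⟨ *-identityʳ _ ⟨
    suc (2 * κ) ^ κ * 1 ∎
    where open ≤-Reasoning
  poly≤exp κ (suc d) with 2 * κ ≤? suc (suc d)
  ... | yes 2κ≤ = begin
    suc (suc d) ^ κ                  ≤⟨ suc^≤2* (suc d) κ 2κ≤ ⟩
    2 * suc d ^ κ                    ≤⟨ *-monoʳ-≤ 2 (poly≤exp κ d) ⟩
    2 * (suc (2 * κ) ^ κ * 2 ^ d)    ≡⟨ solve 2 (λ a b → con 2 :* (a :* b) := a :* (con 2 :* b)) refl (suc (2 * κ) ^ κ) (2 ^ d) ⟩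
    suc (2 * κ) ^ κ * 2 ^ suc d ∎
    where open ≤-Reasoning
  ... | no 2κ≰ = begin
    suc (suc d) ^ κ                  ≤⟨ ^-monoˡ-≤ κ (≤-trans (<⇒≤ (≰⇒> 2κ≰)) (n≤1+n (2 * κ))) ⟩
    suc (2 * κ) ^ κ                  ≤⟨ m≤m*n (suc (2 * κ) ^ κ) (2 ^ suc d) {{m^n≢0 2 (suc d)}} ⟩
    suc (2 * κ) ^ κ * 2 ^ suc d ∎
    where open ≤-Reasoning

  -- `poly≤exp` is applied with one spare power of d + 1; for d ≥ D that spare factor absorbs both
  -- constants.
  poly<exp : ∀ C κ → ∃[ D ] (∀ d → D ≤ d → (C * (suc d * suc d)) ^ κ ≤ 2 ^ d)
  poly<exp C κ = A * C ^ κ , λ d D≤d → *-cancelˡ-≤ A {{A≢0}} (begin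
    A * (C * (suc d * suc d)) ^ κ
      ≡⟨ cong (A *_) (trans (^-distribʳ-*ℕ κ C (suc d * suc d)) (cong (C ^ κ *_) (suc-d² d))) ⟩
    A * (C ^ κ * suc d ^ (2 * κ))
      ≡⟨ *-assoc A (C ^ κ) (suc d ^ (2 * κ)) ⟨
    A * C ^ κ * suc d ^ (2 * κ)
      ≤⟨ *-monoˡ-≤ (suc d ^ (2 * κ)) (≤-trans D≤d (n≤1+n d)) ⟩
    suc d ^ suc (2 * κ)
      ≤⟨ poly≤exp (suc (2 * κ)) d ⟩
    A * 2 ^ d ∎)
    where
    open ≤-Reasoning
    A = suc (2 * suc (2 * κ)) ^ suc (2 * κ)
    A≢0 : NonZero A
    A≢0 = m^n≢0 (suc (2 * suc (2 * κ))) (suc (2 * κ))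
    suc-d² : ∀ d → (suc d * suc d) ^ κ ≡ suc d ^ (2 * κ)
    suc-d² d = trans (^-distribʳ-*ℕ κ (suc d) (suc d)) (trans (sym (^-distribˡ-+-* (suc d) κ κ))
      (cong (λ k → suc d ^ (κ + k)) (sym (+-identityʳ κ))))

  -- The final bound on the potential, h^(2(q+1)) ≤ (2^d + 1) 4^d R^(q+1) with R = 4 · `taylor q` ·
  -- (4/3)^d, after clearing the powers of 3. Here 2^d counts the vectors and 4^d the words.
  UpperWitness : ℕ → ℕ → ℕ → Set
  UpperWitness d q h = (h * h * 3 ^ d) ^ suc q ≤ suc (2 ^ d) * (4 ^ d * (4 * taylor q * 4 ^ d) ^ suc q)

  h^2κ : ∀ h d κ → (h * h * 3 ^ d) ^ κ ≡ h ^ (2 * κ) * 3 ^ (κ * d)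
  h^2κ h d κ = trans (^-distribʳ-*ℕ κ (h * h) (3 ^ d)) (cong₂ _*_
    (trans (^-distribʳ-*ℕ κ h h) (trans (sym (^-distribˡ-+-* h κ κ)) (cong (λ k → h ^ (κ + k)) (sym (+-identityʳ κ)))))
    (trans (^-*-assoc 3 d κ) (cong (3 ^_) (*-comm d κ))))

  -- With q + 1 = 2 · `suc κ` the left side of the witness is the square of the target. The loss is
  -- at most 2 · 2^d · 4^d times a constant; since D ≤ d < 2^d, this is at most (4^d)², and a square
  -- root leaves the allowed factor 4^d.
  upper-arithmetic : ∀ κ → ∃[ D ] (∀ d → D ≤ d → ∀ h → UpperWitness d (suc (2 * κ)) h →
    h ^ (2 * suc κ) * 3 ^ (suc κ * d) ≤ 4 ^ (suc κ * d) * 4 ^ d)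
  upper-arithmetic κ′ = D , λ d D≤d h wit → square-cancel (begin
      X d h * X d h
        ≡⟨ X² d h ⟩
      (h * h * 3 ^ d) ^ suc q
        ≤⟨ wit ⟩
      suc (2 ^ d) * (4 ^ d * (c * 4 ^ d) ^ suc q)
        ≡⟨ cong (λ z → suc (2 ^ d) * (4 ^ d * z)) (^-distribʳ-*ℕ (suc q) c (4 ^ d)) ⟩
      suc (2 ^ d) * (4 ^ d * (c ^ suc q * (4 ^ d) ^ suc q))
        ≤⟨ *-monoˡ-≤ (4 ^ d * (c ^ suc q * (4 ^ d) ^ suc q)) (+-mono-≤ (m^n>0 2 d) (≤-refl {2 ^ d})) ⟩
      (2 ^ d + 2 ^ d) * (4 ^ d * (c ^ suc q * (4 ^ d) ^ suc q))
        ≡⟨ solve 4 (λ t f k z → (t :+ t) :* (f :* (k :* z)) := con 2 :* k :* (t :* f) :* z) refl (2 ^ d) (4 ^ d) (c ^ suc q) ((4 ^ d) ^ suc q) ⟩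
      D * (2 ^ d * 4 ^ d) * (4 ^ d) ^ suc q
        ≤⟨ *-monoˡ-≤ ((4 ^ d) ^ suc q) (*-monoˡ-≤ (2 ^ d * 4 ^ d) (≤-trans D≤d (<⇒≤ (n<2^n d)))) ⟩
      2 ^ d * (2 ^ d * 4 ^ d) * (4 ^ d) ^ suc q
        ≡⟨ cong₂ _*_ (trans (sym (*-assoc (2 ^ d) (2 ^ d) (4 ^ d))) (cong (_* 4 ^ d) (sym (^-distribʳ-*ℕ d 2 2)))) (4^ d) ⟩
      4 ^ d * 4 ^ d * (4 ^ (κ * d) * 4 ^ (κ * d))
        ≡⟨ solve 2 (λ a b → a :* a :* (b :* b) := b :* a :* (b :* a)) refl (4 ^ d) (4 ^ (κ * d)) ⟩
      4 ^ (κ * d) * 4 ^ d * (4 ^ (κ * d) * 4 ^ d) ∎)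
    where
    open ≤-Reasoning
    κ = suc κ′
    q = suc (2 * κ′)
    c = 4 * taylor q
    D = 2 * c ^ suc q
    X : ℕ → ℕ → ℕ
    X d h = h ^ (2 * κ) * 3 ^ (κ * d)
    suc-q : suc q ≡ κ + κ
    suc-q = cong suc (trans (cong (λ k → suc (κ′ + k)) (+-identityʳ κ′)) (sym (+-suc κ′ κ′)))
    X² : ∀ d h → X d h * X d h ≡ (h * h * 3 ^ d) ^ suc q
    X² d h = sym (trans (cong ((h * h * 3 ^ d) ^_) suc-q) (trans (^-distribˡ-+-* (h * h * 3 ^ d) κ κ) (cong₂ _*_ (h^2κ h d κ) (h^2κ h d κ))))
    4^ : ∀ d → (4 ^ d) ^ suc q ≡ 4 ^ (κ * d) * 4 ^ (κ * d)
    4^ d = trans (cong ((4 ^ d) ^_) suc-q) (trans (^-distribˡ-+-* (4 ^ d) κ κ) (cong (λ z → z * z) (trans (^-*-assoc 4 d κ) (cong (4 ^_) (*-comm d κ)))))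
    square-cancel : ∀ {a b} → a * a ≤ b * b → a ≤ b
    square-cancel {a} {b} aa≤bb = ≮⇒≥ λ b<a → <-irrefl refl (<-≤-trans (*-mono-< b<a b<a) aa≤bb)

  -- Solutions n = m + l of Pell's equation n² = 3 m² + 1.
  pell : ℕ → ℕ × ℕ
  pell zero = 1 , 1
  pell (suc j) = let m , l = pell j in 3 * m + l , 2 * m + l

  pell-equation : ∀ j → let m , l = pell j in 2 * m * l + l * l ≡ 2 * (m * m) + 1
  pell-equation zero = refl
  pell-equation (suc j) = let m , l = pell j in begin
    2 * (3 * m + l) * (2 * m + l) + (2 * m + l) * (2 * m + l)
      ≡⟨ solve 2 (λ m l → con 2 :* (con 3 :* m :+ l) :* (con 2 :* m :+ l) :+ (con 2 :* m :+ l) :* (con 2 :* m :+ l)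
           := con 16 :* (m :* m) :+ con 12 :* m :* l :+ con 2 :* (l :* l) :+ (con 2 :* m :* l :+ l :* l)) refl m l ⟩
    16 * (m * m) + 12 * m * l + 2 * (l * l) + (2 * m * l + l * l)
      ≡⟨ cong (16 * (m * m) + 12 * m * l + 2 * (l * l) +_) (pell-equation j) ⟩
    16 * (m * m) + 12 * m * l + 2 * (l * l) + (2 * (m * m) + 1)
      ≡⟨ solve 2 (λ m l → con 16 :* (m :* m) :+ con 12 :* m :* l :+ con 2 :* (l :* l) :+ (con 2 :* (m :* m) :+ con 1)
           := con 2 :* ((con 3 :* m :+ l) :* (con 3 :* m :+ l)) :+ con 1) refl m l ⟩
    2 * ((3 * m + l) * (3 * m + l)) + 1 ∎
    where open ≡-Reasoning

  pell-large : ∀ j → suc j ≤ proj₁ (pell j) × 1 ≤ proj₂ (pell j)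
  pell-large zero = ≤-refl , ≤-refl
  pell-large (suc j) = let j<m , 1≤l = pell-large j in
    subst (_≤ 3 * proj₁ (pell j) + proj₂ (pell j)) (+-comm (suc j) 1) (+-mono-≤ (≤-trans j<m (m≤m+n _ _)) 1≤l) ,
    m≤n⇒m≤o+n (2 * proj₁ (pell j)) 1≤l

  -- With n = m + l, the quotient 4mn / (3m² + n²) is the trace norm of the 2×2 anchored matrix for
  -- weights normalised to mass 1; its maximum 2/√3 is at n = √3 m. The factor (d+1)² is lost to
  -- pigeonholing, 80 to the selection of points and of the subset.
  LowerWitness : ℕ → ℕ → ℕ → ℕ → Set
  LowerWitness m l d h = let c = 3 * (m * m) + (m + l) * (m + l) in
    (4 * (m * (m + l))) ^ d * (4 * (m * (m + l))) ^ d ≤ suc d * suc d * (80 * (c ^ d * (c ^ d * (h * h))))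

  -- Put r = 4mn and x = 12m²n². Pell's equation gives 3r² = 4x and c² = x + 1, so the weights miss
  -- the optimum by the factor 1 + 1/x per coordinate. The index 2κ makes x large enough for (1 +
  -- 1/x)^κ ≤ 2. This loss and the polynomial one cost 2^d each, together the allowed 4^d.
  lower-arithmetic : ∀ κ → let m , l = pell (2 * κ) in ∃[ D ] (∀ d → D ≤ d → ∀ h → LowerWitness m l d h →
    4 ^ (κ * d) ≤ h ^ (2 * κ) * 3 ^ (κ * d) * 4 ^ d)
  lower-arithmetic κ = proj₁ (poly<exp 80 κ) , λ d D≤d h wit → *-cancelˡ-≤ (x ^ (κ * d)) {{m^n≢0 x (κ * d) {{x≢0}}}} (begin
      x ^ (κ * d) * 4 ^ (κ * d)
        ≡⟨ trans (sym (^-distribʳ-*ℕ (κ * d) x 4)) (trans (cong (_^ (κ * d)) (trans (*-comm x 4) (sym 3rr))) (sym (κd (3 * (r * r)) d))) ⟩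
      ((3 * (r * r)) ^ d) ^ κ
        ≤⟨ ^-monoˡ-≤ κ (base d h wit) ⟩
      (80 * (suc d * suc d) * suc x ^ d * (h * h * 3 ^ d)) ^ κ
        ≡⟨ trans (^-distribʳ-*ℕ κ (80 * (suc d * suc d) * suc x ^ d) (h * h * 3 ^ d)) (cong₂ _*_ (^-distribʳ-*ℕ κ (80 * (suc d * suc d)) (suc x ^ d)) (h^2κ h d κ)) ⟩
      (80 * (suc d * suc d)) ^ κ * (suc x ^ d) ^ κ * (h ^ (2 * κ) * 3 ^ (κ * d))
        ≤⟨ *-monoˡ-≤ (h ^ (2 * κ) * 3 ^ (κ * d)) (*-mono-≤ (proj₂ (poly<exp 80 κ) d D≤d) (sucx^ d)) ⟩
      2 ^ d * (2 ^ d * x ^ (κ * d)) * (h ^ (2 * κ) * 3 ^ (κ * d))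
        ≡⟨ solve 3 (λ t y z → t :* (t :* y) :* z := y :* (z :* (t :* t))) refl (2 ^ d) (x ^ (κ * d)) (h ^ (2 * κ) * 3 ^ (κ * d)) ⟩
      x ^ (κ * d) * (h ^ (2 * κ) * 3 ^ (κ * d) * (2 ^ d * 2 ^ d))
        ≡⟨ cong (λ z → x ^ (κ * d) * (h ^ (2 * κ) * 3 ^ (κ * d) * z)) (sym (^-distribʳ-*ℕ d 2 2)) ⟩
      x ^ (κ * d) * (h ^ (2 * κ) * 3 ^ (κ * d) * 4 ^ d) ∎)
    where
    open ≤-Reasoning
    m = proj₁ (pell (2 * κ))
    l = proj₂ (pell (2 * κ))
    n = m + l
    r = 4 * (m * n)
    c = 3 * (m * m) + n * n
    x = 12 * (m * m * (n * n))
    1≤m : 1 ≤ m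
    1≤m = ≤-trans (s≤s z≤n) (proj₁ (pell-large (2 * κ)))
    x≢0 : NonZero x
    x≢0 = >-nonZero (*-mono-≤ {1} {12} (s≤s z≤n) (*-mono-≤ (*-mono-≤ 1≤m 1≤m) (*-mono-≤ 1≤n 1≤n)))
      where
      1≤n : 1 ≤ n
      1≤n = ≤-trans 1≤m (m≤m+n m l)
    3rr : 3 * (r * r) ≡ 4 * x
    3rr = solve 2 (λ m n → con 3 :* (con 4 :* (m :* n) :* (con 4 :* (m :* n))) := con 4 :* (con 12 :* (m :* m :* (n :* n)))) refl m n
    nn : n * n ≡ 3 * (m * m) + 1
    nn = begin-equality
      (m + l) * (m + l)               ≡⟨ solve 2 (λ m l → (m :+ l) :* (m :+ l) := m :* m :+ (con 2 :* m :* l :+ l :* l)) refl m l ⟩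
      m * m + (2 * m * l + l * l)     ≡⟨ cong (m * m +_) (pell-equation (2 * κ)) ⟩
      m * m + (2 * (m * m) + 1)       ≡⟨ solve 1 (λ y → y :+ (con 2 :* y :+ con 1) := con 3 :* y :+ con 1) refl (m * m) ⟩
      3 * (m * m) + 1 ∎
    cc : c * c ≡ suc x
    cc = begin-equality
      c * c
        ≡⟨ cong (λ y → (3 * (m * m) + y) * (3 * (m * m) + y)) nn ⟩
      (3 * (m * m) + (3 * (m * m) + 1)) * (3 * (m * m) + (3 * (m * m) + 1))
        ≡⟨ solve 1 (λ y → (con 3 :* y :+ (con 3 :* y :+ con 1)) :* (con 3 :* y :+ (con 3 :* y :+ con 1))
             := con 1 :+ con 12 :* (y :* (con 3 :* y :+ con 1))) refl (m * m) ⟩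
      suc (12 * (m * m * (3 * (m * m) + 1)))
        ≡⟨ cong (λ y → suc (12 * (m * m * y))) (sym nn) ⟩
      suc x ∎
    2κ≤ : 2 * κ ≤ suc x
    2κ≤ = begin
      2 * κ             ≤⟨ n≤1+n (2 * κ) ⟩
      suc (2 * κ)       ≤⟨ proj₁ (pell-large (2 * κ)) ⟩
      m                 ≤⟨ m≤m*n m m {{>-nonZero 1≤m}} ⟩
      m * m             ≤⟨ m≤n*m (m * m) 3 ⟩
      3 * (m * m)       ≤⟨ m≤m+n (3 * (m * m)) (n * n) ⟩
      c                 ≤⟨ m≤m*n c c {{>-nonZero (≤-trans (*-mono-≤ 1≤m 1≤m) (≤-trans (m≤n*m (m * m) 3) (m≤m+n (3 * (m * m)) (n * n))))}} ⟩
      c * c             ≡⟨ cc ⟩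
      suc x ∎
    κd : ∀ b d → (b ^ d) ^ κ ≡ b ^ (κ * d)
    κd b d = trans (^-*-assoc b d κ) (cong (b ^_) (*-comm d κ))
    sucx^ : ∀ d → (suc x ^ d) ^ κ ≤ 2 ^ d * x ^ (κ * d)
    sucx^ d = begin
      (suc x ^ d) ^ κ        ≡⟨ ^-swap (suc x) d κ ⟩
      (suc x ^ κ) ^ d        ≤⟨ ^-monoˡ-≤ d (suc^≤2* x κ 2κ≤) ⟩
      (2 * x ^ κ) ^ d        ≡⟨ ^-distribʳ-*ℕ d 2 (x ^ κ) ⟩
      2 ^ d * (x ^ κ) ^ d    ≡⟨ cong (2 ^ d *_) (^-*-assoc x κ d) ⟩
      2 ^ d * x ^ (κ * d) ∎
    base : ∀ d h → LowerWitness m l d h → (3 * (r * r)) ^ d ≤ 80 * (suc d * suc d) * suc x ^ d * (h * h * 3 ^ d)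
    base d h wit = begin
      (3 * (r * r)) ^ d
        ≡⟨ trans (^-distribʳ-*ℕ d 3 (r * r)) (cong (3 ^ d *_) (^-distribʳ-*ℕ d r r)) ⟩
      3 ^ d * (r ^ d * r ^ d)
        ≤⟨ *-monoʳ-≤ (3 ^ d) wit ⟩
      3 ^ d * (suc d * suc d * (80 * (c ^ d * (c ^ d * (h * h)))))
        ≡⟨ solve 4 (λ t s c h → t :* (s :* (con 80 :* (c :* (c :* h)))) := con 80 :* s :* (c :* c) :* (h :* t)) refl (3 ^ d) (suc d * suc d) (c ^ d) (h * h) ⟩
      80 * (suc d * suc d) * (c ^ d * c ^ d) * (h * h * 3 ^ d)
        ≡⟨ cong (λ z → 80 * (suc d * suc d) * z * (h * h * 3 ^ d)) (trans (sym (^-distribʳ-*ℕ d c c)) (cong (_^ d) cc)) ⟩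
      80 * (suc d * suc d) * suc x ^ d * (h * h * 3 ^ d) ∎

open Arithmetic using (taylor; ^-distribʳ-*ℕ; UpperWitness; LowerWitness; upper-arithmetic; lower-arithmetic; pell; pell-large)

open import Data.Rational.Base as ℚ using (ℚ; 0ℚ; 1ℚ; ½; _+_; _*_; _-_; -_; _≤_; _<_; mkℚ)
open import Data.Rational.Properties as ℚ using ()
open import Data.Rational.Solver using (module +-*-Solver)
open SemiringSum (CommutativeRing.semiring ℚ.+-*-commutativeRing) using (sum; sum-syntax; sum-cong-≗; sum-remove; sum-replicate-zero; ∑-distrib-+; ∑-comm; *-distribˡ-sum)
open Exp (CommutativeRing.commutativeSemiring ℚ.+-*-commutativeRing) using (_^_; ^-distrib-*)
open +-*-Solver using (solve; _:=_; _:+_; _:*_; _:-_; :-_; con)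

-- Ordered-field arithmetic and finite sums over ℚ.

x≤y⇒0≤y-x : ∀ {x y} → x ≤ y → 0ℚ ≤ y - x
x≤y⇒0≤y-x {x} {y} x≤y = subst (_≤ y - x) (ℚ.+-inverseʳ x) (ℚ.+-monoˡ-≤ (- x) x≤y)

≤-by : ∀ {x y} d → 0ℚ ≤ d → y ≡ x + d → x ≤ y
≤-by {x} d 0≤d refl = subst (_≤ x + d) (ℚ.+-identityʳ x) (ℚ.+-monoʳ-≤ x 0≤d)

0≤y-x⇒x≤y : ∀ {x y} → 0ℚ ≤ y - x → x ≤ y
0≤y-x⇒x≤y {x} {y} 0≤y-x = ≤-by (y - x) 0≤y-x (solve 2 (λ x y → y := x :+ (y :- x)) refl x y)

x-y≤x : ∀ {x y} → 0ℚ ≤ y → x - y ≤ x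
x-y≤x {x} {y} 0≤y = ≤-by y 0≤y (solve 2 (λ x y → x := (x :- y) :+ y) refl x y)

y≤x+y : ∀ x y → 0ℚ ≤ x → y ≤ x + y
y≤x+y x y 0≤x = ≤-by x 0≤x (ℚ.+-comm x y)

0≤x+y : ∀ {x y} → 0ℚ ≤ x → 0ℚ ≤ y → 0ℚ ≤ x + y
0≤x+y = ℚ.+-mono-≤

0≤x*y : ∀ {x y} → 0ℚ ≤ x → 0ℚ ≤ y → 0ℚ ≤ x * y
0≤x*y {x} {y} 0≤x 0≤y = ℚ.nonNegative⁻¹ (x * y)
  {{ℚ.nonNeg*nonNeg⇒nonNeg x {{ℚ.nonNegative 0≤x}} y {{ℚ.nonNegative 0≤y}}}}

0<x*y : ∀ {x y} → 0ℚ < x → 0ℚ < y → 0ℚ < x * y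
0<x*y {x} {y} 0<x 0<y = ℚ.positive⁻¹ (x * y)
  {{ℚ.pos*pos⇒pos x {{ℚ.positive 0<x}} y {{ℚ.positive 0<y}}}}

*-monoˡ-≤ : ∀ {x y z} → 0ℚ ≤ z → x ≤ y → z * x ≤ z * y
*-monoˡ-≤ {z = z} 0≤z = ℚ.*-monoˡ-≤-nonNeg z {{ℚ.nonNegative 0≤z}}

*-monoʳ-≤ : ∀ {x y z} → 0ℚ ≤ z → x ≤ y → x * z ≤ y * z
*-monoʳ-≤ {z = z} 0≤z = ℚ.*-monoʳ-≤-nonNeg z {{ℚ.nonNegative 0≤z}}

*-mono-≤ : ∀ {x y u v} → 0ℚ ≤ u → 0ℚ ≤ y → x ≤ y → u ≤ v → x * u ≤ y * v
*-mono-≤ 0≤u 0≤y x≤y u≤v = ℚ.≤-trans (*-monoʳ-≤ 0≤u x≤y) (*-monoˡ-≤ 0≤y u≤v)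

*-cancelˡ-≤ : ∀ {x y z} → 0ℚ < z → z * x ≤ z * y → x ≤ y
*-cancelˡ-≤ {z = z} 0<z = ℚ.*-cancelˡ-≤-pos z {{ℚ.positive 0<z}}

0≤x*x : ∀ x → 0ℚ ≤ x * x
0≤x*x x with ℚ.≤-total 0ℚ x
... | inj₁ 0≤x = 0≤x*y 0≤x 0≤x
... | inj₂ x≤0 = subst (0ℚ ≤_) (solve 1 (λ x → (:- x) :* (:- x) := x :* x) refl x) (0≤x*y 0≤-x 0≤-x)
  where
  0≤-x : 0ℚ ≤ - x
  0≤-x = ℚ.neg-antimono-≤ x≤0

x*x≡0⇒x≡0 : ∀ {x} → x * x ≡ 0ℚ → x ≡ 0ℚ
x*x≡0⇒x≡0 {x} xx≡0 with ℚ.<-cmp x 0ℚ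
... | tri< x<0 _ _ = contradiction
  (trans (sym xx≡0) (solve 1 (λ x → x :* x := (:- x) :* (:- x)) refl x))
  (ℚ.<⇒≢ (0<x*y (ℚ.neg-antimono-< x<0) (ℚ.neg-antimono-< x<0)))
... | tri≈ _ x≡0 _ = x≡0
... | tri> _ _ 0<x = contradiction (sym xx≡0) (ℚ.<⇒≢ (0<x*y 0<x 0<x))

-- inv 0 = 0.
inv : ℚ → ℚ
inv x with x ℚ.≟ 0ℚ
... | yes _ = 0ℚ
... | no x≢0 = ℚ.1/_ x {{ℚ.≢-nonZero x≢0}}

*-inv : ∀ {x} → x ≢ 0ℚ → x * inv x ≡ 1ℚ
*-inv {x} x≢0 with x ℚ.≟ 0ℚ
... | yes x≡0 = contradiction x≡0 x≢0
... | no x≢0 = ℚ.*-inverseʳ x {{ℚ.≢-nonZero x≢0}}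

-- The hypothesis covers x = 0. Coefficients along a null vector do vanish, so Gram-Schmidt never
-- has to discard a zero residual.
*-inv-* : ∀ c x → (x ≡ 0ℚ → c ≡ 0ℚ) → c * inv x * x ≡ c
*-inv-* c x c≡0 with x ℚ.≟ 0ℚ
... | yes x≡0 = trans (cong₂ _*_ (ℚ.*-zeroʳ c) x≡0) (sym (c≡0 x≡0))
... | no x≢0 = trans (ℚ.*-assoc c _ x)
  (trans (cong (c *_) (ℚ.*-inverseˡ x {{ℚ.≢-nonZero x≢0}})) (ℚ.*-identityʳ c))

0≤inv : ∀ {x} → 0ℚ ≤ x → 0ℚ ≤ inv x
0≤inv {x} 0≤x with x ℚ.≟ 0ℚ
... | yes _ = ℚ.≤-refl
... | no x≢0 = ℚ.<⇒≤ (ℚ.positive⁻¹ _ {{ℚ.1/pos⇒pos x {{x-pos}}}})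
  where
  x-pos : ℚ.Positive x
  x-pos = ℚ.nonNeg∧nonZero⇒pos x {{ℚ.nonNegative 0≤x}} {{ℚ.≢-nonZero x≢0}}

sum-mono-≤ : ∀ {n} {f g : Vector ℚ n} → (∀ i → f i ≤ g i) → sum f ≤ sum g
sum-mono-≤ {zero} f≤g = ℚ.≤-refl
sum-mono-≤ {suc n} f≤g = ℚ.+-mono-≤ (f≤g zero) (sum-mono-≤ (f≤g ∘ suc))

sum-zero : ∀ {n} {f : Vector ℚ n} → (∀ i → f i ≡ 0ℚ) → sum f ≡ 0ℚ
sum-zero {n} f≡0 = trans (sum-cong-≗ f≡0) (sum-replicate-zero n)

0≤sum : ∀ {n} {f : Vector ℚ n} → (∀ i → 0ℚ ≤ f i) → 0ℚ ≤ sum f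
0≤sum {n} {f} 0≤f = subst (_≤ sum f) (sum-replicate-zero n) (sum-mono-≤ 0≤f)

sum-at : ∀ {n} (f : Vector ℚ n) j → (∀ i → i ≢ j → f i ≡ 0ℚ) → sum f ≡ f j
sum-at {suc n} f j f≡0 = trans (sum-remove {i = j} f)
  (trans (cong (f j +_) (sum-zero (λ i → f≡0 (punchIn j i) (punchInᵢ≢i j i)))) (ℚ.+-identityʳ (f j)))

term≤sum : ∀ {n} (f : Vector ℚ n) j → (∀ i → 0ℚ ≤ f i) → f j ≤ sum f
term≤sum {suc n} f j 0≤f = ≤-by (sum (removeAt f j)) (0≤sum (0≤f ∘ punchIn j)) (sum-remove {i = j} f)

sum-≡0⇒≡0 : ∀ {n} {f : Vector ℚ n} → (∀ i → 0ℚ ≤ f i) → sum f ≡ 0ℚ → ∀ i → f i ≡ 0ℚ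
sum-≡0⇒≡0 {f = f} 0≤f Σ≡0 i = ℚ.≤-antisym (subst (f i ≤_) Σ≡0 (term≤sum f i 0≤f)) (0≤f i)

sum-neg : ∀ {n} (f : Vector ℚ n) → sum (λ i → - f i) ≡ - sum f
sum-neg f = trans (sum-cong-≗ λ i → sym (-1*x≡-x (f i)))
  (trans (sym (*-distribˡ-sum (- 1ℚ) f)) (-1*x≡-x (sum f)))
  where
  -1*x≡-x : ∀ x → (- 1ℚ) * x ≡ - x
  -1*x≡-x = solve 1 (λ x → con (- 1ℚ) :* x := :- x) refl

sum-minus : ∀ {n} (f g : Vector ℚ n) → ∑[ i < n ] (f i - g i) ≡ sum f - sum g
sum-minus f g = trans (∑-distrib-+ f (λ i → - g i)) (cong (sum f +_) (sum-neg g))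

-- The averaging principle behind the selection of the flat direction, the heavy class, the next
-- column and the worst row.
sum-≤⇒∃≤ : ∀ {n} .{{_ : ℕ.NonZero n}} (f g : Vector ℚ n) → sum f ≤ sum g → ∃[ i ] f i ≤ g i
sum-≤⇒∃≤ {n} f g Σf≤Σg with any? (λ i → f i ℚ.≤? g i)
... | yes ∃≤ = ∃≤
... | no ∄≤ = contradiction (ℚ.<-≤-trans (sum-mono-< λ i → ℚ.≰⇒> (λ fi≤gi → ∄≤ (i , fi≤gi))) Σf≤Σg)
  (ℚ.<-irrefl refl)
  where
  sum-mono-< : ∀ {n} .{{_ : ℕ.NonZero n}} {f g : Vector ℚ n} → (∀ i → f i < g i) → sum f < sum g
  sum-mono-< {suc n} f<g = ℚ.+-mono-<-≤ (f<g zero) (sum-mono-≤ (ℚ.<⇒≤ ∘ f<g ∘ suc))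

-- Weighted inner products, orthogonal families and Bessel's inequality.

ℚ^_ : ℕ → Set
ℚ^ n = Vector ℚ n

lin : ∀ {m K} → (Fin m → ℚ) → (Fin m → ℚ^ K) → ℚ^ K
lin {m} c v k = ∑[ i < m ] (c i * v i k)

module InnerProduct {K} (w : ℚ^ K) (0≤w : ∀ k → 0ℚ ≤ w k) where

  ⟪_,_⟫ : ℚ^ K → ℚ^ K → ℚ
  ⟪ f , g ⟫ = ∑[ k < K ] (w k * (f k * g k))

  ⟪⟫-cong : ∀ {f f′ g g′} → f ≗ f′ → g ≗ g′ → ⟪ f , g ⟫ ≡ ⟪ f′ , g′ ⟫
  ⟪⟫-cong f≗f′ g≗g′ = sum-cong-≗ λ k → cong (w k *_) (cong₂ _*_ (f≗f′ k) (g≗g′ k))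

  ⟪⟫-comm : ∀ f g → ⟪ f , g ⟫ ≡ ⟪ g , f ⟫
  ⟪⟫-comm f g = sum-cong-≗ λ k → cong (w k *_) (ℚ.*-comm (f k) (g k))

  0≤⟪f,f⟫ : ∀ f → 0ℚ ≤ ⟪ f , f ⟫
  0≤⟪f,f⟫ f = 0≤sum λ k → 0≤x*y (0≤w k) (0≤x*x (f k))

  ⟪⟫-minusˡ : ∀ f g h → ⟪ (λ k → f k - g k) , h ⟫ ≡ ⟪ f , h ⟫ - ⟪ g , h ⟫
  ⟪⟫-minusˡ f g h = trans
    (sum-cong-≗ λ k → solve 4 (λ w f g h → w :* ((f :- g) :* h) := w :* (f :* h) :- w :* (g :* h)) refl (w k) (f k) (g k) (h k))
    (sum-minus (λ k → w k * (f k * h k)) (λ k → w k * (g k * h k)))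

  ⟪⟫-plusˡ : ∀ f g h → ⟪ (λ k → f k + g k) , h ⟫ ≡ ⟪ f , h ⟫ + ⟪ g , h ⟫
  ⟪⟫-plusˡ f g h = trans
    (sum-cong-≗ λ k → solve 4 (λ w f g h → w :* ((f :+ g) :* h) := w :* (f :* h) :+ w :* (g :* h)) refl (w k) (f k) (g k) (h k))
    (∑-distrib-+ (λ k → w k * (f k * h k)) (λ k → w k * (g k * h k)))

  ⟪⟫-scaleˡ : ∀ t f g → ⟪ (λ k → t * f k) , g ⟫ ≡ t * ⟪ f , g ⟫
  ⟪⟫-scaleˡ t f g = trans
    (sum-cong-≗ λ k → solve 4 (λ w t f g → w :* ((t :* f) :* g) := t :* (w :* (f :* g))) refl (w k) t (f k) (g k))
    (sym (*-distribˡ-sum t (λ k → w k * (f k * g k))))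

  ⟪⟫-linˡ : ∀ {m} (c : Fin m → ℚ) v g → ⟪ lin c v , g ⟫ ≡ ∑[ i < m ] (c i * ⟪ v i , g ⟫)
  ⟪⟫-linˡ {m} c v g = begin
    ∑[ k < K ] (w k * (lin c v k * g k))
      ≡⟨ sum-cong-≗ (λ k → trans (solve 3 (λ w l g → w :* (l :* g) := (w :* g) :* l) refl (w k) (lin c v k) (g k))
           (*-distribˡ-sum (w k * g k) (λ i → c i * v i k))) ⟩
    ∑[ k < K ] ∑[ i < m ] (w k * g k * (c i * v i k))
      ≡⟨ ∑-comm (λ k i → w k * g k * (c i * v i k)) ⟩
    ∑[ i < m ] ∑[ k < K ] (w k * g k * (c i * v i k))
      ≡⟨ sum-cong-≗ (λ i → trans
           (sum-cong-≗ λ k → solve 4 (λ w g c v → w :* g :* (c :* v) := c :* (w :* (v :* g))) refl (w k) (g k) (c i) (v i k))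
           (sym (*-distribˡ-sum (c i) (λ k → w k * (v i k * g k))))) ⟩
    ∑[ i < m ] (c i * ⟪ v i , g ⟫) ∎
    where open ≡-Reasoning

  -- The form is only semidefinite, since weights may vanish. Each summand w f² is zero, hence so is
  -- (w f)² and with it w f itself.
  ⟪f,f⟫≡0⇒⟪f,g⟫≡0 : ∀ f g → ⟪ f , f ⟫ ≡ 0ℚ → ⟪ f , g ⟫ ≡ 0ℚ
  ⟪f,f⟫≡0⇒⟪f,g⟫≡0 f g ff≡0 = sum-zero λ k → begin
    w k * (f k * g k) ≡⟨ ℚ.*-assoc (w k) (f k) (g k) ⟨
    w k * f k * g k   ≡⟨ cong (_* g k) (x*x≡0⇒x≡0 {w k * f k} (trans
                           (solve 2 (λ w f → w :* f :* (w :* f) := w :* (w :* (f :* f))) refl (w k) (f k))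
                           (trans (cong (w k *_) (sum-≡0⇒≡0 (λ k → 0≤x*y (0≤w k) (0≤x*x (f k))) ff≡0 k)) (ℚ.*-zeroʳ (w k))))) ⟩
    0ℚ * g k          ≡⟨ ℚ.*-zeroˡ (g k) ⟩
    0ℚ ∎
    where open ≡-Reasoning

  -- Wrapped in a record so that the family can be inferred from the proof of its orthogonality.
  record Orthogonal {m} (g : Fin m → ℚ^ K) : Set where
    constructor orthogonal
    field
      pairwise : ∀ i j → i ≢ j → ⟪ g i , g j ⟫ ≡ 0ℚ

  open Orthogonal public

  module _ {m} {g : Fin m → ℚ^ K} (g⊥ : Orthogonal g) where

    ⟪lin,g⟫ : ∀ c j → ⟪ lin c g , g j ⟫ ≡ c j * ⟪ g j , g j ⟫
    ⟪lin,g⟫ c j = trans (⟪⟫-linˡ c g (g j)) (sum-at (λ i → c i * ⟪ g i , g j ⟫) j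
      λ i i≢j → trans (cong (c i *_) (pairwise g⊥ i j i≢j)) (ℚ.*-zeroʳ (c i)))

    -- One identity serves two choices of c: c = ⟪ f , g i ⟫ yields Bessel for vectors of norm at
    -- most 1 without any division, and the true coefficients make the inner difference vanish and
    -- give the exact norm of the residual.
    ∣f-lin∣² : ∀ f c → ⟪ (λ k → f k - lin c g k) , (λ k → f k - lin c g k) ⟫
      ≡ ⟪ f , f ⟫ - ∑[ i < m ] (c i * (⟪ f , g i ⟫ + (⟪ f , g i ⟫ - c i * ⟪ g i , g i ⟫)))
    ∣f-lin∣² f c = begin
      ⟪ r , r ⟫
        ≡⟨ ⟪⟫-minusˡ f L r ⟩
      ⟪ f , r ⟫ - ⟪ L , r ⟫
        ≡⟨ cong₂ _-_ (trans (⟪⟫-comm f r) (trans (⟪⟫-minusˡ f L f) (cong (λ x → ⟪ f , f ⟫ - x) (⟪⟫-linˡ c g f)))) (⟪⟫-linˡ c g r) ⟩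
      (⟪ f , f ⟫ - ∑[ i < m ] (c i * ⟪ g i , f ⟫)) - ∑[ i < m ] (c i * ⟪ g i , r ⟫)
        ≡⟨ solve 3 (λ x y z → (x :- y) :- z := x :- (y :+ z)) refl ⟪ f , f ⟫ _ _ ⟩
      ⟪ f , f ⟫ - (∑[ i < m ] (c i * ⟪ g i , f ⟫) + ∑[ i < m ] (c i * ⟪ g i , r ⟫))
        ≡⟨ cong (λ x → ⟪ f , f ⟫ - x) (trans (sym (∑-distrib-+ (λ i → c i * ⟪ g i , f ⟫) (λ i → c i * ⟪ g i , r ⟫)))
             (sum-cong-≗ λ i → trans (sym (ℚ.*-distribˡ-+ (c i) _ _)) (cong (c i *_) (cong₂ _+_ (⟪⟫-comm (g i) f)
               (trans (⟪⟫-comm (g i) r) (trans (⟪⟫-minusˡ f L (g i)) (cong (λ x → ⟪ f , g i ⟫ - x) (⟪lin,g⟫ c i)))))))) ⟩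
      ⟪ f , f ⟫ - ∑[ i < m ] (c i * (⟪ f , g i ⟫ + (⟪ f , g i ⟫ - c i * ⟪ g i , g i ⟫))) ∎
      where
      open ≡-Reasoning
      L = lin c g
      r : ℚ^ K
      r k = f k - L k

    bessel-unit : (∀ i → ⟪ g i , g i ⟫ ≤ 1ℚ) → ∀ f → ∑[ i < m ] (⟪ f , g i ⟫ * ⟪ f , g i ⟫) ≤ ⟪ f , f ⟫
    bessel-unit g≤1 f = ℚ.≤-trans
      (sum-mono-≤ λ i → ≤-by (⟪ f , g i ⟫ * ⟪ f , g i ⟫ * (1ℚ - ⟪ g i , g i ⟫))
        (0≤x*y (0≤x*x ⟪ f , g i ⟫) (x≤y⇒0≤y-x (g≤1 i)))
        (solve 2 (λ c n → c :* (c :+ (c :- c :* n)) := c :* c :+ c :* c :* (con 1ℚ :- n)) refl ⟪ f , g i ⟫ ⟪ g i , g i ⟫))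
      (0≤y-x⇒x≤y (subst (0ℚ ≤_) (∣f-lin∣² f c) (0≤⟪f,f⟫ (λ k → f k - lin c g k))))
      where
      c : Fin m → ℚ
      c i = ⟪ f , g i ⟫

    coeff : ℚ^ K → Fin m → ℚ
    coeff f i = ⟪ f , g i ⟫ * inv ⟪ g i , g i ⟫

    residual : ℚ^ K → ℚ^ K
    residual f k = f k - lin (coeff f) g k

    coeff-∣g∣² : ∀ f i → coeff f i * ⟪ g i , g i ⟫ ≡ ⟪ f , g i ⟫
    coeff-∣g∣² f i = *-inv-* ⟪ f , g i ⟫ ⟪ g i , g i ⟫
      λ gg≡0 → trans (⟪⟫-comm f (g i)) (⟪f,f⟫≡0⇒⟪f,g⟫≡0 (g i) f gg≡0)

    residual-⊥ : ∀ f j → ⟪ residual f , g j ⟫ ≡ 0ℚ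
    residual-⊥ f j = trans (⟪⟫-minusˡ f (lin (coeff f) g) (g j))
      (trans (cong (λ x → ⟪ f , g j ⟫ - x) (trans (⟪lin,g⟫ (coeff f) j) (coeff-∣g∣² f j))) (ℚ.+-inverseʳ ⟪ f , g j ⟫))

    ∣residual∣² : ∀ f → ⟪ residual f , residual f ⟫
      ≡ ⟪ f , f ⟫ - ∑[ i < m ] (⟪ f , g i ⟫ * ⟪ f , g i ⟫ * inv ⟪ g i , g i ⟫)
    ∣residual∣² f = trans (∣f-lin∣² f (coeff f)) (cong (λ x → ⟪ f , f ⟫ - x) (sum-cong-≗ λ i → trans
      (cong (λ x → coeff f i * (⟪ f , g i ⟫ + (⟪ f , g i ⟫ - x))) (coeff-∣g∣² f i))
      (solve 2 (λ c x → c :* x :* (c :+ (c :- c)) := c :* c :* x) refl ⟪ f , g i ⟫ (inv ⟪ g i , g i ⟫))))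

    bessel : ∀ f → ∑[ i < m ] (⟪ f , g i ⟫ * ⟪ f , g i ⟫ * inv ⟪ g i , g i ⟫) ≤ ⟪ f , f ⟫
    bessel f = 0≤y-x⇒x≤y (subst (0ℚ ≤_) (∣residual∣² f) (0≤⟪f,f⟫ (residual f)))

    ∣residual∣²≤ : ∀ f → ⟪ residual f , residual f ⟫ ≤ ⟪ f , f ⟫
    ∣residual∣²≤ f = subst (_≤ ⟪ f , f ⟫) (sym (∣residual∣² f))
      (x-y≤x (0≤sum λ i → 0≤x*y (0≤x*x ⟪ f , g i ⟫) (0≤inv (0≤⟪f,f⟫ (g i)))))

-- The integers inside ℚ, powers, and a second-order estimate.

-- Given directly with denominator 1, because `_/_` normalises by a gcd, which is stuck on
-- variables.
ιℤ : ℤ → ℚ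
ιℤ z = mkℚ z 0 (Coprime.sym (Coprime.1-coprimeTo _))

ι : ℕ → ℚ
ι n = ιℤ (ℤ.+ n)

ιℤ≡/1 : ∀ z → z ℚ./ 1 ≡ ιℤ z
ιℤ≡/1 z = ℚ.↥p/↧p≡p (ιℤ z)

ιℤ-+ : ∀ a b → ιℤ (a ℤ.+ b) ≡ ιℤ a + ιℤ b
ιℤ-+ a b = trans (sym (ιℤ≡/1 (a ℤ.+ b))) (cong (ℚ._/ 1) (sym (cong₂ ℤ._+_ (ℤ.*-identityʳ a) (ℤ.*-identityʳ b))))

ιℤ-* : ∀ a b → ιℤ (a ℤ.* b) ≡ ιℤ a * ιℤ b
ιℤ-* a b = sym (ιℤ≡/1 (a ℤ.* b))

ι-+ : ∀ a b → ι (a ℕ.+ b) ≡ ι a + ι b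
ι-+ a b = ιℤ-+ (ℤ.+ a) (ℤ.+ b)

ι-suc : ∀ n → ι (suc n) ≡ 1ℚ + ι n
ι-suc n = ι-+ 1 n

ι-* : ∀ a b → ι (a ℕ.* b) ≡ ι a * ι b
ι-* a b = trans (cong ιℤ (ℤ.pos-* a b)) (ιℤ-* (ℤ.+ a) (ℤ.+ b))

ι-^ : ∀ a n → ι (a ℕ.^ n) ≡ ι a ^ n
ι-^ a zero = refl
ι-^ a (suc n) = trans (ι-* a (a ℕ.^ n)) (cong (ι a *_) (ι-^ a n))

ι-mono-≤ : ∀ {a b} → a ℕ.≤ b → ι a ≤ ι b
ι-mono-≤ {a} {b} a≤b = ℚ.*≤* (subst₂ ℤ._≤_ (sym (ℤ.*-identityʳ (ℤ.+ a))) (sym (ℤ.*-identityʳ (ℤ.+ b))) (ℤ.+≤+ a≤b))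

ι-cancel-≤ : ∀ {a b} → ι a ≤ ι b → a ℕ.≤ b
ι-cancel-≤ {a} {b} a≤b = ℤ.drop‿+≤+ (subst₂ ℤ._≤_ (ℤ.*-identityʳ (ℤ.+ a)) (ℤ.*-identityʳ (ℤ.+ b)) (ℚ.drop-*≤* a≤b))

0≤ι : ∀ n → 0ℚ ≤ ι n
0≤ι n = ι-mono-≤ {0} ℕ.z≤n

0<ι : ∀ n .{{_ : ℕ.NonZero n}} → 0ℚ < ι n
0<ι (suc n) = ℚ.<-≤-trans (ℚ.positive⁻¹ 1ℚ) (ι-mono-≤ {1} (ℕ.s≤s ℕ.z≤n))

sum-const : ∀ n c → ∑[ i < n ] c ≡ ι n * c
sum-const zero c = sym (ℚ.*-zeroˡ c)
sum-const (suc n) c = trans (cong (c +_) (sum-const n c))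
  (trans (solve 2 (λ c n → c :+ n :* c := (con 1ℚ :+ n) :* c) refl c (ι n)) (cong (_* c) (sym (ι-suc n))))

0≤x^n : ∀ {x} n → 0ℚ ≤ x → 0ℚ ≤ x ^ n
0≤x^n zero 0≤x = ℚ.nonNegative⁻¹ 1ℚ
0≤x^n (suc n) 0≤x = 0≤x*y 0≤x (0≤x^n n 0≤x)

0<x^n : ∀ {x} n → 0ℚ < x → 0ℚ < x ^ n
0<x^n zero 0<x = ℚ.positive⁻¹ 1ℚ
0<x^n (suc n) 0<x = 0<x*y 0<x (0<x^n n 0<x)

^-mono-≤ : ∀ {x y} n → 0ℚ ≤ x → x ≤ y → x ^ n ≤ y ^ n
^-mono-≤ zero 0≤x x≤y = ℚ.≤-refl
^-mono-≤ (suc n) 0≤x x≤y = *-mono-≤ (0≤x^n n 0≤x) (ℚ.≤-trans 0≤x x≤y) x≤y (^-mono-≤ n 0≤x x≤y)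

1^n≡1 : ∀ n → 1ℚ ^ n ≡ 1ℚ
1^n≡1 zero = refl
1^n≡1 (suc n) = trans (ℚ.*-identityˡ (1ℚ ^ n)) (1^n≡1 n)

-- The linear coefficient is the exact derivative of (R + s²)^(q+1), so a suitable choice of the
-- sign of t makes the first-order part of a whole sum nonpositive. The hypothesis t² ≤ R lets a
-- multiple of t² (R + s²)^q bound all higher terms, uniformly in s.
taylor-≤ : ∀ q R s t → t * t ≤ R → (R + (s + t) * (s + t)) ^ suc q
  ≤ (R + s * s) ^ q * (R + s * s + (ι 2 * ι (suc q) * (s * t) + ι (taylor q) * (t * t)))
taylor-≤ zero R s t tt≤R = ℚ.≤-reflexive (solve 3 (λ R s t →
  (R :+ (s :+ t) :* (s :+ t)) :* con 1ℚ :=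
  con 1ℚ :* (R :+ s :* s :+ (con (ι 2) :* con 1ℚ :* (s :* t) :+ con 1ℚ :* (t :* t)))) refl R s t)
taylor-≤ (suc q) R s t tt≤R = ℚ.≤-trans (*-monoˡ-≤ 0≤X (taylor-≤ q R s t tt≤R))
  (≤-by ((R + s * s) ^ q * D) (0≤x*y (0≤x^n q 0≤B) 0≤D) eq)
  where
  k n : ℚ
  k = ι (taylor q)
  n = ι (suc q)
  0≤R : 0ℚ ≤ R
  0≤R = ℚ.≤-trans (0≤x*x t) tt≤R
  0≤X : 0ℚ ≤ R + (s + t) * (s + t)
  0≤X = 0≤x+y 0≤R (0≤x*x (s + t))
  0≤B : 0ℚ ≤ R + s * s
  0≤B = 0≤x+y 0≤R (0≤x*x s)
  0≤k : 0ℚ ≤ k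
  0≤k = 0≤ι (taylor q)
  0≤n : 0ℚ ≤ n
  0≤n = 0≤ι (suc q)
  -- The slack of the induction step divided by (R + s²)^q, arranged so that each summand is visibly
  -- nonnegative.
  D : ℚ
  D = t * t * ((R - t * t) * (ι 2 * k + ι 5 * n) + ((k + n) * ((s - t) * (s - t)) + (k * (s * s) + ι 4 * n * (t * t))))
  0≤D : 0ℚ ≤ D
  0≤D = 0≤x*y (0≤x*x t) (0≤x+y
    (0≤x*y (x≤y⇒0≤y-x tt≤R) (0≤x+y (0≤x*y (0≤ι 2) 0≤k) (0≤x*y (0≤ι 5) 0≤n)))
    (0≤x+y (0≤x*y (0≤x+y 0≤k 0≤n) (0≤x*x (s - t)))
      (0≤x+y (0≤x*y 0≤k (0≤x*x s)) (0≤x*y (0≤x*y (0≤ι 4) 0≤n) (0≤x*x t)))))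
  n′≡ : ι (suc (suc q)) ≡ 1ℚ + n
  n′≡ = ι-suc (suc q)
  k′≡ : ι (taylor (suc q)) ≡ ι 3 * k + (ι 5 * n + 1ℚ)
  k′≡ = trans (ι-+ (3 ℕ.* taylor q) (5 ℕ.* suc q ℕ.+ 1))
    (cong₂ _+_ (ι-* 3 (taylor q)) (trans (ι-+ (5 ℕ.* suc q) 1) (cong (_+ 1ℚ) (ι-* 5 (suc q)))))
  eq : (R + s * s) ^ suc q * (R + s * s + (ι 2 * ι (suc (suc q)) * (s * t) + ι (taylor (suc q)) * (t * t)))
     ≡ (R + (s + t) * (s + t)) * ((R + s * s) ^ q * (R + s * s + (ι 2 * n * (s * t) + k * (t * t)))) + (R + s * s) ^ q * D
  eq = trans (cong₂ (λ n′ k′ → (R + s * s) ^ suc q * (R + s * s + (ι 2 * n′ * (s * t) + k′ * (t * t)))) n′≡ k′≡)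
    (solve 6 (λ R s t k n P →
      ((R :+ s :* s) :* P) :* (R :+ s :* s :+ (con (ι 2) :* (con 1ℚ :+ n) :* (s :* t) :+ (con (ι 3) :* k :+ (con (ι 5) :* n :+ con 1ℚ)) :* (t :* t)))
      := (R :+ (s :+ t) :* (s :+ t)) :* (P :* (R :+ s :* s :+ (con (ι 2) :* n :* (s :* t) :+ k :* (t :* t))))
         :+ P :* (t :* t :* ((R :- t :* t) :* (con (ι 2) :* k :+ con (ι 5) :* n) :+ ((k :+ n) :* ((s :- t) :* (s :- t)) :+ (k :* (s :* s) :+ con (ι 4) :* n :* (t :* t))))))
      refl R s t k n ((R + s * s) ^ q))

-- Walking inside the cube

In[-1,1] : ℚ → Set
In[-1,1] x = - 1ℚ ≤ x × x ≤ 1ℚ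

sgn : Sign → ℚ
sgn s = ιℤ (s ◃ 1)

Boundary : ℚ → Set
Boundary x = ∃[ s ] x ≡ sgn s

Boundary⇒In : ∀ {x} → Boundary x → In[-1,1] x
Boundary⇒In (Sign.+ , refl) = ℚ.≤ᵇ⇒≤ _ , ℚ.≤-refl
Boundary⇒In (Sign.- , refl) = ℚ.≤-refl , ℚ.≤ᵇ⇒≤ _

-x≤y⇒-y≤x : ∀ {x y} → - x ≤ y → - y ≤ x
-x≤y⇒-y≤x {x} {y} -x≤y = subst (- y ≤_) (solve 1 (λ x → :- (:- x) := x) refl x) (ℚ.neg-antimono-≤ -x≤y)

In-neg : ∀ {x} → In[-1,1] x → In[-1,1] (- x)
In-neg (lo , hi) = ℚ.neg-antimono-≤ hi , -x≤y⇒-y≤x lo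

-‿distrib-ray : ∀ y α δ → (- y) + α * (- δ) ≡ - (y + α * δ)
-‿distrib-ray = solve 3 (λ y α δ → (:- y) :+ α :* (:- δ) := :- (y :+ α :* δ)) refl

In-convex : ∀ {y δ α β} → In[-1,1] y → In[-1,1] (y + β * δ) → 0ℚ ≤ α → α ≤ β → In[-1,1] (y + α * δ)
In-convex {y} {δ} {α} {β} y∈ z∈ 0≤α α≤β = [ up y∈ z∈ , down ]′ (ℚ.≤-total 0ℚ δ)
  where
  up : ∀ {y δ} → In[-1,1] y → In[-1,1] (y + β * δ) → 0ℚ ≤ δ → In[-1,1] (y + α * δ)
  up {y} {δ} (lo , _) (_ , hi) 0≤δ =
    ℚ.≤-trans lo (≤-by (α * δ) (0≤x*y 0≤α 0≤δ) refl) ,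
    ℚ.≤-trans (ℚ.+-monoʳ-≤ y (*-monoʳ-≤ 0≤δ α≤β)) hi
  down : δ ≤ 0ℚ → In[-1,1] (y + α * δ)
  down δ≤0 = subst In[-1,1] (trans (cong -_ (-‿distrib-ray y α δ)) (solve 1 (λ x → :- (:- x) := x) refl _))
    (In-neg (up (In-neg y∈) (subst In[-1,1] (sym (-‿distrib-ray y β δ)) (In-neg z∈)) (ℚ.neg-antimono-≤ δ≤0)))

Hit : ℚ → ℚ → ℚ → Set
Hit β y δ = ∃[ α ] (0ℚ ≤ α × α ≤ β × Boundary (y + α * δ))

hit-above : ∀ {y δ β} → In[-1,1] y → 0ℚ ≤ β → 1ℚ < y + β * δ →
  ∃[ α ] (0ℚ ≤ α × α ≤ β × y + α * δ ≡ 1ℚ)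
hit-above {y} {δ} {β} (lo , hi) 0≤β z>1 = α , 0≤α , α≤β , hit
  where
  0<βδ : 0ℚ < β * δ
  0<βδ = subst₂ _<_ (ℚ.+-inverseʳ y) (solve 2 (λ y x → (y :+ x) :+ (:- y) := x) refl y (β * δ))
    (ℚ.+-monoˡ-< (- y) (ℚ.≤-<-trans hi z>1))
  0<δ : 0ℚ < δ
  0<δ = ℚ.≰⇒> λ δ≤0 → ℚ.<-irrefl refl (ℚ.<-≤-trans 0<βδ
    (subst (β * δ ≤_) (ℚ.*-zeroʳ β) (*-monoˡ-≤ 0≤β δ≤0)))
  α : ℚ
  α = (1ℚ - y) * inv δ
  αδ : α * δ ≡ 1ℚ - y
  αδ = *-inv-* (1ℚ - y) δ (λ δ≡0 → contradiction (sym δ≡0) (ℚ.<⇒≢ 0<δ))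
  hit : y + α * δ ≡ 1ℚ
  hit = trans (cong (λ x → y + x) αδ) (solve 1 (λ y → y :+ (con 1ℚ :- y) := con 1ℚ) refl y)
  0≤α : 0ℚ ≤ α
  0≤α = 0≤x*y (x≤y⇒0≤y-x hi) (0≤inv (ℚ.<⇒≤ 0<δ))
  α≤β : α ≤ β
  α≤β = ℚ.*-cancelʳ-≤-pos δ {{ℚ.positive 0<δ}} (subst₂ _≤_
    (solve 2 (λ y x → (y :+ x) :+ (:- y) := x) refl y (α * δ))
    (solve 2 (λ y x → (y :+ x) :+ (:- y) := x) refl y (β * δ))
    (ℚ.+-monoˡ-≤ (- y) (subst (_≤ y + β * δ) (sym hit) (ℚ.<⇒≤ z>1))))

stay-or-hit : ∀ {y δ β} → In[-1,1] y → 0ℚ ≤ β → In[-1,1] (y + β * δ) ⊎ Hit β y δ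
stay-or-hit {y} {δ} {β} y∈ 0≤β with (y + β * δ) ℚ.≤? 1ℚ | (- 1ℚ) ℚ.≤? (y + β * δ)
... | yes hi | yes lo = inj₁ (lo , hi)
... | no ¬hi | _ = let α , 0≤α , α≤β , eq = hit-above y∈ 0≤β (ℚ.≰⇒> ¬hi) in inj₂ (α , 0≤α , α≤β , Sign.+ , eq)
... | yes _ | no ¬lo =
  let α , 0≤α , α≤β , eq = hit-above (In-neg y∈) 0≤β
        (subst (1ℚ <_) (sym (-‿distrib-ray y β δ)) (ℚ.neg-antimono-< (ℚ.≰⇒> ¬lo)))
  in inj₂ (α , 0≤α , α≤β , Sign.- , (begin
    y + α * δ             ≡⟨ solve 3 (λ y α δ → y :+ α :* δ := :- ((:- y) :+ α :* (:- δ))) refl y α δ ⟩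
    - ((- y) + α * (- δ)) ≡⟨ cong -_ eq ⟩
    - 1ℚ ∎))
  where open ≡-Reasoning

FirstHit : ∀ {n} → ℚ → (y δ : Fin n → ℚ) → Set
FirstHit β y δ = ∃[ α ] (0ℚ ≤ α × α ≤ β × (∀ k → In[-1,1] (y k + α * δ k)) × ∃[ j ] Boundary (y j + α * δ j))

-- Induction over the coordinates with a shrinking horizon: when a coordinate leaves the cube, the
-- horizon drops to the time at which it touches the boundary, and by convexity the coordinates
-- already treated are still inside at that time.
first-hit : ∀ {n} β (y δ : Fin n → ℚ) → 0ℚ ≤ β → (∀ k → In[-1,1] (y k)) →
  (∀ k → In[-1,1] (y k + β * δ k)) ⊎ FirstHit β y δ
first-hit {zero} β y δ 0≤β y∈ = inj₁ λ ()
first-hit {suc n} β y δ 0≤β y∈ with first-hit β (y ∘ suc) (δ ∘ suc) 0≤β (y∈ ∘ suc)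
... | inj₁ all∈ = [ (λ z∈ → inj₁ λ { zero → z∈ ; (suc k) → all∈ k }) ,
    (λ { (α , 0≤α , α≤β , bd) → inj₂ (α , 0≤α , α≤β ,
      (λ { zero → Boundary⇒In bd ; (suc k) → In-convex (y∈ (suc k)) (all∈ k) 0≤α α≤β }) , zero , bd) }) ]′
  (stay-or-hit (y∈ zero) 0≤β)
... | inj₂ (β′ , 0≤β′ , β′≤β , all∈ , j , bdⱼ) = [
    (λ z∈ → inj₂ (β′ , 0≤β′ , β′≤β , (λ { zero → z∈ ; (suc k) → all∈ k }) , suc j , bdⱼ)) ,
    (λ { (α , 0≤α , α≤β′ , bd) → inj₂ (α , 0≤α , ℚ.≤-trans α≤β′ β′≤β ,
      (λ { zero → Boundary⇒In bd ; (suc k) → In-convex (y∈ (suc k)) (all∈ k) 0≤α α≤β′ }) , zero , bd) }) ]′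
  (stay-or-hit (y∈ zero) 0≤β′)

-- As |δ i| = 1, the i-th coordinate alone forces a hit at some α ≤ 2.
walk-to-boundary : ∀ {n} (y δ : Fin n → ℚ) → (∀ k → In[-1,1] (y k)) → ∀ i → δ i ≡ 1ℚ ⊎ δ i ≡ - 1ℚ →
  FirstHit (ι 2) y δ
walk-to-boundary y δ y∈ i (inj₁ δᵢ≡1) = finish
  where
  β : ℚ
  β = 1ℚ - y i
  0≤β : 0ℚ ≤ β
  0≤β = x≤y⇒0≤y-x (proj₂ (y∈ i))
  β≤2 : β ≤ ι 2
  β≤2 = ≤-by (y i - - 1ℚ) (x≤y⇒0≤y-x (proj₁ (y∈ i)))
    (solve 1 (λ y → con (ι 2) := (con 1ℚ :- y) :+ (y :- con (- 1ℚ))) refl (y i))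
  finish : FirstHit (ι 2) y δ
  finish with first-hit β y δ 0≤β y∈
  ... | inj₁ all∈ = β , 0≤β , β≤2 , all∈ , i , Sign.+ ,
    trans (cong (λ x → y i + β * x) δᵢ≡1) (solve 1 (λ y → y :+ (con 1ℚ :- y) :* con 1ℚ := con 1ℚ) refl (y i))
  ... | inj₂ (α , 0≤α , α≤β , rest) = α , 0≤α , ℚ.≤-trans α≤β β≤2 , rest
walk-to-boundary y δ y∈ i (inj₂ δᵢ≡-1) = finish
  where
  β : ℚ
  β = 1ℚ + y i
  0≤β : 0ℚ ≤ β
  0≤β = subst (0ℚ ≤_) (solve 1 (λ y → y :- con (- 1ℚ) := con 1ℚ :+ y) refl (y i)) (x≤y⇒0≤y-x (proj₁ (y∈ i)))
  β≤2 : β ≤ ι 2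
  β≤2 = ≤-by (1ℚ - y i) (x≤y⇒0≤y-x (proj₂ (y∈ i)))
    (solve 1 (λ y → con (ι 2) := (con 1ℚ :+ y) :+ (con 1ℚ :- y)) refl (y i))
  finish : FirstHit (ι 2) y δ
  finish with first-hit β y δ 0≤β y∈
  ... | inj₁ all∈ = β , 0≤β , β≤2 , all∈ , i , Sign.- ,
    trans (cong (λ x → y i + β * x) δᵢ≡-1) (solve 1 (λ y → y :+ (con 1ℚ :+ y) :* con (- 1ℚ) := con (- 1ℚ)) refl (y i))
  ... | inj₂ (α , 0≤α , α≤β , rest) = α , 0≤α , ℚ.≤-trans α≤β β≤2 , rest

-- The Gram–Schmidt walk

lin-ray : ∀ {m K} y α δ (v : Fin m → ℚ^ K) k → lin (λ i → y i + α * δ i) v k ≡ lin y v k + α * lin δ v k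
lin-ray y α δ v k = trans
  (sum-cong-≗ λ i → solve 4 (λ y α δ v → (y :+ α :* δ) :* v := y :* v :+ α :* (δ :* v)) refl (y i) α (δ i) (v i k))
  (trans (∑-distrib-+ (λ i → y i * v i k) (λ i → α * (δ i * v i k)))
    (cong (λ x → lin y v k + x) (sym (*-distribˡ-sum α (λ i → δ i * v i k)))))

lin-neg : ∀ {m K} c (v : Fin m → ℚ^ K) k → lin (λ i → - c i) v k ≡ - lin c v k
lin-neg c v k = trans (sum-cong-≗ λ i → sym (ℚ.neg-distribˡ-* (c i) (v i k))) (sum-neg (λ i → c i * v i k))

lin-lin : ∀ {m n K} (a : Fin m → ℚ) (C : Fin m → Fin n → ℚ) (v : Fin n → ℚ^ K) k →
  lin a (λ i → lin (C i) v) k ≡ lin (λ j → ∑[ i < m ] (a i * C i j)) v k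
lin-lin {m} {n} a C v k = begin
  ∑[ i < m ] (a i * lin (C i) v k)
    ≡⟨ sum-cong-≗ (λ i → *-distribˡ-sum (a i) (λ j → C i j * v j k)) ⟩
  ∑[ i < m ] ∑[ j < n ] (a i * (C i j * v j k))
    ≡⟨ ∑-comm (λ i j → a i * (C i j * v j k)) ⟩
  ∑[ j < n ] ∑[ i < m ] (a i * (C i j * v j k))
    ≡⟨ sum-cong-≗ (λ j → trans
         (sum-cong-≗ λ i → solve 3 (λ a c v → a :* (c :* v) := v :* (a :* c)) refl (a i) (C i j) (v j k))
         (trans (sym (*-distribˡ-sum (v j k) (λ i → a i * C i j))) (ℚ.*-comm (v j k) (∑[ i < m ] (a i * C i j))))) ⟩
  ∑[ j < n ] (∑[ i < m ] (a i * C i j) * v j k) ∎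
  where open ≡-Reasoning

lin-congʳ : ∀ {m K} c {v v′ : Fin m → ℚ^ K} → (∀ i → v i ≗ v′ i) → lin c v ≗ lin c v′
lin-congʳ c v≗v′ k = sum-cong-≗ λ i → cong (c i *_) (v≗v′ i k)

module GramSchmidtWalk {K} (w : ℚ^ K) (0≤w : ∀ k → 0ℚ ≤ w k) where
  open InnerProduct w 0≤w

  -- `C i` expresses the residual `r i` in the original vectors and thus serves as a direction in
  -- which the coordinates move. Its unit diagonal bounds the length of a move by 2, and the norms
  -- of the residuals stay at most 1.
  record GramSchmidt {m} (v : Fin m → ℚ^ K) : Set where
    field
      r    : Fin m → ℚ^ K
      C    : Fin m → Fin m → ℚ
      r⊥   : Orthogonal r
      r≤1  : ∀ i → ⟪ r i , r i ⟫ ≤ 1ℚ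
      r≗   : ∀ i → r i ≗ lin (C i) v
      C≡1  : ∀ i → C i i ≡ 1ℚ

  extend : ∀ {m} (v : Fin (suc m) → ℚ^ K) → ⟪ v zero , v zero ⟫ ≤ 1ℚ → GramSchmidt (v ∘ suc) → GramSchmidt v
  extend {m} v v≤1 G = record { r = r′ ; C = C′ ; r⊥ = r′⊥ ; r≤1 = r′≤1 ; r≗ = r′≗ ; C≡1 = C′≡1 }
    where
    open GramSchmidt G
    a : Fin m → ℚ
    a = coeff r⊥ (v zero)
    r′ : Fin (suc m) → ℚ^ K
    r′ zero = residual r⊥ (v zero)
    r′ (suc i) = r i
    C′ : Fin (suc m) → Fin (suc m) → ℚ
    C′ zero zero = 1ℚ
    C′ zero (suc j) = - ∑[ i < m ] (a i * C i j)
    C′ (suc i) zero = 0ℚ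
    C′ (suc i) (suc j) = C i j
    r′⊥ : Orthogonal r′
    r′⊥ = orthogonal λ where
      zero zero 0≢0 → contradiction refl 0≢0
      zero (suc j) _ → residual-⊥ r⊥ (v zero) j
      (suc i) zero _ → trans (⟪⟫-comm (r i) (r′ zero)) (residual-⊥ r⊥ (v zero) i)
      (suc i) (suc j) i≢j → pairwise r⊥ i j (λ i≡j → i≢j (cong suc i≡j))
    r′≤1 : ∀ i → ⟪ r′ i , r′ i ⟫ ≤ 1ℚ
    r′≤1 zero = ℚ.≤-trans (∣residual∣²≤ r⊥ (v zero)) v≤1
    r′≤1 (suc i) = r≤1 i
    r′≗ : ∀ i → r′ i ≗ lin (C′ i) v
    r′≗ zero k = begin
      v zero k - lin a r k
        ≡⟨ cong (λ x → v zero k - x) (trans (lin-congʳ a r≗ k) (lin-lin a C (v ∘ suc) k)) ⟩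
      v zero k - lin (λ j → ∑[ i < m ] (a i * C i j)) (v ∘ suc) k
        ≡⟨ cong₂ _+_ (sym (ℚ.*-identityˡ (v zero k))) (sym (lin-neg (λ j → ∑[ i < m ] (a i * C i j)) (v ∘ suc) k)) ⟩
      lin (C′ zero) v k ∎
      where open ≡-Reasoning
    r′≗ (suc i) k = trans (r≗ i k) (trans (sym (ℚ.+-identityˡ _))
      (cong (λ x → x + lin (C i) (v ∘ suc) k) (sym (ℚ.*-zeroˡ (v zero k)))))
    C′≡1 : ∀ i → C′ i i ≡ 1ℚ
    C′≡1 zero = refl
    C′≡1 (suc i) = C≡1 i

  gram-schmidt : ∀ {m} (v : Fin m → ℚ^ K) → (∀ i → ⟪ v i , v i ⟫ ≤ 1ℚ) → GramSchmidt v
  gram-schmidt {zero} v v≤1 = record { r = λ () ; C = λ () ; r⊥ = orthogonal λ () ; r≤1 = λ () ; r≗ = λ () ; C≡1 = λ () }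
  gram-schmidt {suc m} v v≤1 = extend v (v≤1 zero) (gram-schmidt (v ∘ suc) (v≤1 ∘ suc))

  -- Cauchy-Schwarz, as Bessel's inequality for a family with one member.
  ⟪f,g⟫²≤∣f∣² : ∀ f g → ⟪ g , g ⟫ ≤ 1ℚ → ⟪ f , g ⟫ * ⟪ f , g ⟫ ≤ ⟪ f , f ⟫
  ⟪f,g⟫²≤∣f∣² f g g≤1 = subst (_≤ ⟪ f , f ⟫) (ℚ.+-identityʳ _)
    (bessel-unit {1} {λ _ → g} (orthogonal λ { zero zero 0≢0 → contradiction refl 0≢0 }) (λ _ → g≤1) f)

  -- Averaging Bessel's inequality over the orthogonal family r.
  flat-member : ∀ {m M} {r : Fin (suc m) → ℚ^ K} → Orthogonal r → (∀ i → ⟪ r i , r i ⟫ ≤ 1ℚ) →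
    (u : Fin M → ℚ^ K) (γ : ℚ) → (∀ F → ⟪ u F , u F ⟫ ≤ γ) → (W : Fin M → ℚ) → (∀ F → 0ℚ ≤ W F) →
    ∃[ i ] ι (suc m) * ∑[ F < M ] (W F * (⟪ u F , r i ⟫ * ⟪ u F , r i ⟫)) ≤ γ * sum W
  flat-member {m} {M} {r} r⊥ r≤1 u γ u≤γ W 0≤W = sum-≤⇒∃≤ (λ i → ι (suc m) * Q i) (λ _ → γ * sum W) (begin
      sum (λ i → ι (suc m) * Q i)
        ≡⟨ *-distribˡ-sum (ι (suc m)) Q ⟨
      ι (suc m) * sum Q
        ≡⟨ cong (ι (suc m) *_) (trans (∑-comm (λ i F → W F * q F i))
             (sum-cong-≗ λ F → sym (*-distribˡ-sum (W F) (q F)))) ⟩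
      ι (suc m) * ∑[ F < M ] (W F * sum (q F))
        ≤⟨ *-monoˡ-≤ (0≤ι (suc m)) (sum-mono-≤ λ F → *-monoˡ-≤ (0≤W F)
             (ℚ.≤-trans (bessel-unit r⊥ r≤1 (u F)) (u≤γ F))) ⟩
      ι (suc m) * ∑[ F < M ] (W F * γ)
        ≡⟨ cong (ι (suc m) *_) (trans (sum-cong-≗ λ F → ℚ.*-comm (W F) γ) (sym (*-distribˡ-sum γ W))) ⟩
      ι (suc m) * (γ * sum W)
        ≡⟨ sum-const (suc m) (γ * sum W) ⟨
      ∑[ i < suc m ] (γ * sum W) ∎)
    where
    open ℚ.≤-Reasoning
    q : Fin M → Fin (suc m) → ℚ
    q F i = ⟪ u F , r i ⟫ * ⟪ u F , r i ⟫
    Q : Fin (suc m) → ℚ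
    Q i = ∑[ F < M ] (W F * q F i)

  module _ {M} (u : Fin M → ℚ^ K) {γ : ℚ} (u≤γ : ∀ F → ⟪ u F , u F ⟫ ≤ γ) (0≤γ : 0ℚ ≤ γ) (q : ℕ) where

    -- Large enough for two purposes: R ≥ 4γ dominates the square of every increment α ⟪ u F , r ⟫
    -- with α ≤ 2, as `taylor-≤` demands, and the second-order term, at most 4 · `taylor q` · γ
    -- times a sum of q-th powers divided by the number of vectors, becomes that fraction of the
    -- potential.
    R : ℚ
    R = ι 4 * ι (taylor q) * γ

    base : ℚ^ K → Fin M → ℚ
    base s F = R + ⟪ u F , s ⟫ * ⟪ u F , s ⟫

    Φ : ℚ^ K → ℚ
    Φ s = ∑[ F < M ] (base s F ^ suc q)

    0≤R : 0ℚ ≤ R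
    0≤R = 0≤x*y (0≤x*y (0≤ι 4) (0≤ι (taylor q))) 0≤γ

    0≤base : ∀ s F → 0ℚ ≤ base s F
    0≤base s F = 0≤x+y 0≤R (0≤x*x ⟪ u F , s ⟫)

    Φ-cong : ∀ {s s′} → s ≗ s′ → Φ s ≡ Φ s′
    Φ-cong s≗s′ = sum-cong-≗ λ F → cong (λ x → (R + x * x) ^ suc q) (⟪⟫-cong {u F} (λ _ → refl) s≗s′)

    1≤taylor : ∀ n → 1 ℕ.≤ taylor n
    1≤taylor zero = ℕ.s≤s ℕ.z≤n
    1≤taylor (suc n) = ℕ≤.m≤n⇒m≤o+n (3 ℕ.* taylor n) (ℕ≤.m≤n⇒m≤o+n (5 ℕ.* suc n) ℕ≤.≤-refl)
      where import Data.Nat.Properties as ℕ≤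

    4γ≤R : ι 4 * γ ≤ R
    4γ≤R = subst (_≤ R) (cong (_* γ) (ℚ.*-identityʳ (ι 4)))
      (*-monoʳ-≤ 0≤γ (*-monoˡ-≤ (0≤ι 4) (ι-mono-≤ (1≤taylor q))))

    module _ (s r : ℚ^ K) (r≤1 : ⟪ r , r ⟫ ≤ 1ℚ) {α : ℚ} (0≤α : 0ℚ ≤ α) (α≤2 : α ≤ ι 2) where

      slope curvature : ℚ
      slope = ∑[ F < M ] (base s F ^ q * (⟪ u F , s ⟫ * ⟪ u F , r ⟫))
      curvature = ∑[ F < M ] (base s F ^ q * (⟪ u F , r ⟫ * ⟪ u F , r ⟫))

      α²≤4 : α * α ≤ ι 4
      α²≤4 = *-mono-≤ 0≤α (0≤ι 2) α≤2 α≤2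

      Φ-step : slope ≤ 0ℚ → Φ (λ k → s k + α * r k) ≤ Φ s + ι 4 * ι (taylor q) * curvature
      Φ-step slope≤0 = begin
        Φ (λ k → s k + α * r k)
          ≡⟨ sum-cong-≗ (λ F → cong (λ x → (R + x * x) ^ suc q) (⟪u,s+αr⟫ F)) ⟩
        ∑[ F < M ] ((R + (x F + α * z F) * (x F + α * z F)) ^ suc q)
          ≤⟨ sum-mono-≤ (λ F → taylor-≤ q R (x F) (α * z F) (small F)) ⟩
        ∑[ F < M ] (P F * (base s F + (c * (x F * (α * z F)) + k * ((α * z F) * (α * z F)))))
          ≡⟨ sum-cong-≗ (λ F → solve 7 (λ P B c x α z k →
               P :* (B :+ (c :* (x :* (α :* z)) :+ k :* ((α :* z) :* (α :* z))))
               := B :* P :+ ((c :* α) :* (P :* (x :* z)) :+ (k :* (α :* α)) :* (P :* (z :* z)))) refl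
               (P F) (base s F) c (x F) α (z F) k) ⟩
        ∑[ F < M ] (base s F ^ suc q + (c * α * (P F * (x F * z F)) + k * (α * α) * (P F * (z F * z F))))
          ≡⟨ trans (∑-distrib-+ (λ F → base s F ^ suc q) _) (cong (λ y → Φ s + y) (trans
               (∑-distrib-+ (λ F → c * α * (P F * (x F * z F))) (λ F → k * (α * α) * (P F * (z F * z F))))
               (sym (cong₂ _+_ (*-distribˡ-sum (c * α) (λ F → P F * (x F * z F)))
                 (*-distribˡ-sum (k * (α * α)) (λ F → P F * (z F * z F))))))) ⟩
        Φ s + (c * α * slope + k * (α * α) * curvature)
          ≤⟨ ℚ.+-monoʳ-≤ (Φ s) (ℚ.+-mono-≤
               (subst (c * α * slope ≤_) (ℚ.*-zeroʳ (c * α)) (*-monoˡ-≤ (0≤x*y 0≤c 0≤α) slope≤0))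
               (*-monoʳ-≤ 0≤curvature (*-monoˡ-≤ (0≤ι (taylor q)) α²≤4))) ⟩
        Φ s + (0ℚ + k * ι 4 * curvature)
          ≡⟨ cong (λ y → Φ s + y) (trans (ℚ.+-identityˡ _) (cong (_* curvature) (ℚ.*-comm k (ι 4)))) ⟩
        Φ s + ι 4 * k * curvature ∎
        where
        open ℚ.≤-Reasoning
        x z P : Fin M → ℚ
        x F = ⟪ u F , s ⟫
        z F = ⟪ u F , r ⟫
        P F = base s F ^ q
        c k : ℚ
        c = ι 2 * ι (suc q)
        k = ι (taylor q)
        0≤c : 0ℚ ≤ c
        0≤c = 0≤x*y (0≤ι 2) (0≤ι (suc q))
        0≤curvature : 0ℚ ≤ curvature
        0≤curvature = 0≤sum λ F → 0≤x*y (0≤x^n q (0≤base s F)) (0≤x*x (z F))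
        ⟪u,s+αr⟫ : ∀ F → ⟪ u F , (λ k → s k + α * r k) ⟫ ≡ x F + α * z F
        ⟪u,s+αr⟫ F = trans (⟪⟫-comm (u F) _) (trans (⟪⟫-plusˡ s (λ k → α * r k) (u F)) (cong₂ _+_ (⟪⟫-comm s (u F))
          (trans (⟪⟫-scaleˡ α r (u F)) (cong (α *_) (⟪⟫-comm r (u F))))))
        small : ∀ F → (α * z F) * (α * z F) ≤ R
        small F = begin
          (α * z F) * (α * z F) ≡⟨ solve 2 (λ α z → (α :* z) :* (α :* z) := (α :* α) :* (z :* z)) refl α (z F) ⟩
          (α * α) * (z F * z F) ≤⟨ *-mono-≤ (0≤x*x (z F)) (0≤ι 4) α²≤4 (ℚ.≤-trans (⟪f,g⟫²≤∣f∣² (u F) r r≤1) (u≤γ F)) ⟩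
          ι 4 * γ               ≤⟨ 4γ≤R ⟩
          R ∎

    -- The vector `o` collects the contribution of the coordinates already frozen, so the recursion
    -- sees only the uncoloured vectors.
    State : ∀ {m} → ℚ^ K → (Fin m → ℚ^ K) → (Fin m → ℚ) → ℚ^ K
    State o v y k = o k + lin y v k

    record Direction {m} (v : Fin (suc m) → ℚ^ K) (s : ℚ^ K) (i : Fin (suc m)) (δ : Fin (suc m) → ℚ) : Set where
      field
        δᵢ      : δ i ≡ 1ℚ ⊎ δ i ≡ - 1ℚ
        short   : ⟪ lin δ v , lin δ v ⟫ ≤ 1ℚ
        flat    : ι (suc m) * ∑[ F < M ] (base s F ^ q * (⟪ u F , lin δ v ⟫ * ⟪ u F , lin δ v ⟫))
                    ≤ γ * ∑[ F < M ] (base s F ^ q)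
        descent : ∑[ F < M ] (base s F ^ q * (⟪ u F , s ⟫ * ⟪ u F , lin δ v ⟫)) ≤ 0ℚ

    0≤base^q : ∀ s F → 0ℚ ≤ base s F ^ q
    0≤base^q s F = 0≤x^n q (0≤base s F)

    neg-direction : ∀ {m} {v : Fin (suc m) → ℚ^ K} {s i δ} → δ i ≡ 1ℚ → ⟪ lin δ v , lin δ v ⟫ ≤ 1ℚ →
      ι (suc m) * ∑[ F < M ] (base s F ^ q * (⟪ u F , lin δ v ⟫ * ⟪ u F , lin δ v ⟫)) ≤ γ * ∑[ F < M ] (base s F ^ q) →
      0ℚ ≤ ∑[ F < M ] (base s F ^ q * (⟪ u F , s ⟫ * ⟪ u F , lin δ v ⟫)) → Direction v s i (λ j → - δ j)
    neg-direction {m} {v} {s} {i} {δ} δᵢ≡1 short flat 0≤ = record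
        { δᵢ = inj₂ (cong -_ δᵢ≡1)
        ; short = subst (_≤ 1ℚ) (sym (trans (⟪f,-⟫ (lin (λ j → - δ j) v))
            (trans (cong -_ (trans (⟪⟫-comm (lin (λ j → - δ j) v) (lin δ v)) (⟪f,-⟫ (lin δ v)))) (neg-neg _)))) short
        ; flat = subst (λ x → ι (suc m) * x ≤ γ * ∑[ F < M ] (base s F ^ q))
            (sum-cong-≗ λ F → cong (base s F ^ q *_) (sym (trans (cong (λ x → x * x) (⟪f,-⟫ (u F))) (neg-sq ⟪ u F , lin δ v ⟫))))
            flat
        ; descent = subst (_≤ 0ℚ) (trans (sym (sum-neg (λ F → base s F ^ q * (⟪ u F , s ⟫ * ⟪ u F , lin δ v ⟫))))
            (sum-cong-≗ λ F → trans
              (solve 3 (λ w x z → :- (w :* (x :* z)) := w :* (x :* (:- z))) refl (base s F ^ q) ⟪ u F , s ⟫ ⟪ u F , lin δ v ⟫)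
              (cong (λ x → base s F ^ q * (⟪ u F , s ⟫ * x)) (sym (⟪f,-⟫ (u F))))))
            (ℚ.neg-antimono-≤ 0≤)
        }
      where
      ⟪f,-⟫ : ∀ f → ⟪ f , lin (λ j → - δ j) v ⟫ ≡ - ⟪ f , lin δ v ⟫
      ⟪f,-⟫ f = trans (⟪⟫-cong {f} (λ _ → refl) (lin-neg δ v))
        (trans (sum-cong-≗ λ k → solve 3 (λ w f g → w :* (f :* (:- g)) := :- (w :* (f :* g))) refl (w k) (f k) (lin δ v k))
          (sum-neg (λ k → w k * (f k * lin δ v k))))
      neg-sq : ∀ x → (- x) * (- x) ≡ x * x
      neg-sq = solve 1 (λ x → (:- x) :* (:- x) := x :* x) refl
      neg-neg : ∀ x → - (- x) ≡ x
      neg-neg = solve 1 (λ x → :- (:- x) := x) refl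

    direction : ∀ {m} (v : Fin (suc m) → ℚ^ K) → GramSchmidt v → ∀ s → ∃[ i ] ∃[ δ ] Direction v s i δ
    direction {m} v G s = from-member (flat-member r⊥ r≤1 u γ u≤γ (λ F → base s F ^ q) (0≤base^q s))
      where
      open GramSchmidt G
      from-member : (∃[ i ] ι (suc m) * ∑[ F < M ] (base s F ^ q * (⟪ u F , r i ⟫ * ⟪ u F , r i ⟫)) ≤ γ * ∑[ F < M ] (base s F ^ q)) →
        ∃[ i ] ∃[ δ ] Direction v s i δ
      from-member (i , flat) = [ (λ ≤0 → i , C i , record { δᵢ = inj₁ (C≡1 i) ; short = short′ ; flat = flat′ ; descent = ≤0 }) ,
          (λ 0≤ → i , (λ j → - C i j) , neg-direction (C≡1 i) short′ flat′ 0≤) ]′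
          (ℚ.≤-total (∑[ F < M ] (base s F ^ q * (⟪ u F , s ⟫ * ⟪ u F , lin (C i) v ⟫))) 0ℚ)
        where
        short′ : ⟪ lin (C i) v , lin (C i) v ⟫ ≤ 1ℚ
        short′ = subst (_≤ 1ℚ) (⟪⟫-cong (r≗ i) (r≗ i)) (r≤1 i)
        flat′ : ι (suc m) * ∑[ F < M ] (base s F ^ q * (⟪ u F , lin (C i) v ⟫ * ⟪ u F , lin (C i) v ⟫)) ≤ γ * ∑[ F < M ] (base s F ^ q)
        flat′ = subst (λ x → ι (suc m) * x ≤ γ * ∑[ F < M ] (base s F ^ q))
          (sum-cong-≗ λ F → cong (λ x → base s F ^ q * (x * x)) (⟪⟫-cong {u F} (λ _ → refl) (r≗ i))) flat

    step-bound : ∀ {m} (v : Fin (suc m) → ℚ^ K) s {i δ} → Direction v s i δ → ∀ {α} → 0ℚ ≤ α → α ≤ ι 2 →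
      ι (suc m) * Φ (λ k → s k + α * lin δ v k) ≤ ι (suc (suc m)) * Φ s
    step-bound {m} v s {i} {δ} dir {α} 0≤α α≤2 = begin
      ι (suc m) * Φ (λ k → s k + α * lin δ v k)
        ≤⟨ *-monoˡ-≤ (0≤ι (suc m)) (Φ-step s (lin δ v) short 0≤α α≤2 descent) ⟩
      ι (suc m) * (Φ s + c * Q)
        ≡⟨ solve 4 (λ n f c q → n :* (f :+ c :* q) := n :* f :+ c :* (n :* q)) refl (ι (suc m)) (Φ s) c Q ⟩
      ι (suc m) * Φ s + c * (ι (suc m) * Q)
        ≤⟨ ℚ.+-monoʳ-≤ (ι (suc m) * Φ s) (*-monoˡ-≤ (0≤x*y (0≤ι 4) (0≤ι (taylor q))) flat) ⟩
      ι (suc m) * Φ s + c * (γ * sum W)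
        ≡⟨ cong (λ x → ι (suc m) * Φ s + x) (trans (sym (ℚ.*-assoc c γ (sum W))) (*-distribˡ-sum R W)) ⟩
      ι (suc m) * Φ s + ∑[ F < M ] (R * W F)
        -- Since R ≤ `base s F`, one more factor of the base turns R times the q-th powers into the
        -- potential itself.
        ≤⟨ ℚ.+-monoʳ-≤ (ι (suc m) * Φ s) (sum-mono-≤ λ F → *-monoʳ-≤ {R} {base s F} (0≤base^q s F)
             (≤-by (⟪ u F , s ⟫ * ⟪ u F , s ⟫) (0≤x*x ⟪ u F , s ⟫) refl)) ⟩
      ι (suc m) * Φ s + Φ s
        ≡⟨ solve 2 (λ n f → n :* f :+ f := (con 1ℚ :+ n) :* f) refl (ι (suc m)) (Φ s) ⟩
      (1ℚ + ι (suc m)) * Φ s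
        ≡⟨ cong (_* Φ s) (ι-suc (suc m)) ⟨
      ι (suc (suc m)) * Φ s ∎
      where
      open ℚ.≤-Reasoning
      open Direction dir
      W : Fin M → ℚ
      W F = base s F ^ q
      c Q : ℚ
      c = ι 4 * ι (taylor q)
      Q = ∑[ F < M ] (W F * (⟪ u F , lin δ v ⟫ * ⟪ u F , lin δ v ⟫))

    record Step {m} (v : Fin (suc m) → ℚ^ K) (y : Fin (suc m) → ℚ) (o : ℚ^ K) : Set where
      field
        y′  : Fin (suc m) → ℚ
        y′∈ : ∀ i → In[-1,1] (y′ i)
        j   : Fin (suc m)
        e   : Sign
        y′ⱼ : y′ j ≡ sgn e
        Φ≤  : ι (suc m) * Φ (State o v y′) ≤ ι (suc (suc m)) * Φ (State o v y)

    step : ∀ {m} (v : Fin (suc m) → ℚ^ K) → (∀ i → ⟪ v i , v i ⟫ ≤ 1ℚ) →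
      ∀ y → (∀ i → In[-1,1] (y i)) → ∀ o → Step v y o
    step {m} v v≤1 y y∈ o = along (direction v (gram-schmidt v v≤1) (State o v y))
      where
      along : (∃[ i ] ∃[ δ ] Direction v (State o v y) i δ) → Step v y o
      along (i , δ , dir) = to (walk-to-boundary y δ y∈ i (Direction.δᵢ dir))
        where
        to : FirstHit (ι 2) y δ → Step v y o
        to (α , 0≤α , α≤2 , y′∈ , j , e , y′ⱼ) = record
          { y′ = λ j → y j + α * δ j ; y′∈ = y′∈ ; j = j ; e = e ; y′ⱼ = y′ⱼ
          ; Φ≤ = subst (λ x → ι (suc m) * x ≤ ι (suc (suc m)) * Φ (State o v y))
              (Φ-cong λ k → trans (ℚ.+-assoc (o k) (lin y v k) (α * lin δ v k)) (cong (λ x → o k + x) (sym (lin-ray y α δ v k))))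
              (step-bound v (State o v y) dir 0≤α α≤2)
          }

    freeze : ∀ {m} (o : ℚ^ K) (v : Fin (suc m) → ℚ^ K) (y : Fin (suc m) → ℚ) j →
      State (λ k → o k + y j * v j k) (v ∘ punchIn j) (y ∘ punchIn j) ≗ State o v y
    freeze o v y j k = trans (ℚ.+-assoc (o k) _ _) (cong (λ x → o k + x) (sym (sum-remove {i = j} (λ i → y i * v i k))))

    Signing : ∀ {m} → (Fin m → ℚ^ K) → ℚ^ K → ℚ → Set
    Signing {m} v o B = Σ[ ε ∈ (Fin m → Sign) ] Φ (State o v (sgn ∘ ε)) ≤ B

    -- ∏ (1 + 1/m) telescopes.
    walk : ∀ {m} (v : Fin m → ℚ^ K) → (∀ i → ⟪ v i , v i ⟫ ≤ 1ℚ) → ∀ y → (∀ i → In[-1,1] (y i)) → ∀ o →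
      Signing v o (ι (suc m) * Φ (State o v y))
    walk {zero} v v≤1 y y∈ o = (λ ()) , ℚ.≤-reflexive (sym (ℚ.*-identityˡ (Φ (State o v y))))
    walk {suc m} v v≤1 y y∈ o = continue (step v v≤1 y y∈ o)
      where
      continue : Step v y o → Signing v o (ι (suc (suc m)) * Φ (State o v y))
      continue st = finish (walk (v ∘ punchIn j) (v≤1 ∘ punchIn j) (y′ ∘ punchIn j) (y′∈ ∘ punchIn j) o′)
        where
        open Step st
        o′ : ℚ^ K
        o′ k = o k + y′ j * v j k
        finish : Signing (v ∘ punchIn j) o′ (ι (suc m) * Φ (State o′ (v ∘ punchIn j) (y′ ∘ punchIn j))) →
          Signing v o (ι (suc (suc m)) * Φ (State o v y))
        finish (ε , Φ″≤) = insertAt ε j e , ℚ.≤-trans (ℚ.≤-reflexive (Φ-cong ends))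
          (ℚ.≤-trans Φ″≤ (ℚ.≤-trans (ℚ.≤-reflexive (cong (ι (suc m) *_) (Φ-cong (freeze o v y′ j)))) Φ≤))
          where
          ends : State o v (sgn ∘ insertAt ε j e) ≗ State o′ (v ∘ punchIn j) (sgn ∘ ε)
          ends k = trans (sym (freeze o v (sgn ∘ insertAt ε j e) j k)) (cong₂ (λ x y → o k + x * v j k + y)
            (trans (cong sgn (insertAt-lookup ε j e)) (sym y′ⱼ))
            (sum-cong-≗ λ i → cong (λ x → sgn x * v (punchIn j i) k) (insertAt-punchIn ε j e i)))

    -- At the centre of the cube the potential is M R^(q+1), the walk multiplies it by at most m +
    -- 1, and at the end any single summand is at most the whole sum.
    balanced-signs : ∀ {m} (v : Fin m → ℚ^ K) → (∀ i → ⟪ v i , v i ⟫ ≤ 1ℚ) →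
      Σ[ ε ∈ (Fin m → Sign) ] (∀ F → (⟪ u F , lin (sgn ∘ ε) v ⟫ * ⟪ u F , lin (sgn ∘ ε) v ⟫) ^ suc q ≤ ι (suc m) * (ι M * R ^ suc q))
    balanced-signs {m} v v≤1 = bound (walk v v≤1 (λ _ → 0ℚ) (λ _ → ℚ.≤ᵇ⇒≤ _ , ℚ.≤ᵇ⇒≤ _) (λ _ → 0ℚ))
      where
      open ℚ.≤-Reasoning
      base-0 : ∀ F → base (State (λ _ → 0ℚ) v (λ _ → 0ℚ)) F ≡ R
      base-0 F = trans (cong (λ x → R + x * x) (sum-zero λ k → trans
        (cong (λ x → w k * (u F k * x)) (trans (ℚ.+-identityˡ _) (sum-zero λ i → ℚ.*-zeroˡ (v i k))))
        (solve 2 (λ w u → w :* (u :* con 0ℚ) := con 0ℚ) refl (w k) (u F k))))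
        (solve 1 (λ R → R :+ con 0ℚ :* con 0ℚ := R) refl R)
      bound : Signing v (λ _ → 0ℚ) (ι (suc m) * Φ (State (λ _ → 0ℚ) v (λ _ → 0ℚ))) →
        Σ[ ε ∈ (Fin m → Sign) ] (∀ F → (⟪ u F , lin (sgn ∘ ε) v ⟫ * ⟪ u F , lin (sgn ∘ ε) v ⟫) ^ suc q ≤ ι (suc m) * (ι M * R ^ suc q))
      bound (ε , Φ≤) = ε , λ F → begin
        (⟪ u F , S ⟫ * ⟪ u F , S ⟫) ^ suc q
          ≤⟨ ^-mono-≤ (suc q) (0≤x*x ⟪ u F , S ⟫) (≤-by R 0≤R (ℚ.+-comm R _)) ⟩
        base S F ^ suc q
          ≤⟨ term≤sum (λ F → base S F ^ suc q) F (λ F → 0≤x^n (suc q) (0≤base S F)) ⟩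
        Φ S
          ≡⟨ Φ-cong (λ k → sym (ℚ.+-identityˡ (S k))) ⟩
        Φ (State (λ _ → 0ℚ) v (sgn ∘ ε))
          ≤⟨ Φ≤ ⟩
        ι (suc m) * Φ (State (λ _ → 0ℚ) v (λ _ → 0ℚ))
          ≡⟨ cong (ι (suc m) *_) (trans (sum-cong-≗ λ F → cong (_^ suc q) (base-0 F)) (sum-const M (R ^ suc q))) ⟩
        ι (suc m) * (ι M * R ^ suc q) ∎
        where
        S : ℚ^ K
        S = lin (sgn ∘ ε) v

-- Tensor powers

module Product = CommutativeMonoidSum ℚ.*-1-commutativeMonoid

∏ : ∀ {n} → Vector ℚ n → ℚ
∏ = Product.sum

∏-cong : ∀ {n} {f g : Vector ℚ n} → f ≗ g → ∏ f ≡ ∏ g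
∏-cong = Product.sum-cong-≗

∏-const : ∀ n c → ∏ {n} (λ _ → c) ≡ c ^ n
∏-const zero c = refl
∏-const (suc n) c = cong (c *_) (∏-const n c)

∏-distrib-* : ∀ n (f g : Vector ℚ n) → ∏ (λ i → f i * g i) ≡ ∏ f * ∏ g
∏-distrib-* n f g = Product.∑-distrib-+ f g

0≤∏ : ∀ {n} {f : Vector ℚ n} → (∀ i → 0ℚ ≤ f i) → 0ℚ ≤ ∏ f
0≤∏ {zero} 0≤f = ℚ.nonNegative⁻¹ 1ℚ
0≤∏ {suc n} 0≤f = 0≤x*y (0≤f zero) (0≤∏ (0≤f ∘ suc))

0<∏ : ∀ {n} {f : Vector ℚ n} → (∀ i → 0ℚ < f i) → 0ℚ < ∏ f
0<∏ {zero} 0<f = ℚ.positive⁻¹ 1ℚ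
0<∏ {suc n} 0<f = 0<x*y (0<f zero) (0<∏ (0<f ∘ suc))

∏-zero : ∀ {n} {f : Vector ℚ n} i → f i ≡ 0ℚ → ∏ f ≡ 0ℚ
∏-zero {suc n} {f} zero fi≡0 = trans (cong (_* ∏ (f ∘ suc)) fi≡0) (ℚ.*-zeroˡ (∏ (f ∘ suc)))
∏-zero {suc n} {f} (suc i) fi≡0 = trans (cong (f zero *_) (∏-zero {f = f ∘ suc} i fi≡0)) (ℚ.*-zeroʳ (f zero))

∏-mono-≤ : ∀ {n} {f g : Vector ℚ n} → (∀ i → 0ℚ ≤ f i) → (∀ i → f i ≤ g i) → ∏ f ≤ ∏ g
∏-mono-≤ {zero} 0≤f f≤g = ℚ.≤-refl
∏-mono-≤ {suc n} 0≤f f≤g =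
  *-mono-≤ (0≤∏ (0≤f ∘ suc)) (ℚ.≤-trans (0≤f zero) (f≤g zero)) (f≤g zero) (∏-mono-≤ (0≤f ∘ suc) (f≤g ∘ suc))

sum-↑ : ∀ m {n} (f : Vector ℚ (m ℕ.+ n)) → sum f ≡ sum (λ i → f (i ↑ˡ n)) + sum (λ j → f (m ↑ʳ j))
sum-↑ zero f = sym (ℚ.+-identityˡ (sum f))
sum-↑ (suc m) {n} f = trans (cong (f zero +_) (sum-↑ m (f ∘ suc)))
  (sym (ℚ.+-assoc (f zero) (sum (λ i → f (suc (i ↑ˡ n)))) (sum (λ j → f (suc (m ↑ʳ j))))))

sum-combine : ∀ m {n} (f : Vector ℚ (m ℕ.* n)) → sum f ≡ ∑[ i < m ] ∑[ j < n ] f (combine i j)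
sum-combine zero f = refl
sum-combine (suc m) {n} f = trans (sum-↑ n f) (cong (sum (λ j → f (j ↑ˡ (m ℕ.* n))) +_) (sum-combine m (λ k → f (n ↑ʳ k))))

-- Distributivity: expanding a product of sums gives one term for each word.
sum-∏ : ∀ {A} d (φ : Fin d → Fin A → ℚ) →
  ∑[ x < A ℕ.^ d ] ∏ {d} (λ i → φ i (finToFun x i)) ≡ ∏ {d} (λ i → sum (φ i))
sum-∏ zero φ = ℚ.+-identityʳ 1ℚ
sum-∏ {A} (suc d) φ = begin
  ∑[ x < A ℕ.* A ℕ.^ d ] ∏ (λ i → φ i (finToFun x i))
    ≡⟨ sum-combine A (λ x → ∏ (λ i → φ i (finToFun x i))) ⟩
  ∑[ c < A ] ∑[ x < A ℕ.^ d ] ∏ (λ i → φ i (finToFun {A} (combine c x) i))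
    ≡⟨ sum-cong-≗ (λ c → sum-cong-≗ λ x → cong₂ _*_ (cong (φ zero ∘ proj₁) (remQuot-combine c x))
         (∏-cong λ i → cong (λ z → φ (suc i) (finToFun (proj₂ z) i)) (remQuot-combine c x))) ⟩
  ∑[ c < A ] ∑[ x < A ℕ.^ d ] (φ zero c * ∏ (λ i → φ (suc i) (finToFun x i)))
    ≡⟨ sum-cong-≗ (λ c → trans (sym (*-distribˡ-sum (φ zero c) (λ x → ∏ (λ i → φ (suc i) (finToFun x i)))))
         (trans (cong (φ zero c *_) (sum-∏ d (φ ∘ suc))) (ℚ.*-comm (φ zero c) P))) ⟩
  ∑[ c < A ] (P * φ zero c)
    ≡⟨ *-distribˡ-sum P (φ zero) ⟨
  P * sum (φ zero)
    ≡⟨ ℚ.*-comm P (sum (φ zero)) ⟩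
  sum (φ zero) * P ∎
  where
  open ≡-Reasoning
  P : ℚ
  P = ∏ (λ i → sum (φ (suc i)))

-- Words of length d over the alphabet Fin A are the elements of Fin (A ^ d).
⊗ᵛ : ∀ {A} d → (Fin A → ℚ) → ℚ^ (A ℕ.^ d)
⊗ᵛ d w x = ∏ {d} λ i → w (finToFun x i)

⊗ : ∀ {A B} d → (Fin A → Fin B → ℚ) → Fin (A ℕ.^ d) → ℚ^ (B ℕ.^ d)
⊗ d k x y = ∏ {d} λ i → k (finToFun x i) (finToFun y i)

0≤⊗ᵛ : ∀ {A} d {w : Fin A → ℚ} → (∀ c → 0ℚ ≤ w c) → ∀ x → 0ℚ ≤ ⊗ᵛ d w x
0≤⊗ᵛ d 0≤w x = 0≤∏ {d} λ i → 0≤w (finToFun x i)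

sum-⊗ᵛ : ∀ {A} d (w : Fin A → ℚ) → sum (⊗ᵛ d w) ≡ sum w ^ d
sum-⊗ᵛ d w = trans (sum-∏ d (λ _ → w)) (∏-const d (sum w))

-- The mixed-product rule. It reduces every factorisation, norm and orthogonality relation in
-- dimension d to a check on single letters.
sum-⊗ : ∀ {A B C} d (w : Fin C → ℚ) (k : Fin A → Fin C → ℚ) (l : Fin B → Fin C → ℚ) x y →
  ∑[ z < C ℕ.^ d ] (⊗ᵛ d w z * (⊗ d k x z * ⊗ d l y z)) ≡ ⊗ d (λ a b → ∑[ c < C ] (w c * (k a c * l b c))) x y
sum-⊗ {C = C} d w k l x y = trans
  (sum-cong-≗ λ z → sym (trans
    (∏-distrib-* d (λ i → w (finToFun z i)) (λ i → k (finToFun x i) (finToFun z i) * l (finToFun y i) (finToFun z i)))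
    (cong (⊗ᵛ d w z *_) (∏-distrib-* d (λ i → k (finToFun x i) (finToFun z i)) (λ i → l (finToFun y i) (finToFun z i))))))
  (sum-∏ {C} d (λ i c → w c * (k (finToFun x i) c * l (finToFun y i) c)))

finToFun-injective : ∀ {A} d (x y : Fin (A ℕ.^ d)) → (∀ (i : Fin d) → finToFun {A} x i ≡ finToFun y i) → x ≡ y
finToFun-injective zero zero zero _ = refl
finToFun-injective {A} (suc d) x y eq = begin
  x
    ≡⟨ combine-remQuot {A} (A ℕ.^ d) x ⟨
  combine (finToFun {A} {suc d} x zero) (remainder {A} (A ℕ.^ d) x)
    ≡⟨ cong₂ combine (eq zero) (finToFun-injective {A} d (remainder {A} (A ℕ.^ d) x) (remainder {A} (A ℕ.^ d) y) (λ i → eq (suc i))) ⟩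
  combine (finToFun {A} {suc d} y zero) (remainder {A} (A ℕ.^ d) y)
    ≡⟨ combine-remQuot {A} (A ℕ.^ d) y ⟩
  y ∎
  where open ≡-Reasoning

⊗-diagonal : ∀ {A} d (k : Fin A → Fin A → ℚ) → (∀ a b → a ≢ b → k a b ≡ 0ℚ) → ∀ x y → x ≢ y → ⊗ d k x y ≡ 0ℚ
⊗-diagonal {A} d k k≡0 x y x≢y with ¬∀⟶∃¬ d _ (λ i → finToFun {A} {d} x i ≟ finToFun {A} {d} y i) (x≢y ∘ finToFun-injective {A} d x y)
... | i , xᵢ≢yᵢ = ∏-zero {f = λ i → k (finToFun x i) (finToFun y i)} i (k≡0 _ _ xᵢ≢yᵢ)

-- Colourings of small discrepancy

allᵇ : ∀ {n} → (Fin n → Bool) → Bool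
allᵇ {zero} f = true
allᵇ {suc n} f = f zero ∧ allᵇ (f ∘ suc)

𝟙⟨_⟩ : Bool → ℚ
𝟙⟨ b ⟩ = if b then 1ℚ else 0ℚ

𝟙-∧ : ∀ a b → 𝟙⟨ a ∧ b ⟩ ≡ 𝟙⟨ a ⟩ * 𝟙⟨ b ⟩
𝟙-∧ true b = sym (ℚ.*-identityˡ 𝟙⟨ b ⟩)
𝟙-∧ false b = sym (ℚ.*-zeroˡ 𝟙⟨ b ⟩)

∏-𝟙 : ∀ {n} (f : Fin n → Bool) → ∏ (λ i → 𝟙⟨ f i ⟩) ≡ 𝟙⟨ allᵇ f ⟩
∏-𝟙 {zero} f = refl
∏-𝟙 {suc n} f = trans (cong (𝟙⟨ f zero ⟩ *_) (∏-𝟙 (f ∘ suc))) (sym (𝟙-∧ (f zero) (allᵇ (f ∘ suc))))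

-- ok a is the trace on {0,1} of the interval named by the letter a.
words : ∀ {A} d → (Fin A → Fin 2 → Bool) → Fin (A ℕ.^ d) → Subset (2 ℕ.^ d)
words d ok F = tabulate λ v → allᵇ {d} λ i → ok (finToFun F i) (finToFun v i)

⊗-words : ∀ {A} d (ok : Fin A → Fin 2 → Bool) F v → ⊗ d (λ a b → 𝟙⟨ ok a b ⟩) F v ≡ 𝟙⟨ lookup (words d ok F) v ⟩
⊗-words d ok F v = trans (∏-𝟙 {d} (λ i → ok (finToFun F i) (finToFun v i)))
  (cong 𝟙⟨_⟩ (sym (lookup∘tabulate (λ v → allᵇ {d} λ i → ok (finToFun F i) (finToFun v i)) v)))

ιℤ-sum : ∀ {n} (f : Vector ℤ n) → ιℤ (CommutativeMonoidSum.sum ℤ.+-0-commutativeMonoid f) ≡ sum (ιℤ ∘ f)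
ιℤ-sum {zero} f = refl
ιℤ-sum {suc n} f = trans (ιℤ-+ (f zero) _) (cong (ιℤ (f zero) +_) (ιℤ-sum (f ∘ suc)))

ιℤ-colourSum : ∀ {n} (x : Colouring n) F J →
  ιℤ (colourSum x (F ∩ J)) ≡ ∑[ v < n ] (𝟙⟨ lookup F v ⟩ * (𝟙⟨ lookup J v ⟩ * sgn (lookup x v)))
ιℤ-colourSum x F J = trans (ιℤ-sum (λ v → if lookup (F ∩ J) v then lookup x v ◃ 1 else 0ℤ)) (sum-cong-≗ λ v →
  trans (cong (λ b → ιℤ (if b then lookup x v ◃ 1 else 0ℤ)) (lookup-zipWith _∧_ v F J))
    (ind-if (lookup F v) (lookup J v) (lookup x v ◃ 1)))
  where
  ind-if : ∀ a b z → ιℤ (if a ∧ b then z else 0ℤ) ≡ 𝟙⟨ a ⟩ * (𝟙⟨ b ⟩ * ιℤ z)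
  ind-if true true z = sym (trans (ℚ.*-identityˡ _) (ℚ.*-identityˡ _))
  ind-if true false z = sym (trans (ℚ.*-identityˡ _) (ℚ.*-zeroˡ (ιℤ z)))
  ind-if false b z = sym (ℚ.*-zeroˡ (𝟙⟨ b ⟩ * ιℤ z))

ι∣z∣² : ∀ z → ι ℤ.∣ z ∣ * ι ℤ.∣ z ∣ ≡ ιℤ z * ιℤ z
ι∣z∣² (ℤ.+ n) = refl
ι∣z∣² ℤ.-[1+ n ] = refl

-- The fourth letter is the empty interval, so that an empty box is a word as well. Its functional
-- is zero; its only cost is that there are 4^d words instead of 3^d.
interval : Fin 4 → Fin 2 → Bool
interval 0F 0F = true
interval 0F 1F = false
interval 1F 0F = false
interval 1F 1F = true
interval 2F _ = true
interval 3F _ = false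

-- With respect to the weights ½, the rows of V₃ are unit vectors at angle 60°, and U₃ is the shortest
-- choice of functionals realising interval on them.
V₃ : Fin 2 → Fin 3 → ℚ
V₃ 0F 0F = 1ℚ
V₃ 0F 1F = 1ℚ
V₃ 0F 2F = 0ℚ
V₃ 1F 0F = 0ℚ
V₃ 1F 1F = 1ℚ
V₃ 1F 2F = 1ℚ

U₃ : Fin 4 → Fin 3 → ℚ
U₃ 0F 0F = ℤ.+ 4 ℚ./ 3
U₃ 0F 1F = ℤ.+ 2 ℚ./ 3
U₃ 0F 2F = - (ℤ.+ 2 ℚ./ 3)
U₃ 1F 0F = - (ℤ.+ 2 ℚ./ 3)
U₃ 1F 1F = ℤ.+ 2 ℚ./ 3
U₃ 1F 2F = ℤ.+ 4 ℚ./ 3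
U₃ 2F 0F = ℤ.+ 2 ℚ./ 3
U₃ 2F 1F = ℤ.+ 4 ℚ./ 3
U₃ 2F 2F = ℤ.+ 2 ℚ./ 3
U₃ 3F _ = 0ℚ

4/3 : ℚ
4/3 = ℤ.+ 4 ℚ./ 3

U₃V₃ : ∀ a b → ∑[ c < 3 ] (½ * (U₃ a c * V₃ b c)) ≡ 𝟙⟨ interval a b ⟩
U₃V₃ 0F 0F = refl
U₃V₃ 0F 1F = refl
U₃V₃ 1F 0F = refl
U₃V₃ 1F 1F = refl
U₃V₃ 2F 0F = refl
U₃V₃ 2F 1F = refl
U₃V₃ 3F 0F = refl
U₃V₃ 3F 1F = refl

∣V₃∣² : ∀ b → ∑[ c < 3 ] (½ * (V₃ b c * V₃ b c)) ≡ 1ℚ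
∣V₃∣² 0F = refl
∣V₃∣² 1F = refl

∣U₃∣² : ∀ a → ∑[ c < 3 ] (½ * (U₃ a c * U₃ a c)) ≤ 4/3
∣U₃∣² 0F = ℚ.≤ᵇ⇒≤ _
∣U₃∣² 1F = ℚ.≤ᵇ⇒≤ _
∣U₃∣² 2F = ℚ.≤ᵇ⇒≤ _
∣U₃∣² 3F = ℚ.≤ᵇ⇒≤ _

module _ (d q : ℕ) (J : Subset (2 ℕ.^ d)) where

  private
    w : ℚ^ (3 ℕ.^ d)
    w = ⊗ᵛ d (λ _ → ½)
    0≤w : ∀ k → 0ℚ ≤ w k
    0≤w = 0≤⊗ᵛ {3} d (λ _ → ℚ.≤ᵇ⇒≤ _)
    u : Fin (4 ℕ.^ d) → ℚ^ (3 ℕ.^ d)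
    u = ⊗ d U₃
    -- A point outside `J` gets the zero vector instead of being removed: it may be coloured
    -- arbitrarily, and the index set stays the whole cube.
    v : Fin (2 ℕ.^ d) → ℚ^ (3 ℕ.^ d)
    v x k = 𝟙⟨ lookup J x ⟩ * ⊗ d V₃ x k

    open InnerProduct w 0≤w
    open GramSchmidtWalk w 0≤w

    u≤ : ∀ F → ⟪ u F , u F ⟫ ≤ 4/3 ^ d
    u≤ F = ℚ.≤-trans (ℚ.≤-reflexive (sum-⊗ {4} {4} {3} d (λ _ → ½) U₃ U₃ F F)) (ℚ.≤-trans
      (∏-mono-≤ {d} (λ i → 0≤sum {3} λ c → 0≤x*y {½} (ℚ.≤ᵇ⇒≤ _) (0≤x*x (U₃ (finToFun F i) c))) (λ i → ∣U₃∣² (finToFun F i)))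
      (ℚ.≤-reflexive (∏-const d 4/3)))

    ∣⊗V₃∣² : ∀ x → ⟪ ⊗ d V₃ x , ⊗ d V₃ x ⟫ ≡ 1ℚ
    ∣⊗V₃∣² x = trans (sum-⊗ {2} {2} {3} d (λ _ → ½) V₃ V₃ x x)
      (trans (∏-cong {d} λ i → ∣V₃∣² (finToFun x i)) (trans (∏-const d 1ℚ) (1^n≡1 d)))

    v≤ : ∀ x → ⟪ v x , v x ⟫ ≤ 1ℚ
    v≤ x = by-cases (lookup J x) refl
      where
      by-cases : ∀ b → lookup J x ≡ b → ⟪ v x , v x ⟫ ≤ 1ℚ
      by-cases true eq = ℚ.≤-reflexive (trans (⟪⟫-cong v≗ v≗) (∣⊗V₃∣² x))
        where
        v≗ : v x ≗ ⊗ d V₃ x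
        v≗ k = trans (cong (λ b → 𝟙⟨ b ⟩ * ⊗ d V₃ x k) eq) (ℚ.*-identityˡ _)
      by-cases false eq = ℚ.≤-trans (ℚ.≤-reflexive (sum-zero λ k → trans
          (cong (λ b → w k * (b * b)) (trans (cong (λ b → 𝟙⟨ b ⟩ * ⊗ d V₃ x k) eq) (ℚ.*-zeroˡ (⊗ d V₃ x k)))) (ℚ.*-zeroʳ (w k))))
        (ℚ.nonNegative⁻¹ 1ℚ)

    ⟪u,v⟫ : ∀ F x → ⟪ v x , u F ⟫ ≡ 𝟙⟨ lookup (words d interval F) x ⟩ * 𝟙⟨ lookup J x ⟩
    ⟪u,v⟫ F x = begin
      ⟪ v x , u F ⟫
        ≡⟨ ⟪⟫-scaleˡ 𝟙⟨ lookup J x ⟩ (⊗ d V₃ x) (u F) ⟩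
      𝟙⟨ lookup J x ⟩ * ⟪ ⊗ d V₃ x , u F ⟫
        ≡⟨ cong (𝟙⟨ lookup J x ⟩ *_) (trans (⟪⟫-comm (⊗ d V₃ x) (u F)) (sum-⊗ {4} {2} {3} d (λ _ → ½) U₃ V₃ F x)) ⟩
      𝟙⟨ lookup J x ⟩ * ⊗ d (λ a b → ∑[ c < 3 ] (½ * (U₃ a c * V₃ b c))) F x
        ≡⟨ cong (𝟙⟨ lookup J x ⟩ *_) (trans (∏-cong {d} λ i → U₃V₃ (finToFun F i) (finToFun x i)) (⊗-words d interval F x)) ⟩
      𝟙⟨ lookup J x ⟩ * 𝟙⟨ lookup (words d interval F) x ⟩
        ≡⟨ ℚ.*-comm 𝟙⟨ lookup J x ⟩ 𝟙⟨ lookup (words d interval F) x ⟩ ⟩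
      𝟙⟨ lookup (words d interval F) x ⟩ * 𝟙⟨ lookup J x ⟩ ∎
      where open ≡-Reasoning

    ⟪u,lin⟫ : ∀ F (ε : Fin (2 ℕ.^ d) → Sign) →
      ⟪ u F , lin (sgn ∘ ε) v ⟫ ≡ ιℤ (colourSum (tabulate ε) (words d interval F ∩ J))
    ⟪u,lin⟫ F ε = begin
      ⟪ u F , lin (sgn ∘ ε) v ⟫
        ≡⟨ trans (⟪⟫-comm (u F) (lin (sgn ∘ ε) v)) (⟪⟫-linˡ (sgn ∘ ε) v (u F)) ⟩
      ∑[ x < 2 ℕ.^ d ] (sgn (ε x) * ⟪ v x , u F ⟫)
        ≡⟨ sum-cong-≗ (λ x → trans (cong (sgn (ε x) *_) (⟪u,v⟫ F x)) (trans
             (solve 3 (λ s a b → s :* (a :* b) := a :* (b :* s)) refl (sgn (ε x)) 𝟙⟨ lookup (words d interval F) x ⟩ 𝟙⟨ lookup J x ⟩)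
             (cong (λ e → 𝟙⟨ lookup (words d interval F) x ⟩ * (𝟙⟨ lookup J x ⟩ * sgn e)) (sym (lookup∘tabulate ε x))))) ⟩
      ∑[ x < 2 ℕ.^ d ] (𝟙⟨ lookup (words d interval F) x ⟩ * (𝟙⟨ lookup J x ⟩ * sgn (lookup (tabulate ε) x)))
        ≡⟨ ιℤ-colourSum (tabulate ε) (words d interval F) J ⟨
      ιℤ (colourSum (tabulate ε) (words d interval F ∩ J)) ∎
      where open ≡-Reasoning

  UpperBound : ℕ → Set
  UpperBound a = (a ℕ.* a ℕ.* 3 ℕ.^ d) ℕ.^ suc q ℕ.≤ suc (2 ℕ.^ d) ℕ.* (4 ℕ.^ d ℕ.* (4 ℕ.* taylor q ℕ.* 4 ℕ.^ d) ℕ.^ suc q)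

  private
    clear-denominators : ∀ z →
      (ιℤ z * ιℤ z) ^ suc q ≤ ι (suc (2 ℕ.^ d)) * (ι (4 ℕ.^ d) * (ι 4 * ι (taylor q) * 4/3 ^ d) ^ suc q) →
      UpperBound ℤ.∣ z ∣
    clear-denominators z z≤ = ι-cancel-≤ (begin
      ι ((a ℕ.* a ℕ.* 3 ℕ.^ d) ℕ.^ suc q)
        ≡⟨ trans (ι-^ (a ℕ.* a ℕ.* 3 ℕ.^ d) (suc q)) (cong (_^ suc q) (trans (ι-* (a ℕ.* a) (3 ℕ.^ d))
             (cong₂ _*_ (trans (ι-* a a) (ι∣z∣² z)) (ι-^ 3 d)))) ⟩
      (ιℤ z * ιℤ z * T₃) ^ suc q
        ≡⟨ ^-distrib-* (ιℤ z * ιℤ z) T₃ (suc q) ⟩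
      (ιℤ z * ιℤ z) ^ suc q * T₃ ^ suc q
        ≤⟨ *-monoʳ-≤ (0≤x^n (suc q) (0≤x^n d (0≤ι 3))) z≤ ⟩
      A * (B * (C * 4/3 ^ d) ^ suc q) * T₃ ^ suc q
        ≡⟨ solve 4 (λ A B X Y → A :* (B :* X) :* Y := A :* (B :* (X :* Y))) refl A B ((C * 4/3 ^ d) ^ suc q) (T₃ ^ suc q) ⟩
      A * (B * ((C * 4/3 ^ d) ^ suc q * T₃ ^ suc q))
        ≡⟨ cong (λ X → A * (B * X)) (trans (sym (^-distrib-* (C * 4/3 ^ d) T₃ (suc q))) (cong (_^ suc q) (trans
             (ℚ.*-assoc C (4/3 ^ d) T₃) (cong (C *_) (sym (^-distrib-* 4/3 (ι 3) d)))))) ⟩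
      A * (B * (C * ι 4 ^ d) ^ suc q)
        ≡⟨ cong (λ X → A * (B * X)) (sym (trans (ι-^ (4 ℕ.* taylor q ℕ.* 4 ℕ.^ d) (suc q)) (cong (_^ suc q)
             (trans (ι-* (4 ℕ.* taylor q) (4 ℕ.^ d)) (cong₂ _*_ (ι-* 4 (taylor q)) (ι-^ 4 d)))))) ⟩
      A * (B * ι ((4 ℕ.* taylor q ℕ.* 4 ℕ.^ d) ℕ.^ suc q))
        ≡⟨ sym (trans (ι-* (suc (2 ℕ.^ d)) _) (cong (A *_) (ι-* (4 ℕ.^ d) _))) ⟩
      ι (suc (2 ℕ.^ d) ℕ.* (4 ℕ.^ d ℕ.* (4 ℕ.* taylor q ℕ.* 4 ℕ.^ d) ℕ.^ suc q)) ∎)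
      where
      open ℚ.≤-Reasoning
      a = ℤ.∣ z ∣
      A B C T₃ : ℚ
      A = ι (suc (2 ℕ.^ d))
      B = ι (4 ℕ.^ d)
      C = ι 4 * ι (taylor q)
      T₃ = ι 3 ^ d

  balanced-colouring : Σ[ x ∈ Colouring (2 ℕ.^ d) ] (∀ F → UpperBound ℤ.∣ colourSum x (words d interval F ∩ J) ∣)
  balanced-colouring = from (balanced-signs u u≤ (0≤x^n d (ℚ.≤ᵇ⇒≤ _)) q v v≤)
    where
    from : Σ[ ε ∈ (Fin (2 ℕ.^ d) → Sign) ] (∀ F → (⟪ u F , lin (sgn ∘ ε) v ⟫ * ⟪ u F , lin (sgn ∘ ε) v ⟫) ^ suc q
        ≤ ι (suc (2 ℕ.^ d)) * (ι (4 ℕ.^ d) * (ι 4 * ι (taylor q) * 4/3 ^ d) ^ suc q)) →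
      Σ[ x ∈ Colouring (2 ℕ.^ d) ] (∀ F → UpperBound ℤ.∣ colourSum x (words d interval F ∩ J) ∣)
    from (ε , bound) = tabulate ε , λ F → clear-denominators (colourSum (tabulate ε) (words d interval F ∩ J))
      (subst (λ s → (s * s) ^ suc q ≤ ι (suc (2 ℕ.^ d)) * (ι (4 ℕ.^ d) * (ι 4 * ι (taylor q) * 4/3 ^ d) ^ suc q)) (⟪u,lin⟫ F ε) (bound F))

-- Choosing an unbalanced subset

-- With n = ⟪ g , g ⟫ and c = ⟪ f , g ⟫ this says that the coefficient c/n is at least 1/2 in
-- absolute value, without division.
Bad : ℚ → ℚ → Set
Bad n c = n * n ≤ ι 4 * (c * c)

bad? : ∀ n c → Dec (Bad n c)
bad? n c = (n * n) ℚ.≤? (ι 4 * (c * c))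

-- Of three sums spaced by one unit at most one avoids the penalty, so the penalties total at most 1
-- + 2/8 = 5/4 and the better of two options gets at most 5/8. Any penalty below 1/2 would bring
-- this number below 1.
⅛ 5/8 : ℚ
⅛ = ℤ.+ 1 ℚ./ 8
5/8 = ℤ.+ 5 ℚ./ 8

penalty : ∀ {P : Set} → Dec P → ℚ
penalty (yes _) = ⅛
penalty (no _) = 1ℚ

0≤penalty : ∀ {P : Set} (b : Dec P) → 0ℚ ≤ penalty b
0≤penalty (yes _) = ℚ.≤ᵇ⇒≤ _
0≤penalty (no _) = ℚ.≤ᵇ⇒≤ _

-- The parallelogram law: 2(c - c′)² ≤ 4c² + 4c′² < 2n².
good-unique : ∀ n c c′ → ¬ Bad n c → ¬ Bad n c′ → n * n ≤ (c - c′) * (c - c′) → ⊥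
good-unique n c c′ ¬bad ¬bad′ n≤ = ℚ.<-irrefl refl (begin-strict
  n * n + n * n
    ≤⟨ ℚ.+-mono-≤ n≤ n≤ ⟩
  (c - c′) * (c - c′) + (c - c′) * (c - c′)
    ≤⟨ ≤-by ((c + c′) * (c + c′) + (c + c′) * (c + c′)) (0≤x+y (0≤x*x (c + c′)) (0≤x*x (c + c′)))
         (solve 2 (λ c c′ → con (ι 4) :* (c :* c) :+ con (ι 4) :* (c′ :* c′) :=
           ((c :- c′) :* (c :- c′) :+ (c :- c′) :* (c :- c′)) :+ ((c :+ c′) :* (c :+ c′) :+ (c :+ c′) :* (c :+ c′))) refl c c′) ⟩
  ι 4 * (c * c) + ι 4 * (c′ * c′)
    <⟨ ℚ.+-mono-< (ℚ.≰⇒> ¬bad) (ℚ.≰⇒> ¬bad′) ⟩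
  n * n + n * n ∎)
  where open ℚ.≤-Reasoning

-- Three collinear points at spacing n: at most one lies within n/2 of the origin.
penalties≤5/4 : ∀ n c {c₊ c₋} → c₊ ≡ c + n → c₋ ≡ c - n →
  (b : Dec (Bad n c)) (b₊ : Dec (Bad n c₊)) (b₋ : Dec (Bad n c₋)) →
  penalty b + (penalty b₊ + penalty b₋) ≤ ℤ.+ 5 ℚ./ 4
penalties≤5/4 n c refl refl (no ¬b) (no ¬b₊) _ = ⊥-elim (good-unique n (c + n) c ¬b₊ ¬b (ℚ.≤-reflexive
  (solve 2 (λ n c → n :* n := ((c :+ n) :- c) :* ((c :+ n) :- c)) refl n c)))
penalties≤5/4 n c refl refl (no ¬b) (yes _) (no ¬b₋) = ⊥-elim (good-unique n c (c - n) ¬b ¬b₋ (ℚ.≤-reflexive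
  (solve 2 (λ n c → n :* n := (c :- (c :- n)) :* (c :- (c :- n))) refl n c)))
penalties≤5/4 n c refl refl (yes _) (no ¬b₊) (no ¬b₋) = ⊥-elim (good-unique n (c + n) (c - n) ¬b₊ ¬b₋ (≤-by (ι 3 * (n * n))
  (0≤x*y (0≤ι 3) (0≤x*x n))
  (solve 2 (λ n c → ((c :+ n) :- (c :- n)) :* ((c :+ n) :- (c :- n)) := n :* n :+ con (ι 3) :* (n :* n)) refl n c)))
penalties≤5/4 n c _ _ (no _) (yes _) (yes _) = ℚ.≤ᵇ⇒≤ _
penalties≤5/4 n c _ _ (yes _) (no _) (yes _) = ℚ.≤ᵇ⇒≤ _
penalties≤5/4 n c _ _ (yes _) (yes _) (no _) = ℚ.≤ᵇ⇒≤ _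
penalties≤5/4 n c _ _ (yes _) (yes _) (yes _) = ℚ.≤ᵇ⇒≤ _

module Adversary {K} (w : ℚ^ K) (0≤w : ∀ k → 0ℚ ≤ w k) where
  open InnerProduct w 0≤w

  W : ℚ^ K → ℚ^ K → ℚ
  W g o = penalty (bad? ⟪ g , g ⟫ ⟪ o , g ⟫)

  0≤W : ∀ g o → 0ℚ ≤ W g o
  0≤W g o = 0≤penalty (bad? ⟪ g , g ⟫ ⟪ o , g ⟫)

  shift : ℚ^ K → ℚ → ℚ^ K → ℚ^ K
  shift o t b k = o k + t * b k

  ⟪shift⟫ : ∀ o t b g → ⟪ shift o t b , g ⟫ ≡ ⟪ o , g ⟫ + t * ⟪ b , g ⟫
  ⟪shift⟫ o t b g = trans (⟪⟫-plusˡ o (λ k → t * b k) g) (cong (λ x → ⟪ o , g ⟫ + x) (⟪⟫-scaleˡ t b g))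

  -- Sums of penalties over all colourings of J, with partial signed sums started at o.
  tot : ∀ {s} (g b : Fin s → ℚ^ K) → (Fin s → Bool) → ℚ^ K → ℚ
  tot {zero} g b J o = 1ℚ
  tot {suc s} g b J o = if J zero
    then visit (shift o (sgn Sign.+) (b zero)) + visit (shift o (sgn Sign.-) (b zero))
    else visit o
    where
    visit : ℚ^ K → ℚ
    visit o = W (g zero) o * tot (g ∘ suc) (b ∘ suc) (J ∘ suc) o

  0≤tot : ∀ {s} (g b : Fin s → ℚ^ K) J o → 0ℚ ≤ tot g b J o
  0≤tot {zero} g b J o = ℚ.≤ᵇ⇒≤ _
  0≤tot {suc s} g b J o = 0≤if (J zero)
    (0≤x+y (0≤visit (shift o (sgn Sign.+) (b zero))) (0≤visit (shift o (sgn Sign.-) (b zero)))) (0≤visit o)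
    where
    0≤visit : ∀ o → 0ℚ ≤ W (g zero) o * tot (g ∘ suc) (b ∘ suc) (J ∘ suc) o
    0≤visit o = 0≤x*y (0≤W (g zero) o) (0≤tot (g ∘ suc) (b ∘ suc) (J ∘ suc) o)
    0≤if : ∀ c {x y} → 0ℚ ≤ x → 0ℚ ≤ y → 0ℚ ≤ (if c then x else y)
    0≤if true 0≤x _ = 0≤x
    0≤if false _ 0≤y = 0≤y

  -- Abstracts the sum over all colourings of the points decided so far, weighted by the penalties
  -- already incurred and applied to a function of the partial signed sum. Positivity and linearity
  -- suffice for the choice of the next point.
  record PositiveFunctional (μ : (ℚ^ K → ℚ) → ℚ) : Set where
    field
      mono  : ∀ {f h} → (∀ o → f o ≤ h o) → μ f ≤ μ h
      add   : ∀ f h → μ (λ o → f o + h o) ≡ μ f + μ h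
      scale : ∀ c f → μ (λ o → c * f o) ≡ c * μ f

    respects : ∀ {f h} → (∀ o → f o ≡ h o) → μ f ≡ μ h
    respects f≗h = ℚ.≤-antisym (mono (ℚ.≤-reflexive ∘ f≗h)) (mono (ℚ.≤-reflexive ∘ sym ∘ f≗h))

  module _ {μ} (μ⁺ : PositiveFunctional μ) (g b : ℚ^ K) where
    open PositiveFunctional μ⁺

    -- `skip` and `branch` update the functional for a point left out of the subset and for a point
    -- put into it, where both signs are then possible.
    skip : (ℚ^ K → ℚ) → ℚ
    skip f = μ λ o → W g o * f o

    branch : (ℚ^ K → ℚ) → ℚ
    branch f = μ λ o → W g (shift o (sgn Sign.+) b) * f (shift o (sgn Sign.+) b)
                     + W g (shift o (sgn Sign.-) b) * f (shift o (sgn Sign.-) b)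

    skip⁺ : PositiveFunctional skip
    skip⁺ = record
      { mono = λ f≤h → mono λ o → *-monoˡ-≤ (0≤W g o) (f≤h o)
      ; add = λ f h → trans (respects λ o → ℚ.*-distribˡ-+ (W g o) (f o) (h o)) (add (λ o → W g o * f o) (λ o → W g o * h o))
      ; scale = λ c f → trans (respects λ o → solve 3 (λ w c f → w :* (c :* f) := c :* (w :* f)) refl (W g o) c (f o))
          (scale c (λ o → W g o * f o))
      }

    branch⁺ : PositiveFunctional branch
    branch⁺ = record
      { mono = λ f≤h → mono λ o → ℚ.+-mono-≤
          (*-monoˡ-≤ (0≤W g (shift o (sgn Sign.+) b)) (f≤h (shift o (sgn Sign.+) b)))
          (*-monoˡ-≤ (0≤W g (shift o (sgn Sign.-) b)) (f≤h (shift o (sgn Sign.-) b)))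
      ; add = λ f h → trans (respects λ o → solve 6 (λ w w′ x y x′ y′ →
            w :* (x :+ y) :+ w′ :* (x′ :+ y′) := (w :* x :+ w′ :* x′) :+ (w :* y :+ w′ :* y′)) refl
            (W g (shift o (sgn Sign.+) b)) (W g (shift o (sgn Sign.-) b))
            (f (shift o (sgn Sign.+) b)) (h (shift o (sgn Sign.+) b)) (f (shift o (sgn Sign.-) b)) (h (shift o (sgn Sign.-) b)))
          (add _ _)
      ; scale = λ c f → trans (respects λ o → solve 5 (λ c w w′ x x′ →
            w :* (c :* x) :+ w′ :* (c :* x′) := c :* (w :* x :+ w′ :* x′)) refl c
            (W g (shift o (sgn Sign.+) b)) (W g (shift o (sgn Sign.-) b))
            (f (shift o (sgn Sign.+) b)) (f (shift o (sgn Sign.-) b)))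
          (scale c _)
      }

    one : ℚ^ K → ℚ
    one _ = 1ℚ

    skip+branch : ⟪ b , g ⟫ ≡ ⟪ g , g ⟫ → skip one + branch one ≤ (ℤ.+ 5 ℚ./ 4) * μ one
    skip+branch bg≡gg = begin
      skip one + branch one
        ≡⟨ add _ _ ⟨
      μ (λ o → W g o * 1ℚ + (W g (shift o (sgn Sign.+) b) * 1ℚ + W g (shift o (sgn Sign.-) b) * 1ℚ))
        ≤⟨ mono (λ o → ℚ.≤-trans (ℚ.≤-reflexive (solve 3 (λ x y z →
             x :* con 1ℚ :+ (y :* con 1ℚ :+ z :* con 1ℚ) := x :+ (y :+ z)) refl
             (W g o) (W g (shift o (sgn Sign.+) b)) (W g (shift o (sgn Sign.-) b))))
             (ℚ.≤-trans (penalties≤5/4 ⟪ g , g ⟫ ⟪ o , g ⟫ (at+ o) (at- o)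
               (bad? ⟪ g , g ⟫ ⟪ o , g ⟫) (bad? ⟪ g , g ⟫ ⟪ shift o (sgn Sign.+) b , g ⟫) (bad? ⟪ g , g ⟫ ⟪ shift o (sgn Sign.-) b , g ⟫))
               (ℚ.≤-reflexive (sym (ℚ.*-identityʳ (ℤ.+ 5 ℚ./ 4)))))) ⟩
      μ (λ o → (ℤ.+ 5 ℚ./ 4) * 1ℚ)
        ≡⟨ scale (ℤ.+ 5 ℚ./ 4) one ⟩
      (ℤ.+ 5 ℚ./ 4) * μ one ∎
      where
      open ℚ.≤-Reasoning
      at+ : ∀ o → ⟪ shift o (sgn Sign.+) b , g ⟫ ≡ ⟪ o , g ⟫ + ⟪ g , g ⟫
      at+ o = trans (⟪shift⟫ o (sgn Sign.+) b g) (trans (cong (λ x → ⟪ o , g ⟫ + sgn Sign.+ * x) bg≡gg)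
        (solve 2 (λ x y → x :+ con 1ℚ :* y := x :+ y) refl ⟪ o , g ⟫ ⟪ g , g ⟫))
      at- : ∀ o → ⟪ shift o (sgn Sign.-) b , g ⟫ ≡ ⟪ o , g ⟫ - ⟪ g , g ⟫
      at- o = trans (⟪shift⟫ o (sgn Sign.-) b g) (trans (cong (λ x → ⟪ o , g ⟫ + sgn Sign.- * x) bg≡gg)
        (solve 2 (λ x y → x :+ con (- 1ℚ) :* y := x :- y) refl ⟪ o , g ⟫ ⟪ g , g ⟫))

  halve : ∀ {x y z} → x + y ≤ (ℤ.+ 5 ℚ./ 4) * z → x ≤ 5/8 * z ⊎ y ≤ 5/8 * z
  halve {x} {y} {z} x+y≤ with x ℚ.≤? 5/8 * z
  ... | yes x≤ = inj₁ x≤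
  ... | no x≰ = inj₂ (ℚ.≮⇒≥ λ y> → ℚ.<-irrefl refl (ℚ.<-≤-trans
    (subst (_< x + y) (solve 1 (λ z → con 5/8 :* z :+ con 5/8 :* z := con (ℤ.+ 5 ℚ./ 4) :* z) refl z)
      (ℚ.+-mono-< (ℚ.≰⇒> x≰) y>)) x+y≤))

  -- The method of conditional expectations, applied to membership in the subset and not to the
  -- colours: the two options together have mass at most 5/4 of the present one, so one of them has
  -- at most 5/8.
  choose : ∀ {s} (g b : Fin s → ℚ^ K) → (∀ i → ⟪ b i , g i ⟫ ≡ ⟪ g i , g i ⟫) →
    ∀ {μ} → PositiveFunctional μ → Σ[ J ∈ (Fin s → Bool) ] μ (tot g b J) ≤ 5/8 ^ s * μ (λ _ → 1ℚ)
  choose {zero} g b bg≡gg μ⁺ = (λ ()) , ℚ.≤-reflexive (sym (ℚ.*-identityˡ _))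
  choose {suc s} g b bg≡gg {μ} μ⁺ =
    [ (λ small → extend false (skip⁺ μ⁺ (g zero) (b zero)) small (λ _ → ℚ.≤-refl)) ,
      (λ small → extend true (branch⁺ μ⁺ (g zero) (b zero)) small (λ _ → ℚ.≤-refl)) ]′
    (halve {skip μ⁺ (g zero) (b zero) (λ _ → 1ℚ)} {branch μ⁺ (g zero) (b zero) (λ _ → 1ℚ)} {μ (λ _ → 1ℚ)} (skip+branch μ⁺ (g zero) (b zero) (bg≡gg zero)))
    where
    cons : Bool → (Fin s → Bool) → Fin (suc s) → Bool
    cons c J zero = c
    cons c J (suc i) = J i
    extend : ∀ c {ν} → PositiveFunctional ν → ν (λ _ → 1ℚ) ≤ 5/8 * μ (λ _ → 1ℚ) →
      (∀ J → μ (tot g b (cons c J)) ≤ ν (tot (g ∘ suc) (b ∘ suc) J)) →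
      Σ[ J ∈ (Fin (suc s) → Bool) ] μ (tot g b J) ≤ 5/8 ^ suc s * μ (λ _ → 1ℚ)
    extend c {ν} ν⁺ small head≤ = finish (choose (g ∘ suc) (b ∘ suc) (bg≡gg ∘ suc) ν⁺)
      where
      finish : Σ[ J ∈ (Fin s → Bool) ] ν (tot (g ∘ suc) (b ∘ suc) J) ≤ 5/8 ^ s * ν (λ _ → 1ℚ) →
        Σ[ J ∈ (Fin (suc s) → Bool) ] μ (tot g b J) ≤ 5/8 ^ suc s * μ (λ _ → 1ℚ)
      finish (J , J≤) = cons c J , ℚ.≤-trans (head≤ J) (ℚ.≤-trans J≤ (ℚ.≤-trans
        (*-monoˡ-≤ (0≤x^n s (ℚ.≤ᵇ⇒≤ _)) small)
        (ℚ.≤-reflexive (solve 3 (λ p c m → p :* (c :* m) := (c :* p) :* m) refl (5/8 ^ s) 5/8 (μ (λ _ → 1ℚ))))))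

  signed : ∀ {s} → (Fin s → Bool) → (Fin s → Sign) → Fin s → ℚ
  signed J e i = 𝟙⟨ J i ⟩ * sgn (e i)

  -- Points decided later are orthogonal to `g i`, so the coefficient along `g i` is final once
  -- point i has been decided. Hence the penalties of a colouring can be read off its complete sum,
  -- and their product is one nonnegative term of `tot`.
  ∏W≤tot : ∀ {s} (g b : Fin s → ℚ^ K) → (∀ i j → i Fin.< j → ⟪ b j , g i ⟫ ≡ 0ℚ) → ∀ J e o f →
    f ≗ (λ k → o k + lin (signed J e) b k) → ∏ (λ i → W (g i) f) ≤ tot g b J o
  ∏W≤tot {zero} g b b⊥g J e o f f≗ = ℚ.≤-refl
  ∏W≤tot {suc s} g b b⊥g J e o f f≗ = by-cases (J zero) refl (e zero) refl
    where
    rest : ℚ^ K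
    rest = lin (signed (J ∘ suc) (e ∘ suc)) (b ∘ suc)
    visit : ℚ^ K → ℚ
    visit o = W (g zero) o * tot (g ∘ suc) (b ∘ suc) (J ∘ suc) o
    0≤visit : ∀ o → 0ℚ ≤ visit o
    0≤visit o = 0≤x*y (0≤W (g zero) o) (0≤tot (g ∘ suc) (b ∘ suc) (J ∘ suc) o)
    same : ∀ o′ → f ≗ (λ k → o′ k + rest k) → ⟪ f , g zero ⟫ ≡ ⟪ o′ , g zero ⟫
    same o′ f≗′ = begin
      ⟪ f , g zero ⟫
        ≡⟨ trans (⟪⟫-cong f≗′ (λ _ → refl)) (⟪⟫-plusˡ o′ rest (g zero)) ⟩
      ⟪ o′ , g zero ⟫ + ⟪ rest , g zero ⟫
        ≡⟨ cong (λ x → ⟪ o′ , g zero ⟫ + x) (trans (⟪⟫-linˡ (signed (J ∘ suc) (e ∘ suc)) (b ∘ suc) (g zero))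
             (sum-zero λ j → trans (cong (signed (J ∘ suc) (e ∘ suc) j *_) (b⊥g zero (suc j) (ℕ.s≤s ℕ.z≤n))) (ℚ.*-zeroʳ (signed (J ∘ suc) (e ∘ suc) j)))) ⟩
      ⟪ o′ , g zero ⟫ + 0ℚ
        ≡⟨ ℚ.+-identityʳ _ ⟩
      ⟪ o′ , g zero ⟫ ∎
      where open ≡-Reasoning
    via : ∀ o′ → f ≗ (λ k → o′ k + rest k) → ∏ (λ i → W (g i) f) ≤ visit o′
    via o′ f≗′ = *-mono-≤ (0≤∏ (λ i → 0≤W (g (suc i)) f)) (0≤W (g zero) o′)
      (ℚ.≤-reflexive (cong (λ c → penalty (bad? ⟪ g zero , g zero ⟫ c)) (same o′ f≗′)))
      (∏W≤tot (g ∘ suc) (b ∘ suc) (λ i j i<j → b⊥g (suc i) (suc j) (ℕ.s≤s i<j)) (J ∘ suc) (e ∘ suc) o′ f f≗′)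
    via-shift : ∀ t → 𝟙⟨ J zero ⟩ * sgn (e zero) ≡ t → ∏ (λ i → W (g i) f) ≤ visit (shift o t (b zero))
    via-shift t t≡ = via (shift o t (b zero)) λ k → trans (f≗ k) (trans
      (cong (λ x → o k + (x * b zero k + rest k)) t≡) (sym (ℚ.+-assoc (o k) (t * b zero k) (rest k))))
    tot≡ : ∀ c → J zero ≡ c → tot g b J o ≡
      (if c then visit (shift o (sgn Sign.+) (b zero)) + visit (shift o (sgn Sign.-) (b zero)) else visit o)
    tot≡ c = cong λ c → if c then visit (shift o (sgn Sign.+) (b zero)) + visit (shift o (sgn Sign.-) (b zero)) else visit o
    by-cases : ∀ c → J zero ≡ c → ∀ ε → e zero ≡ ε → ∏ (λ i → W (g i) f) ≤ tot g b J o
    by-cases true J≡ Sign.+ e≡ = ℚ.≤-trans (via-shift (sgn Sign.+) (cong₂ (λ c ε → 𝟙⟨ c ⟩ * sgn ε) J≡ e≡))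
      (ℚ.≤-trans (≤-by (visit (shift o (sgn Sign.-) (b zero))) (0≤visit _) refl) (ℚ.≤-reflexive (sym (tot≡ true J≡))))
    by-cases true J≡ Sign.- e≡ = ℚ.≤-trans (via-shift (sgn Sign.-) (cong₂ (λ c ε → 𝟙⟨ c ⟩ * sgn ε) J≡ e≡))
      (ℚ.≤-trans (y≤x+y (visit (shift o (sgn Sign.+) (b zero))) (visit (shift o (sgn Sign.-) (b zero))) (0≤visit _)) (ℚ.≤-reflexive (sym (tot≡ true J≡))))
    by-cases false J≡ ε e≡ = ℚ.≤-trans (via o λ k → trans (f≗ k) (cong (λ x → o k + x) (trans
        (cong (λ c → 𝟙⟨ c ⟩ * sgn (e zero) * b zero k + rest k) J≡)
        (solve 3 (λ x y z → con 0ℚ :* x :* y :+ z := z) refl (sgn (e zero)) (b zero k) (rest k)))))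
      (ℚ.≤-reflexive (sym (tot≡ false J≡)))

  bads : ∀ {s} (g : Fin s → ℚ^ K) → ℚ^ K → ℕ
  bads {zero} g f = 0
  bads {suc s} g f with bad? ⟪ g zero , g zero ⟫ ⟪ f , g zero ⟫
  ... | yes _ = suc (bads (g ∘ suc) f)
  ... | no _ = bads (g ∘ suc) f

  ∏W≡ : ∀ {s} (g : Fin s → ℚ^ K) f → ∏ (λ i → W (g i) f) ≡ ⅛ ^ bads g f
  ∏W≡ {zero} g f = refl
  ∏W≡ {suc s} g f with bad? ⟪ g zero , g zero ⟫ ⟪ f , g zero ⟫
  ... | yes _ = cong (⅛ *_) (∏W≡ (g ∘ suc) f)
  ... | no _ = trans (ℚ.*-identityˡ _) (∏W≡ (g ∘ suc) f)

  -- A bad index contributes c²/n ≥ n/4 ≥ Λ/4 to the Bessel sum, with n and c as in `Bad`.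
  bads≤ : ∀ {s Λ} (g : Fin s → ℚ^ K) → 0ℚ < Λ → (∀ i → Λ ≤ ⟪ g i , g i ⟫) → ∀ f →
    ι (bads g f) * Λ ≤ ι 4 * ∑[ i < s ] (⟪ f , g i ⟫ * ⟪ f , g i ⟫ * inv ⟪ g i , g i ⟫)
  bads≤ {zero} {Λ} g 0<Λ Λ≤ f = ℚ.≤-reflexive (ℚ.*-zeroˡ Λ)
  bads≤ {suc s} {Λ} g 0<Λ Λ≤ f with bad? ⟪ g zero , g zero ⟫ ⟪ f , g zero ⟫
  ... | yes bad = begin
    ι (suc (bads (g ∘ suc) f)) * Λ
      ≡⟨ trans (cong (_* Λ) (ι-suc (bads (g ∘ suc) f))) (solve 2 (λ n l → (con 1ℚ :+ n) :* l := l :+ n :* l) refl (ι (bads (g ∘ suc) f)) Λ) ⟩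
    Λ + ι (bads (g ∘ suc) f) * Λ
      ≤⟨ ℚ.+-mono-≤ head (bads≤ (g ∘ suc) 0<Λ (Λ≤ ∘ suc) f) ⟩
    ι 4 * (c * c * inv n) + ι 4 * rest
      ≡⟨ ℚ.*-distribˡ-+ (ι 4) (c * c * inv n) rest ⟨
    ι 4 * (c * c * inv n + rest) ∎
    where
    open ℚ.≤-Reasoning
    n c rest : ℚ
    n = ⟪ g zero , g zero ⟫
    c = ⟪ f , g zero ⟫
    rest = ∑[ i < s ] (⟪ f , g (suc i) ⟫ * ⟪ f , g (suc i) ⟫ * inv ⟪ g (suc i) , g (suc i) ⟫)
    head : Λ ≤ ι 4 * (c * c * inv n)
    head = begin
      Λ                     ≤⟨ Λ≤ zero ⟩
      n                     ≡⟨ *-inv-* n n (λ z → z) ⟨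
      n * inv n * n         ≡⟨ solve 2 (λ n i → n :* i :* n := n :* n :* i) refl n (inv n) ⟩
      n * n * inv n         ≤⟨ *-monoʳ-≤ (0≤inv (0≤⟪f,f⟫ (g zero))) bad ⟩
      ι 4 * (c * c) * inv n ≡⟨ ℚ.*-assoc (ι 4) (c * c) (inv n) ⟩
      ι 4 * (c * c * inv n) ∎
  ... | no _ = ℚ.≤-trans (bads≤ (g ∘ suc) 0<Λ (Λ≤ ∘ suc) f) (*-monoˡ-≤ (0≤ι 4)
      (y≤x+y (⟪ f , g zero ⟫ * ⟪ f , g zero ⟫ * inv ⟪ g zero , g zero ⟫)
        (∑[ i < s ] (⟪ f , g (suc i) ⟫ * ⟪ f , g (suc i) ⟫ * inv ⟪ g (suc i) , g (suc i) ⟫))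
        (0≤x*y (0≤x*x ⟪ f , g zero ⟫) (0≤inv (0≤⟪f,f⟫ (g zero))))))

  -- 8 · 5⁵ ≤ 8⁵
  s≤5D : ∀ s D → ⅛ ^ D ≤ 5/8 ^ s → s ℕ.≤ 5 ℕ.* D
  s≤5D s D ⅛≤ = ℕ.≮⇒≥ λ 5D<s → ℕ.<-irrefl refl (ℕ.<-≤-trans
      (ℕ.^-monoʳ-< 8 (ℕ.s≤s (ℕ.s≤s ℕ.z≤n)) 5D<s) 8^s≤8^5D)
    where
    8^s≤5^s8^D : 8 ℕ.^ s ℕ.≤ 5 ℕ.^ s ℕ.* 8 ℕ.^ D
    8^s≤5^s8^D = ι-cancel-≤ (begin
      ι (8 ℕ.^ s)                          ≡⟨ trans (ι-^ 8 s) (sym (ℚ.*-identityˡ (ι 8 ^ s))) ⟩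
      1ℚ * ι 8 ^ s                         ≡⟨ cong (_* ι 8 ^ s) (trans (sym (1^n≡1 D)) (^-distrib-* ⅛ (ι 8) D)) ⟩
      ⅛ ^ D * ι 8 ^ D * ι 8 ^ s            ≤⟨ *-monoʳ-≤ (0≤x^n s (0≤ι 8)) (*-monoʳ-≤ (0≤x^n D (0≤ι 8)) ⅛≤) ⟩
      5/8 ^ s * ι 8 ^ D * ι 8 ^ s          ≡⟨ solve 3 (λ x y z → x :* y :* z := x :* z :* y) refl (5/8 ^ s) (ι 8 ^ D) (ι 8 ^ s) ⟩
      5/8 ^ s * ι 8 ^ s * ι 8 ^ D          ≡⟨ cong (_* ι 8 ^ D) (sym (^-distrib-* 5/8 (ι 8) s)) ⟩
      ι 5 ^ s * ι 8 ^ D                    ≡⟨ sym (trans (ι-* (5 ℕ.^ s) (8 ℕ.^ D)) (cong₂ _*_ (ι-^ 5 s) (ι-^ 8 D))) ⟩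
      ι (5 ℕ.^ s ℕ.* 8 ℕ.^ D) ∎)
      where open ℚ.≤-Reasoning
    8^s≤8^5D : 8 ℕ.^ s ℕ.≤ 8 ℕ.^ (5 ℕ.* D)
    8^s≤8^5D = ℕ.*-cancelʳ-≤ (8 ℕ.^ s) (8 ℕ.^ (5 ℕ.* D)) ((5 ℕ.^ 5) ℕ.^ s) {{ℕ.m^n≢0 (5 ℕ.^ 5) s}} (begin
      8 ℕ.^ s ℕ.* (5 ℕ.^ 5) ℕ.^ s       ≡⟨ sym (^-distribʳ-*ℕ s 8 (5 ℕ.^ 5)) ⟩
      (8 ℕ.* 5 ℕ.^ 5) ℕ.^ s             ≤⟨ ℕ.^-monoˡ-≤ s (ℕ.≤ᵇ⇒≤ (8 ℕ.* 5 ℕ.^ 5) (8 ℕ.^ 5) _) ⟩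
      (8 ℕ.^ 5) ℕ.^ s                   ≡⟨ trans (ℕ.^-*-assoc 8 5 s) (trans (cong (8 ℕ.^_) (ℕ.*-comm 5 s)) (sym (ℕ.^-*-assoc 8 s 5))) ⟩
      (8 ℕ.^ s) ℕ.^ 5                   ≤⟨ ℕ.^-monoˡ-≤ 5 8^s≤5^s8^D ⟩
      (5 ℕ.^ s ℕ.* 8 ℕ.^ D) ℕ.^ 5       ≡⟨ ^-distribʳ-*ℕ 5 (5 ℕ.^ s) (8 ℕ.^ D) ⟩
      (5 ℕ.^ s) ℕ.^ 5 ℕ.* (8 ℕ.^ D) ℕ.^ 5 ≡⟨ cong₂ ℕ._*_
        (trans (ℕ.^-*-assoc 5 s 5) (trans (cong (5 ℕ.^_) (ℕ.*-comm s 5)) (sym (ℕ.^-*-assoc 5 5 s))))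
        (trans (ℕ.^-*-assoc 8 D 5) (cong (8 ℕ.^_) (ℕ.*-comm D 5))) ⟩
      (5 ℕ.^ 5) ℕ.^ s ℕ.* 8 ℕ.^ (5 ℕ.* D) ≡⟨ ℕ.*-comm ((5 ℕ.^ 5) ℕ.^ s) _ ⟩
      8 ℕ.^ (5 ℕ.* D) ℕ.* (5 ℕ.^ 5) ℕ.^ s ∎)
      where open ℕ.≤-Reasoning

  -- For every colouring the product of penalties is at most (5/8)^s, which forces a fifth of the
  -- indices to be bad; each accounts for Λ/4 of the squared norm, hence 20 = 5 · 4.
  unbalanced : ∀ {s Λ} (g b : Fin s → ℚ^ K) → Orthogonal g → 0ℚ < Λ → (∀ i → Λ ≤ ⟪ g i , g i ⟫) →
    (∀ i → ⟪ b i , g i ⟫ ≡ ⟪ g i , g i ⟫) → (∀ i j → i Fin.< j → ⟪ b j , g i ⟫ ≡ 0ℚ) →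
    Σ[ J ∈ (Fin s → Bool) ] (∀ e → ι s * Λ ≤ ι 20 * ⟪ lin (signed J e) b , lin (signed J e) b ⟫)
  unbalanced {s} {Λ} g b g⊥ 0<Λ Λ≤ bg≡gg b⊥g = finish (choose g b bg≡gg at-0)
    where
    at-0 : PositiveFunctional (λ f → f (λ _ → 0ℚ))
    at-0 = record { mono = λ f≤h → f≤h _ ; add = λ _ _ → refl ; scale = λ _ _ → refl }
    finish : Σ[ J ∈ (Fin s → Bool) ] tot g b J (λ _ → 0ℚ) ≤ 5/8 ^ s * 1ℚ →
      Σ[ J ∈ (Fin s → Bool) ] (∀ e → ι s * Λ ≤ ι 20 * ⟪ lin (signed J e) b , lin (signed J e) b ⟫)
    finish (J , tot≤) = J , bound
      where
      open ℚ.≤-Reasoning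
      bound : ∀ e → ι s * Λ ≤ ι 20 * ⟪ lin (signed J e) b , lin (signed J e) b ⟫
      bound e = begin
        ι s * Λ                  ≤⟨ *-monoʳ-≤ (ℚ.<⇒≤ 0<Λ) (ι-mono-≤ (s≤5D s D (begin
          ⅛ ^ D                      ≡⟨ ∏W≡ g f ⟨
          ∏ (λ i → W (g i) f)        ≤⟨ ∏W≤tot g b b⊥g J e (λ _ → 0ℚ) f (λ k → sym (ℚ.+-identityˡ (f k))) ⟩
          tot g b J (λ _ → 0ℚ)       ≤⟨ tot≤ ⟩
          5/8 ^ s * 1ℚ               ≡⟨ ℚ.*-identityʳ (5/8 ^ s) ⟩
          5/8 ^ s ∎))) ⟩
        ι (5 ℕ.* D) * Λ          ≡⟨ trans (cong (_* Λ) (ι-* 5 D)) (ℚ.*-assoc (ι 5) (ι D) Λ) ⟩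
        ι 5 * (ι D * Λ)          ≤⟨ *-monoˡ-≤ (0≤ι 5) (ℚ.≤-trans (bads≤ g 0<Λ Λ≤ f) (*-monoˡ-≤ (0≤ι 4) (bessel g⊥ f))) ⟩
        ι 5 * (ι 4 * ⟪ f , f ⟫)  ≡⟨ solve 1 (λ x → con (ι 5) :* (con (ι 4) :* x) := con (ι 20) :* x) refl ⟪ f , f ⟫ ⟩
        ι 20 * ⟪ f , f ⟫ ∎
        where
        f : ℚ^ K
        f = lin (signed J e) b
        D : ℕ
        D = bads g f

-- Greedy choice of independent columns

0<x⇒x≢0 : ∀ {x} → 0ℚ < x → x ≢ 0ℚ
0<x⇒x≢0 0<x x≡0 = ℚ.<⇒≢ 0<x (sym x≡0)

module Greedy {K N P} (w : ℚ^ K) (0≤w : ∀ k → 0ℚ ≤ w k) (q : ℚ^ N) (0<q : ∀ x → 0ℚ < q x)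
  (b : Fin N → ℚ^ K) (f : Fin P → ℚ^ N) where

  open InnerProduct w 0≤w
  module Q = InnerProduct q (λ x → ℚ.<⇒≤ (0<q x))

  -- The image of `f S` under the weighted matrix with columns `b`. When the `f S` are right
  -- singular vectors, these images are orthogonal as well and carry the singular values in their
  -- lengths.
  e : Fin P → ℚ^ K
  e S = lin (λ x → q x * f S x) b

  residual-lin : ∀ {s} {g : Fin s → ℚ^ K} (g⊥ : Orthogonal g) c →
    residual g⊥ (lin c b) ≗ lin c (λ x → residual g⊥ (b x))
  residual-lin {s} {g} g⊥ c k = begin
    lin c b k - lin (coeff g⊥ (lin c b)) g k
      ≡⟨ cong (λ z → lin c b k - z) (trans (sum-cong-≗ λ i → cong (_* g i k) (coeff-lin i)) (sym (lin-lin c (λ x → coeff g⊥ (b x)) g k))) ⟩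
    lin c b k - lin c (λ x → lin (coeff g⊥ (b x)) g) k
      ≡⟨ sum-minus (λ x → c x * b x k) (λ x → c x * lin (coeff g⊥ (b x)) g k) ⟨
    ∑[ x < N ] (c x * b x k - c x * lin (coeff g⊥ (b x)) g k)
      ≡⟨ sum-cong-≗ (λ x → solve 3 (λ c y z → c :* y :- c :* z := c :* (y :- z)) refl (c x) (b x k) (lin (coeff g⊥ (b x)) g k)) ⟩
    lin c (λ x → residual g⊥ (b x)) k ∎
    where
    open ≡-Reasoning
    coeff-lin : ∀ i → coeff g⊥ (lin c b) i ≡ ∑[ x < N ] (c x * coeff g⊥ (b x) i)
    coeff-lin i = trans (cong (_* inv ⟪ g i , g i ⟫) (⟪⟫-linˡ c b (g i))) (trans
      (trans (ℚ.*-comm _ (inv ⟪ g i , g i ⟫)) (*-distribˡ-sum (inv ⟪ g i , g i ⟫) (λ x → c x * ⟪ b x , g i ⟫)))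
      (sum-cong-≗ λ x → solve 3 (λ n c z → n :* (c :* z) := c :* (z :* n)) refl (inv ⟪ g i , g i ⟫) (c x) ⟪ b x , g i ⟫))

  -- Bessel's inequality on the column side, applied to every row of the matrix ρ; the right side is
  -- its weighted Hilbert-Schmidt norm squared.
  bessel-Q : Q.Orthogonal f → (ρ : Fin N → ℚ^ K) →
    ∑[ S < P ] (inv Q.⟪ f S , f S ⟫ * ⟪ lin (λ x → q x * f S x) ρ , lin (λ x → q x * f S x) ρ ⟫)
      ≤ ∑[ x < N ] (q x * ⟪ ρ x , ρ x ⟫)
  bessel-Q f⊥ ρ = begin
    ∑[ S < P ] (inv Q.⟪ f S , f S ⟫ * ∑[ k < K ] (w k * (r S k * r S k)))
      ≡⟨ sum-cong-≗ (λ S → *-distribˡ-sum (inv Q.⟪ f S , f S ⟫) (λ k → w k * (r S k * r S k))) ⟩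
    ∑[ S < P ] ∑[ k < K ] (inv Q.⟪ f S , f S ⟫ * (w k * (r S k * r S k)))
      ≡⟨ ∑-comm (λ S k → inv Q.⟪ f S , f S ⟫ * (w k * (r S k * r S k))) ⟩
    ∑[ k < K ] ∑[ S < P ] (inv Q.⟪ f S , f S ⟫ * (w k * (r S k * r S k)))
      ≡⟨ sum-cong-≗ (λ k → trans (sum-cong-≗ λ S → trans
           (solve 3 (λ n w c → n :* (w :* (c :* c)) := w :* (c :* c :* n)) refl (inv Q.⟪ f S , f S ⟫) (w k) (r S k))
           (cong (λ c → w k * (c * c * inv Q.⟪ f S , f S ⟫)) (r≡ S k)))
           (sym (*-distribˡ-sum (w k) (λ S → Q.⟪ ρᵀ k , f S ⟫ * Q.⟪ ρᵀ k , f S ⟫ * inv Q.⟪ f S , f S ⟫)))) ⟩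
    ∑[ k < K ] (w k * ∑[ S < P ] (Q.⟪ ρᵀ k , f S ⟫ * Q.⟪ ρᵀ k , f S ⟫ * inv Q.⟪ f S , f S ⟫))
      ≤⟨ sum-mono-≤ (λ k → *-monoˡ-≤ (0≤w k) (Q.bessel f⊥ (ρᵀ k))) ⟩
    ∑[ k < K ] (w k * ∑[ x < N ] (q x * (ρ x k * ρ x k)))
      ≡⟨ sum-cong-≗ (λ k → *-distribˡ-sum (w k) (λ x → q x * (ρ x k * ρ x k))) ⟩
    ∑[ k < K ] ∑[ x < N ] (w k * (q x * (ρ x k * ρ x k)))
      ≡⟨ ∑-comm (λ k x → w k * (q x * (ρ x k * ρ x k))) ⟩
    ∑[ x < N ] ∑[ k < K ] (w k * (q x * (ρ x k * ρ x k)))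
      ≡⟨ sum-cong-≗ (λ x → trans (sum-cong-≗ λ k → solve 3 (λ w q c → w :* (q :* (c :* c)) := q :* (w :* (c :* c))) refl (w k) (q x) (ρ x k))
           (sym (*-distribˡ-sum (q x) (λ k → w k * (ρ x k * ρ x k))))) ⟩
    ∑[ x < N ] (q x * ⟪ ρ x , ρ x ⟫) ∎
    where
    open ℚ.≤-Reasoning
    r : Fin P → ℚ^ K
    r S = lin (λ x → q x * f S x) ρ
    ρᵀ : Fin K → ℚ^ N
    ρᵀ k x = ρ x k
    r≡ : ∀ S k → r S k ≡ Q.⟪ ρᵀ k , f S ⟫
    r≡ S k = sum-cong-≗ λ x → solve 3 (λ q f c → q :* f :* c := q :* (c :* f)) refl (q x) (f S x) (ρ x k)

  module _ (f⊥ : Q.Orthogonal f) (e⊥ : Orthogonal e) (0<∣f∣² : ∀ S → 0ℚ < Q.⟪ f S , f S ⟫)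
    (β : Fin P → Bool) {τ : ℚ} (0<τ : 0ℚ < τ)
    (∣e∣² : ∀ S → β S ≡ true → ⟪ e S , e S ⟫ ≡ τ * Q.⟪ f S , f S ⟫) where

    size : ℚ
    size = ∑[ S < P ] 𝟙⟨ β S ⟩

    module _ {s} {g : Fin s → ℚ^ K} (g⊥ : Orthogonal g) (0<∣g∣² : ∀ i → 0ℚ < ⟪ g i , g i ⟫) where

      -- The squared cosine of the angle between `e S` and `g i`.
      captured : Fin P → Fin s → ℚ
      captured S i = ⟪ e S , g i ⟫ * ⟪ e S , g i ⟫ * inv ⟪ g i , g i ⟫ * inv ⟪ e S , e S ⟫

      0≤captured : ∀ S i → 0ℚ ≤ captured S i
      0≤captured S i = 0≤x*y (0≤x*y (0≤x*x ⟪ e S , g i ⟫) (0≤inv (0≤⟪f,f⟫ (g i)))) (0≤inv (0≤⟪f,f⟫ (e S)))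

      -- Double counting: for a fixed i, Bessel's inequality for the orthogonal vectors `e S` shows
      -- that `g i` distributes at most one unit.
      total-captured : ∑[ S < P ] sum (captured S) ≤ ι s
      total-captured = begin
        ∑[ S < P ] sum (captured S)
          ≡⟨ ∑-comm captured ⟩
        ∑[ i < s ] ∑[ S < P ] captured S i
          ≡⟨ sum-cong-≗ (λ i → trans (sum-cong-≗ λ S → trans
               (solve 3 (λ c n m → c :* c :* n :* m := n :* (c :* c :* m)) refl ⟪ e S , g i ⟫ (inv ⟪ g i , g i ⟫) (inv ⟪ e S , e S ⟫))
               (cong (λ c → inv ⟪ g i , g i ⟫ * (c * c * inv ⟪ e S , e S ⟫)) (⟪⟫-comm (e S) (g i))))
               (sym (*-distribˡ-sum (inv ⟪ g i , g i ⟫) (λ S → ⟪ g i , e S ⟫ * ⟪ g i , e S ⟫ * inv ⟪ e S , e S ⟫)))) ⟩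
        ∑[ i < s ] (inv ⟪ g i , g i ⟫ * ∑[ S < P ] (⟪ g i , e S ⟫ * ⟪ g i , e S ⟫ * inv ⟪ e S , e S ⟫))
          ≤⟨ sum-mono-≤ (λ i → ℚ.≤-trans (*-monoˡ-≤ (0≤inv (0≤⟪f,f⟫ (g i))) (bessel e⊥ (g i)))
               (ℚ.≤-reflexive (trans (ℚ.*-comm _ ⟪ g i , g i ⟫) (*-inv (0<x⇒x≢0 (0<∣g∣² i)))))) ⟩
        ∑[ i < s ] 1ℚ
          ≡⟨ trans (sum-const s 1ℚ) (ℚ.*-identityʳ (ι s)) ⟩
        ι s ∎
        where open ℚ.≤-Reasoning

      -- In the class, |e|² / |f|² = τ and the residual keeps exactly the uncaptured share of it.
      -- Outside the class the left side is at most 0.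
      left-over : ∀ S → τ * (𝟙⟨ β S ⟩ - sum (captured S)) ≤ inv Q.⟪ f S , f S ⟫ * ⟪ residual g⊥ (e S) , residual g⊥ (e S) ⟫
      left-over S = by-cases (β S) refl
        where
        φ n X : ℚ
        φ = inv Q.⟪ f S , f S ⟫
        n = ⟪ e S , e S ⟫
        X = ∑[ i < s ] (⟪ e S , g i ⟫ * ⟪ e S , g i ⟫ * inv ⟪ g i , g i ⟫)
        captured≡ : sum (captured S) ≡ inv n * X
        captured≡ = trans (sum-cong-≗ λ i → ℚ.*-comm (⟪ e S , g i ⟫ * ⟪ e S , g i ⟫ * inv ⟪ g i , g i ⟫) (inv n)) (sym (*-distribˡ-sum (inv n) (λ i → ⟪ e S , g i ⟫ * ⟪ e S , g i ⟫ * inv ⟪ g i , g i ⟫)))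
        by-cases : ∀ c → β S ≡ c → τ * (𝟙⟨ β S ⟩ - sum (captured S)) ≤ φ * ⟪ residual g⊥ (e S) , residual g⊥ (e S) ⟫
        by-cases false βS = ℚ.≤-trans
          (subst (τ * (𝟙⟨ β S ⟩ - sum (captured S)) ≤_) (ℚ.*-zeroʳ τ) (*-monoˡ-≤ (ℚ.<⇒≤ 0<τ)
            (subst (λ c → 𝟙⟨ c ⟩ - sum (captured S) ≤ 0ℚ) (sym βS) (x-y≤x (0≤sum (0≤captured S))))))
          (0≤x*y (0≤inv (Q.0≤⟪f,f⟫ (f S))) (0≤⟪f,f⟫ (residual g⊥ (e S))))
        by-cases true βS = ℚ.≤-reflexive (begin
          τ * (𝟙⟨ β S ⟩ - sum (captured S))
            ≡⟨ cong₂ (λ c z → τ * (𝟙⟨ c ⟩ - z)) βS captured≡ ⟩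
          τ * (1ℚ - inv n * X)
            ≡⟨ solve 3 (λ t m x → t :* (con 1ℚ :- m :* x) := t :- t :* m :* x) refl τ (inv n) X ⟩
          τ - τ * inv n * X
            ≡⟨ cong₂ (λ y z → y - z * X) (sym φn≡τ) (sym φ≡) ⟩
          φ * n - φ * X
            ≡⟨ solve 3 (λ p n x → p :* n :- p :* x := p :* (n :- x)) refl φ n X ⟩
          φ * (n - X)
            ≡⟨ cong (φ *_) (∣residual∣² g⊥ (e S)) ⟨
          φ * ⟪ residual g⊥ (e S) , residual g⊥ (e S) ⟫ ∎)
          where
          open ≡-Reasoning
          m : ℚ
          m = Q.⟪ f S , f S ⟫
          φn≡τ : φ * n ≡ τ
          φn≡τ = trans (cong (φ *_) (∣e∣² S βS)) (trans (solve 3 (λ p t m → p :* (t :* m) := t :* (m :* p)) refl φ τ m)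
            (trans (cong (τ *_) (*-inv (0<x⇒x≢0 (0<∣f∣² S)))) (ℚ.*-identityʳ τ)))
          0<n : 0ℚ < n
          0<n = subst (0ℚ <_) (sym (∣e∣² S βS)) (0<x*y 0<τ (0<∣f∣² S))
          φ≡ : φ ≡ τ * inv n
          φ≡ = trans (sym (trans (cong (φ *_) (*-inv (0<x⇒x≢0 0<n))) (ℚ.*-identityʳ φ)))
            (trans (sym (ℚ.*-assoc φ n (inv n))) (cong (_* inv n) φn≡τ))

      -- The s chosen directions capture at most s of the singular directions in the class. What
      -- they miss survives in the residuals of the `e S`, which are the same combinations of the
      -- residual columns, so `bessel-Q` passes it on to those columns.
      remaining-mass : τ * (size - ι s) ≤ ∑[ x < N ] (q x * ⟪ residual g⊥ (b x) , residual g⊥ (b x) ⟫)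
      remaining-mass = begin
        τ * (size - ι s)
          ≤⟨ *-monoˡ-≤ (ℚ.<⇒≤ 0<τ) (ℚ.+-monoʳ-≤ size (ℚ.neg-antimono-≤ total-captured)) ⟩
        τ * (size - ∑[ S < P ] sum (captured S))
          ≡⟨ cong (τ *_) (sym (sum-minus (λ S → 𝟙⟨ β S ⟩) (λ S → sum (captured S)))) ⟩
        τ * ∑[ S < P ] (𝟙⟨ β S ⟩ - sum (captured S))
          ≡⟨ *-distribˡ-sum τ (λ S → 𝟙⟨ β S ⟩ - sum (captured S)) ⟩
        ∑[ S < P ] (τ * (𝟙⟨ β S ⟩ - sum (captured S)))
          ≤⟨ sum-mono-≤ left-over ⟩
        ∑[ S < P ] (inv Q.⟪ f S , f S ⟫ * ⟪ residual g⊥ (e S) , residual g⊥ (e S) ⟫)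
          ≡⟨ sum-cong-≗ (λ S → cong (inv Q.⟪ f S , f S ⟫ *_) (⟪⟫-cong (residual-lin g⊥ (λ x → q x * f S x)) (residual-lin g⊥ (λ x → q x * f S x)))) ⟩
        ∑[ S < P ] (inv Q.⟪ f S , f S ⟫ * ⟪ lin (λ x → q x * f S x) (λ x → residual g⊥ (b x)) , lin (λ x → q x * f S x) (λ x → residual g⊥ (b x)) ⟫)
          ≤⟨ bessel-Q f⊥ (λ x → residual g⊥ (b x)) ⟩
        ∑[ x < N ] (q x * ⟪ residual g⊥ (b x) , residual g⊥ (b x) ⟫) ∎
        where open ℚ.≤-Reasoning

    -- The newest vector has index zero; b (x i) lies in the span of g i and the older g's.
    record Chain (Λ : ℚ) (s : ℕ) : Set where
      field
        x     : Fin s → Fin N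
        g     : Fin s → ℚ^ K
        a     : Fin s → Fin s → ℚ
        g⊥    : Orthogonal g
        Λ≤    : ∀ i → Λ ≤ ⟪ g i , g i ⟫
        b≗    : ∀ i → b (x i) ≗ lin (a i) g
        aᵢᵢ≡1 : ∀ i → a i i ≡ 1ℚ
        aⱼᵢ≡0 : ∀ i j → i Fin.< j → a j i ≡ 0ℚ

      ⟪bᵢ,gᵢ⟫ : ∀ i → ⟪ b (x i) , g i ⟫ ≡ ⟪ g i , g i ⟫
      ⟪bᵢ,gᵢ⟫ i = trans (⟪⟫-cong (b≗ i) (λ _ → refl)) (trans (⟪lin,g⟫ g⊥ (a i) i)
        (trans (cong (_* ⟪ g i , g i ⟫) (aᵢᵢ≡1 i)) (ℚ.*-identityˡ ⟪ g i , g i ⟫)))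

      ⟪bⱼ,gᵢ⟫ : ∀ i j → i Fin.< j → ⟪ b (x j) , g i ⟫ ≡ 0ℚ
      ⟪bⱼ,gᵢ⟫ i j i<j = trans (⟪⟫-cong (b≗ j) (λ _ → refl)) (trans (⟪lin,g⟫ g⊥ (a j) i)
        (trans (cong (_* ⟪ g i , g i ⟫) (aⱼᵢ≡0 i j i<j)) (ℚ.*-zeroˡ ⟪ g i , g i ⟫)))

    extend : ∀ {Λ s} (c : Chain Λ s) (y : Fin N) → let open Chain c in
      Λ ≤ ⟪ residual g⊥ (b y) , residual g⊥ (b y) ⟫ → Chain Λ (suc s)
    extend {Λ} {s} c y Λ≤′ = record
      { x = x′ ; g = g′ ; a = a′ ; g⊥ = g′⊥
      ; Λ≤ = λ { zero → Λ≤′ ; (suc i) → Λ≤ i }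
      ; b≗ = b≗′
      ; aᵢᵢ≡1 = λ { zero → refl ; (suc i) → aᵢᵢ≡1 i }
      ; aⱼᵢ≡0 = λ { zero (suc j) _ → refl ; (suc i) (suc j) (ℕ.s≤s i<j) → aⱼᵢ≡0 i j i<j }
      }
      where
      open Chain c
      x′ : Fin (suc s) → Fin N
      x′ zero = y
      x′ (suc i) = x i
      g′ : Fin (suc s) → ℚ^ K
      g′ zero = residual g⊥ (b y)
      g′ (suc i) = g i
      a′ : Fin (suc s) → Fin (suc s) → ℚ
      a′ zero zero = 1ℚ
      a′ zero (suc j) = coeff g⊥ (b y) j
      a′ (suc i) zero = 0ℚ
      a′ (suc i) (suc j) = a i j
      g′⊥ : Orthogonal g′
      g′⊥ = orthogonal λ where
        zero zero 0≢0 → contradiction refl 0≢0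
        zero (suc j) _ → residual-⊥ g⊥ (b y) j
        (suc i) zero _ → trans (⟪⟫-comm (g i) (g′ zero)) (residual-⊥ g⊥ (b y) i)
        (suc i) (suc j) i≢j → pairwise g⊥ i j (λ i≡j → i≢j (cong suc i≡j))
      b≗′ : ∀ i → b (x′ i) ≗ lin (a′ i) g′
      b≗′ zero k = solve 2 (λ y l → y := con 1ℚ :* (y :- l) :+ l) refl (b y k) (lin (coeff g⊥ (b y)) g k)
      b≗′ (suc i) k = trans (b≗ i k) (solve 2 (λ z l → l := con 0ℚ :* z :+ l) refl (g′ zero k) (lin (a i) g k))

    chain : .{{_ : ℕ.NonZero N}} → ∀ {Λ} → 0ℚ < Λ → ∀ s → (∀ t → t ℕ.< s → sum q * Λ ≤ τ * (size - ι t)) → Chain Λ s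
    chain 0<Λ zero _ = record { x = λ () ; g = λ () ; a = λ () ; g⊥ = orthogonal λ () ; Λ≤ = λ () ; b≗ = λ () ; aᵢᵢ≡1 = λ () ; aⱼᵢ≡0 = λ () }
    chain {Λ} 0<Λ (suc s) enough = grow (chain 0<Λ s λ t t<s → enough t (ℕ.m<n⇒m<1+n t<s))
      where
      grow : Chain Λ s → Chain Λ (suc s)
      grow c = pick (sum-≤⇒∃≤ (λ y → q y * Λ) (λ y → q y * ⟪ residual g⊥ (b y) , residual g⊥ (b y) ⟫)
          (ℚ.≤-trans (ℚ.≤-reflexive Σ≡) (ℚ.≤-trans (enough s ℕ.≤-refl) (remaining-mass g⊥ (λ i → ℚ.<-≤-trans 0<Λ (Λ≤ i))))))
        where
        open Chain c
        Σ≡ : ∑[ y < N ] (q y * Λ) ≡ sum q * Λ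
        Σ≡ = trans (sum-cong-≗ λ y → ℚ.*-comm (q y) Λ) (trans (sym (*-distribˡ-sum Λ q)) (ℚ.*-comm Λ (sum q)))
        pick : (∃[ y ] q y * Λ ≤ q y * ⟪ residual g⊥ (b y) , residual g⊥ (b y) ⟫) → Chain Λ (suc s)
        pick (y , le) = extend c y (*-cancelˡ-≤ (0<q y) le)

-- Singular values of the anchored matrix

record Image {s N} (x : Fin s → Fin N) (J : Fin s → Bool) : Set where
  field
    set     : Subset N
    outside : ∀ v → (∀ i → x i ≢ v) → lookup set v ≡ false
    sum-set : ∀ (φ : Fin N → ℚ) → ∑[ v < N ] (𝟙⟨ lookup set v ⟩ * φ v) ≡ ∑[ i < s ] (𝟙⟨ J i ⟩ * φ (x i))

image : ∀ {s N} (x : Fin s → Fin N) (J : Fin s → Bool) → (∀ i j → i Fin.< j → x i ≢ x j) → Image x J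
image {zero} {N} x J x≢ = record
  { set = V.replicate N false
  ; outside = λ v _ → lookup-replicate v false
  ; sum-set = λ φ → sum-zero λ v → trans (cong (λ c → 𝟙⟨ c ⟩ * φ v) (lookup-replicate v false)) (ℚ.*-zeroˡ (φ v))
  }
image {suc s} {N} x J x≢ = add (J zero) refl (image (x ∘ suc) (J ∘ suc) (λ i j i<j → x≢ (suc i) (suc j) (ℕ.s≤s i<j)))
  where
  add : ∀ c → J zero ≡ c → Image (x ∘ suc) (J ∘ suc) → Image x J
  add false J≡ I = record
    { set = set
    ; outside = λ v x≢v → outside v (x≢v ∘ suc)
    ; sum-set = λ φ → trans (sum-set φ) (trans
        (solve 2 (λ p z → z := con 0ℚ :* p :+ z) refl (φ (x zero)) (∑[ i < s ] (𝟙⟨ J (suc i) ⟩ * φ (x (suc i)))))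
        (cong (λ c → 𝟙⟨ c ⟩ * φ (x zero) + ∑[ i < s ] (𝟙⟨ J (suc i) ⟩ * φ (x (suc i)))) (sym J≡)))
    }
    where open Image I
  add true J≡ I = record
    { set = set′
    ; outside = λ v x≢v → trans (lookup∘update′ (λ v≡ → x≢v zero (sym v≡)) set true) (outside v (x≢v ∘ suc))
    ; sum-set = sum-set′ N x₀ refl refl
    }
    where
    open Image I
    x₀ : Fin N
    x₀ = x zero
    set′ : Subset N
    set′ = set [ x₀ ]≔ true
    x₀∉ : lookup set x₀ ≡ false
    x₀∉ = outside x₀ (λ i x≡ → x≢ zero (suc i) (ℕ.s≤s ℕ.z≤n) (sym x≡))
    -- `sum-remove` needs a ground set of the form `suc M`; a separate M with M ≡ N allows that
    -- shape to be exposed by matching.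
    sum-set′ : ∀ M (y : Fin M) (M≡ : M ≡ N) → subst Fin M≡ y ≡ x₀ → ∀ (φ : Fin N → ℚ) →
      ∑[ v < N ] (𝟙⟨ lookup set′ v ⟩ * φ v) ≡ ∑[ i < suc s ] (𝟙⟨ J i ⟩ * φ (x i))
    sum-set′ (suc M) y refl refl φ = begin
      ∑[ v < suc M ] (𝟙⟨ lookup set′ v ⟩ * φ v)
        ≡⟨ sum-remove {i = x₀} (λ v → 𝟙⟨ lookup set′ v ⟩ * φ v) ⟩
      𝟙⟨ lookup set′ x₀ ⟩ * φ x₀ + ∑[ v < M ] (𝟙⟨ lookup set′ (punchIn x₀ v) ⟩ * φ (punchIn x₀ v))
        ≡⟨ cong₂ _+_ (cong (λ c → 𝟙⟨ c ⟩ * φ x₀) (trans (lookup∘update x₀ set true) (sym J≡)))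
             (trans (sum-cong-≗ λ v → cong (λ c → 𝟙⟨ c ⟩ * φ (punchIn x₀ v)) (lookup∘update′ (punchInᵢ≢i x₀ v) set true))
               (trans (sym (ℚ.+-identityˡ (rest φ))) (cong (_+ rest φ) (sym (trans (cong (λ c → 𝟙⟨ c ⟩ * φ x₀) x₀∉) (ℚ.*-zeroˡ (φ x₀))))))) ⟩
      𝟙⟨ J zero ⟩ * φ x₀ + (𝟙⟨ lookup set x₀ ⟩ * φ x₀ + rest φ)
        ≡⟨ cong (λ z → 𝟙⟨ J zero ⟩ * φ x₀ + z) (trans (sym (sum-remove {i = x₀} (λ v → 𝟙⟨ lookup set v ⟩ * φ v))) (sum-set φ)) ⟩
      ∑[ i < suc s ] (𝟙⟨ J i ⟩ * φ (x i)) ∎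
      where
      open ≡-Reasoning
      rest : (Fin (suc M) → ℚ) → ℚ
      rest φ = ∑[ v < M ] (𝟙⟨ lookup set (punchIn x₀ v) ⟩ * φ (punchIn x₀ v))

sum-𝟙 : ∀ {n} (β : Fin n → Bool) → ∃[ k ] ∑[ i < n ] 𝟙⟨ β i ⟩ ≡ ι k
sum-𝟙 {zero} β = 0 , refl
sum-𝟙 {suc n} β = add (β zero) (sum-𝟙 (β ∘ suc))
  where
  add : ∀ c → (∃[ k ] ∑[ i < n ] 𝟙⟨ β (suc i) ⟩ ≡ ι k) → ∃[ k ] 𝟙⟨ c ⟩ + ∑[ i < n ] 𝟙⟨ β (suc i) ⟩ ≡ ι k
  add true (k , eq) = suc k , trans (cong (1ℚ +_) eq) (sym (ι-suc k))
  add false (k , eq) = k , trans (ℚ.+-identityˡ _) eq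

ones : ∀ {d} → (Fin d → Fin 2) → ℕ
ones {zero} s = 0
ones {suc d} s = toℕ (s zero) ℕ.+ ones (s ∘ suc)

ones≤d : ∀ {d} (s : Fin d → Fin 2) → ones s ℕ.≤ d
ones≤d {zero} s = ℕ.z≤n
ones≤d {suc d} s = ℕ.+-mono-≤ (Fin.toℕ≤pred[n] (s zero)) (ones≤d (s ∘ suc))

∏-ones : ∀ {d} (σ : Fin 2 → ℚ) (s : Fin d → Fin 2) → ∏ (σ ∘ s) ≡ σ 0F ^ (d ∸ ones s) * σ 1F ^ ones s
∏-ones {zero} σ s = refl
∏-ones {suc d} σ s = by-cases (s zero) refl
  where
  r : ℕ
  r = ones (s ∘ suc)
  by-cases : ∀ a → s zero ≡ a → ∏ (σ ∘ s) ≡ σ 0F ^ (suc d ∸ ones s) * σ 1F ^ ones s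
  by-cases 0F s≡ = begin
    σ (s zero) * ∏ (σ ∘ s ∘ suc)                   ≡⟨ cong₂ _*_ (cong σ s≡) (∏-ones σ (s ∘ suc)) ⟩
    σ 0F * (σ 0F ^ (d ∸ r) * σ 1F ^ r)             ≡⟨ ℚ.*-assoc (σ 0F) _ _ ⟨
    σ 0F ^ suc (d ∸ r) * σ 1F ^ r                  ≡⟨ cong (λ k → σ 0F ^ k * σ 1F ^ r) (sym (ℕ.+-∸-assoc 1 (ones≤d (s ∘ suc)))) ⟩
    σ 0F ^ (suc d ∸ r) * σ 1F ^ r                  ≡⟨ cong (λ c → σ 0F ^ (suc d ∸ (toℕ c ℕ.+ r)) * σ 1F ^ (toℕ c ℕ.+ r)) s≡ ⟨
    σ 0F ^ (suc d ∸ ones s) * σ 1F ^ ones s ∎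
    where open ≡-Reasoning
  by-cases 1F s≡ = begin
    σ (s zero) * ∏ (σ ∘ s ∘ suc)                   ≡⟨ cong₂ _*_ (cong σ s≡) (∏-ones σ (s ∘ suc)) ⟩
    σ 1F * (σ 0F ^ (d ∸ r) * σ 1F ^ r)             ≡⟨ solve 3 (λ a b c → a :* (b :* c) := b :* (a :* c)) refl (σ 1F) (σ 0F ^ (d ∸ r)) (σ 1F ^ r) ⟩
    σ 0F ^ (d ∸ r) * σ 1F ^ suc r                  ≡⟨ cong (λ c → σ 0F ^ (suc d ∸ (toℕ c ℕ.+ r)) * σ 1F ^ (toℕ c ℕ.+ r)) s≡ ⟨
    σ 0F ^ (suc d ∸ ones s) * σ 1F ^ ones s ∎
    where open ≡-Reasoning

≡ᵇ-refl : ∀ n → (n ℕ.≡ᵇ n) ≡ true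
≡ᵇ-refl zero = refl
≡ᵇ-refl (suc n) = ≡ᵇ-refl n

≢⇒≡ᵇ : ∀ m n → m ≢ n → (m ℕ.≡ᵇ n) ≡ false
≢⇒≡ᵇ m n m≢n with m ℕ.≡ᵇ n in eq
... | true = contradiction (ℕ.≡ᵇ⇒≡ m n (subst T (sym eq) _)) m≢n
... | false = refl

anchored : Fin 2 → Fin 2 → Bool
anchored 0F 0F = true
anchored 0F 1F = false
anchored 1F _ = true

-- Words with the same number of 1's have the same singular value; the heaviest such class
-- carries a 1/(d+1) fraction of the trace norm (σ₀ + σ₁)^d.
module Buckets (d : ℕ) (σ : Fin 2 → ℚ) where

  level : ℕ → ℚ
  level a = σ 0F ^ (d ∸ a) * σ 1F ^ a

  count : Fin (2 ℕ.^ d) → ℕ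
  count S = ones {d} (finToFun S)

  bucket : Fin (suc d) → Fin (2 ℕ.^ d) → Bool
  bucket a S = count S ℕ.≡ᵇ toℕ a

  σ-level : ∀ S → ⊗ᵛ d σ S ≡ level (count S)
  σ-level S = ∏-ones {d} σ (finToFun S)

  bucket-σ : ∀ a S → bucket a S ≡ true → ⊗ᵛ d σ S ≡ level (toℕ a)
  bucket-σ a S S∈ = trans (σ-level S) (cong level (ℕ.≡ᵇ⇒≡ (count S) (toℕ a) (subst T (sym S∈) _)))

  σ-split : ∀ S → ⊗ᵛ d σ S ≡ ∑[ a < suc d ] (level (toℕ a) * 𝟙⟨ bucket a S ⟩)
  σ-split S = sym (trans (sum-at (λ a → level (toℕ a) * 𝟙⟨ bucket a S ⟩) a₀ others)
    (trans (cong₂ (λ k c → level k * 𝟙⟨ c ⟩) a₀≡ (trans (cong (count S ℕ.≡ᵇ_) a₀≡) (≡ᵇ-refl (count S))))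
      (trans (ℚ.*-identityʳ (level (count S))) (sym (σ-level S)))))
    where
    count< : count S ℕ.< suc d
    count< = ℕ.s≤s (ones≤d {d} (finToFun S))
    a₀ : Fin (suc d)
    a₀ = fromℕ< count<
    a₀≡ : toℕ a₀ ≡ count S
    a₀≡ = toℕ-fromℕ< count<
    others : ∀ a → a ≢ a₀ → level (toℕ a) * 𝟙⟨ bucket a S ⟩ ≡ 0ℚ
    others a a≢a₀ = trans (cong (λ c → level (toℕ a) * 𝟙⟨ c ⟩)
      (≢⇒≡ᵇ (count S) (toℕ a) (λ eq → a≢a₀ (toℕ-injective (trans (sym eq) (sym a₀≡)))))) (ℚ.*-zeroʳ (level (toℕ a)))

  heavy : ∃[ a ] (σ 0F + σ 1F) ^ d ≤ ι (suc d) * (level (toℕ a) * ∑[ S < 2 ℕ.^ d ] 𝟙⟨ bucket a S ⟩)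
  heavy = sum-≤⇒∃≤ (λ _ → (σ 0F + σ 1F) ^ d) (λ a → ι (suc d) * mass a) (ℚ.≤-reflexive (begin
    ∑[ a < suc d ] ((σ 0F + σ 1F) ^ d)
      ≡⟨ sum-const (suc d) ((σ 0F + σ 1F) ^ d) ⟩
    ι (suc d) * (σ 0F + σ 1F) ^ d
      ≡⟨ cong (ι (suc d) *_) (trans (cong (λ z → (σ 0F + z) ^ d) (sym (ℚ.+-identityʳ (σ 1F)))) (sym (sum-⊗ᵛ {2} d σ))) ⟩
    ι (suc d) * sum (⊗ᵛ d σ)
      ≡⟨ cong (ι (suc d) *_) (trans (sum-cong-≗ σ-split) (trans (∑-comm (λ S a → level (toℕ a) * 𝟙⟨ bucket a S ⟩))
           (sum-cong-≗ λ a → sym (*-distribˡ-sum (level (toℕ a)) (λ S → 𝟙⟨ bucket a S ⟩))))) ⟩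
    ι (suc d) * sum mass
      ≡⟨ *-distribˡ-sum (ι (suc d)) mass ⟩
    ∑[ a < suc d ] (ι (suc d) * mass a) ∎))
    where
    open ≡-Reasoning
    mass : Fin (suc d) → ℚ
    mass a = level (toℕ a) * ∑[ S < 2 ℕ.^ d ] 𝟙⟨ bucket a S ⟩

0<+ : ∀ {x y} → 0ℚ < x → 0ℚ ≤ y → 0ℚ < x + y
0<+ = ℚ.+-mono-<-≤

module Spectrum (M L : ℚ) (0<M : 0ℚ < M) (0<L : 0ℚ < L) where

  -- For the row weights p and column weights q the anchored 2×2 matrix has singular values σ and
  -- right singular vectors f; the trace norm is largest when (M + L)² ≈ 3 M².
  p q σ : Fin 2 → ℚ
  p 0F = L * (ι 2 * M + L)
  p 1F = ι 4 * (M * M)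
  q 0F = ι 4 * (M * M)
  q 1F = L * (ι 2 * M + L)
  σ 0F = ι 2 * M * (ι 2 * M + L)
  σ 1F = ι 2 * M * L

  f e : Fin 2 → Fin 2 → ℚ
  f 0F 0F = ι 2 * M + L
  f 0F 1F = ι 2 * M
  f 1F 0F = L
  f 1F 1F = - (ι 2 * M)
  e s r = ∑[ x < 2 ] (q x * (f s x * 𝟙⟨ anchored r x ⟩))

  ν : Fin 2 → ℚ
  ν s = ∑[ x < 2 ] (q x * (f s x * f s x))

  0<4MM : 0ℚ < ι 4 * (M * M)
  0<4MM = 0<x*y (0<ι 4) (0<x*y 0<M 0<M)

  0<2M+L : 0ℚ < ι 2 * M + L
  0<2M+L = 0<+ (0<x*y (0<ι 2) 0<M) (ℚ.<⇒≤ 0<L)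

  0<p : ∀ c → 0ℚ < p c
  0<p 0F = 0<x*y 0<L 0<2M+L
  0<p 1F = 0<4MM

  0<q : ∀ c → 0ℚ < q c
  0<q 0F = 0<4MM
  0<q 1F = 0<x*y 0<L 0<2M+L

  0<σ : ∀ c → 0ℚ < σ c
  0<σ 0F = 0<x*y (0<x*y (0<ι 2) 0<M) 0<2M+L
  0<σ 1F = 0<x*y (0<x*y (0<ι 2) 0<M) 0<L

  0<ν : ∀ s → 0ℚ < ν s
  0<ν 0F = 0<+ (0<x*y 0<4MM (0<x*y 0<2M+L 0<2M+L)) (0≤x+y (0≤x*y (ℚ.<⇒≤ (0<q 1F)) (0≤x*x (f 0F 1F))) ℚ.≤-refl)
  0<ν 1F = 0<+ (0<x*y 0<4MM (0<x*y 0<L 0<L)) (0≤x+y (0≤x*y (ℚ.<⇒≤ (0<q 1F)) (0≤x*x (f 1F 1F))) ℚ.≤-refl)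

  f⊥ : ∀ s s′ → s ≢ s′ → ∑[ x < 2 ] (q x * (f s x * f s′ x)) ≡ 0ℚ
  f⊥ 0F 0F 0≢0 = contradiction refl 0≢0
  f⊥ 0F 1F _ = solve 2 (λ M L → con (ι 4) :* (M :* M) :* ((con (ι 2) :* M :+ L) :* L)
    :+ (L :* (con (ι 2) :* M :+ L) :* (con (ι 2) :* M :* (:- (con (ι 2) :* M))) :+ con 0ℚ) := con 0ℚ) refl M L
  f⊥ 1F 0F _ = solve 2 (λ M L → con (ι 4) :* (M :* M) :* (L :* (con (ι 2) :* M :+ L))
    :+ (L :* (con (ι 2) :* M :+ L) :* ((:- (con (ι 2) :* M)) :* (con (ι 2) :* M)) :+ con 0ℚ) := con 0ℚ) refl M L
  f⊥ 1F 1F 1≢1 = contradiction refl 1≢1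

  private
    e′ : Fin 2 → Fin 2 → ℚ
    e′ 0F 0F = ι 4 * (M * M) * (ι 2 * M + L)
    e′ 0F 1F = ι 2 * M * ((ι 2 * M + L) * (ι 2 * M + L))
    e′ 1F 0F = ι 4 * (M * M) * L
    e′ 1F 1F = - (ι 2 * M * (L * L))

    e≡ : ∀ s r → e s r ≡ e′ s r
    e≡ 0F 0F = solve 2 (λ M L → con (ι 4) :* (M :* M) :* ((con (ι 2) :* M :+ L) :* con 1ℚ)
      :+ (L :* (con (ι 2) :* M :+ L) :* (con (ι 2) :* M :* con 0ℚ) :+ con 0ℚ)
      := con (ι 4) :* (M :* M) :* (con (ι 2) :* M :+ L)) refl M L
    e≡ 0F 1F = solve 2 (λ M L → con (ι 4) :* (M :* M) :* ((con (ι 2) :* M :+ L) :* con 1ℚ)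
      :+ (L :* (con (ι 2) :* M :+ L) :* (con (ι 2) :* M :* con 1ℚ) :+ con 0ℚ)
      := con (ι 2) :* M :* ((con (ι 2) :* M :+ L) :* (con (ι 2) :* M :+ L))) refl M L
    e≡ 1F 0F = solve 2 (λ M L → con (ι 4) :* (M :* M) :* (L :* con 1ℚ)
      :+ (L :* (con (ι 2) :* M :+ L) :* ((:- (con (ι 2) :* M)) :* con 0ℚ) :+ con 0ℚ)
      := con (ι 4) :* (M :* M) :* L) refl M L
    e≡ 1F 1F = solve 2 (λ M L → con (ι 4) :* (M :* M) :* (L :* con 1ℚ)
      :+ (L :* (con (ι 2) :* M :+ L) :* ((:- (con (ι 2) :* M)) :* con 1ℚ) :+ con 0ℚ)
      := :- (con (ι 2) :* M :* (L :* L))) refl M L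

    ⟪e,e⟫≡ : ∀ s s′ → ∑[ r < 2 ] (p r * (e s r * e s′ r)) ≡ ∑[ r < 2 ] (p r * (e′ s r * e′ s′ r))
    ⟪e,e⟫≡ s s′ = sum-cong-≗ {2} λ r → cong (p r *_) (cong₂ _*_ (e≡ s r) (e≡ s′ r))

  e⊥ : ∀ s s′ → s ≢ s′ → ∑[ r < 2 ] (p r * (e s r * e s′ r)) ≡ 0ℚ
  e⊥ 0F 0F 0≢0 = contradiction refl 0≢0
  e⊥ 0F 1F _ = trans (⟪e,e⟫≡ 0F 1F) (solve 2 (λ M L →
    L :* (con (ι 2) :* M :+ L) :* (con (ι 4) :* (M :* M) :* (con (ι 2) :* M :+ L) :* (con (ι 4) :* (M :* M) :* L))
    :+ (con (ι 4) :* (M :* M) :* (con (ι 2) :* M :* ((con (ι 2) :* M :+ L) :* (con (ι 2) :* M :+ L)) :* (:- (con (ι 2) :* M :* (L :* L)))) :+ con 0ℚ)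
    := con 0ℚ) refl M L)
  e⊥ 1F 0F _ = trans (⟪e,e⟫≡ 1F 0F) (solve 2 (λ M L →
    L :* (con (ι 2) :* M :+ L) :* (con (ι 4) :* (M :* M) :* L :* (con (ι 4) :* (M :* M) :* (con (ι 2) :* M :+ L)))
    :+ (con (ι 4) :* (M :* M) :* ((:- (con (ι 2) :* M :* (L :* L))) :* (con (ι 2) :* M :* ((con (ι 2) :* M :+ L) :* (con (ι 2) :* M :+ L)))) :+ con 0ℚ)
    := con 0ℚ) refl M L)
  e⊥ 1F 1F 1≢1 = contradiction refl 1≢1

  ∣e∣² : ∀ s → ∑[ r < 2 ] (p r * (e s r * e s r)) ≡ σ s * (σ s * ν s)
  ∣e∣² 0F = trans (⟪e,e⟫≡ 0F 0F) (solve 2 (λ M L →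
    L :* (con (ι 2) :* M :+ L) :* (con (ι 4) :* (M :* M) :* (con (ι 2) :* M :+ L) :* (con (ι 4) :* (M :* M) :* (con (ι 2) :* M :+ L)))
    :+ (con (ι 4) :* (M :* M) :* (con (ι 2) :* M :* ((con (ι 2) :* M :+ L) :* (con (ι 2) :* M :+ L)) :* (con (ι 2) :* M :* ((con (ι 2) :* M :+ L) :* (con (ι 2) :* M :+ L)))) :+ con 0ℚ)
    := con (ι 2) :* M :* (con (ι 2) :* M :+ L) :* (con (ι 2) :* M :* (con (ι 2) :* M :+ L) :*
      (con (ι 4) :* (M :* M) :* ((con (ι 2) :* M :+ L) :* (con (ι 2) :* M :+ L))
        :+ (L :* (con (ι 2) :* M :+ L) :* (con (ι 2) :* M :* (con (ι 2) :* M)) :+ con 0ℚ)))) refl M L)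
  ∣e∣² 1F = trans (⟪e,e⟫≡ 1F 1F) (solve 2 (λ M L →
    L :* (con (ι 2) :* M :+ L) :* (con (ι 4) :* (M :* M) :* L :* (con (ι 4) :* (M :* M) :* L))
    :+ (con (ι 4) :* (M :* M) :* ((:- (con (ι 2) :* M :* (L :* L))) :* (:- (con (ι 2) :* M :* (L :* L)))) :+ con 0ℚ)
    := con (ι 2) :* M :* L :* (con (ι 2) :* M :* L :*
      (con (ι 4) :* (M :* M) :* (L :* L)
        :+ (L :* (con (ι 2) :* M :+ L) :* ((:- (con (ι 2) :* M)) :* (:- (con (ι 2) :* M))) :+ con 0ℚ)))) refl M L)

  total : ℚ
  total = ι 3 * (M * M) + (M + L) * (M + L)

  sum-p : sum p ≡ total
  sum-p = solve 2 (λ M L → L :* (con (ι 2) :* M :+ L) :+ (con (ι 4) :* (M :* M) :+ con 0ℚ)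
    := con (ι 3) :* (M :* M) :+ (M :+ L) :* (M :+ L)) refl M L

  sum-q : sum q ≡ total
  sum-q = solve 2 (λ M L → con (ι 4) :* (M :* M) :+ (L :* (con (ι 2) :* M :+ L) :+ con 0ℚ)
    := con (ι 3) :* (M :* M) :+ (M :+ L) :* (M :+ L)) refl M L

  σ₀+σ₁ : σ 0F + σ 1F ≡ ι 4 * (M * (M + L))
  σ₀+σ₁ = solve 2 (λ M L → con (ι 2) :* M :* (con (ι 2) :* M :+ L) :+ con (ι 2) :* M :* L := con (ι 4) :* (M :* (M :+ L))) refl M L

sum-weighted : ∀ {n} (w : ℚ^ n) c → ∑[ i < n ] (w i * c) ≡ sum w * c
sum-weighted w c = trans (sum-cong-≗ λ i → ℚ.*-comm (w i) c) (trans (sym (*-distribˡ-sum c w)) (ℚ.*-comm c (sum w)))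

module LowerBound (d : ℕ) (M L : ℚ) (0<M : 0ℚ < M) (0<L : 0ℚ < L) where
  open Spectrum M L 0<M 0<L using (p; q; σ; f; ν; total; 0<p; 0<q; 0<σ; 0<ν)
  module ₁ = Spectrum M L 0<M 0<L

  rows columns : ℚ^ (2 ℕ.^ d)
  rows = ⊗ᵛ d p
  columns = ⊗ᵛ d q

  0<rows : ∀ r → 0ℚ < rows r
  0<rows r = 0<∏ {d} λ i → 0<p (finToFun r i)

  0<columns : ∀ x → 0ℚ < columns x
  0<columns x = 0<∏ {d} λ i → 0<q (finToFun x i)

  b F : Fin (2 ℕ.^ d) → ℚ^ (2 ℕ.^ d)
  b x r = 𝟙⟨ lookup (words d anchored r) x ⟩
  F = ⊗ d f

  open InnerProduct rows (λ r → ℚ.<⇒≤ (0<rows r))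
  open Greedy rows (λ r → ℚ.<⇒≤ (0<rows r)) columns 0<columns b F
  open Buckets d σ
  open Adversary rows (λ r → ℚ.<⇒≤ (0<rows r)) using (unbalanced; signed)

  e≗ : ∀ S → e S ≗ ⊗ d ₁.e S
  e≗ S r = trans (sum-cong-≗ λ x → trans (ℚ.*-assoc (columns x) (F S x) (b x r))
      (cong (λ z → columns x * (F S x * z)) (sym (⊗-words d anchored r x))))
    (sum-⊗ {2} {2} {2} d q f (λ r x → 𝟙⟨ anchored r x ⟩) S r)

  F⊥ : Q.Orthogonal F
  F⊥ = Q.orthogonal λ S S′ S≢S′ → trans (sum-⊗ {2} {2} {2} d q f f S S′) (⊗-diagonal d _ ₁.f⊥ S S′ S≢S′)

  ⟪e,e⟫ : ∀ S S′ → ⟪ e S , e S′ ⟫ ≡ ⊗ d (λ s s′ → ∑[ r < 2 ] (p r * (₁.e s r * ₁.e s′ r))) S S′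
  ⟪e,e⟫ S S′ = trans (⟪⟫-cong (e≗ S) (e≗ S′)) (sum-⊗ {2} {2} {2} d p ₁.e ₁.e S S′)

  e⊥ : Orthogonal e
  e⊥ = orthogonal λ S S′ S≢S′ → trans (⟪e,e⟫ S S′) (⊗-diagonal d _ ₁.e⊥ S S′ S≢S′)

  ∣F∣² : ∀ S → Q.⟪ F S , F S ⟫ ≡ ⊗ᵛ d ν S
  ∣F∣² S = sum-⊗ {2} {2} {2} d q f f S S

  0<∣F∣² : ∀ S → 0ℚ < Q.⟪ F S , F S ⟫
  0<∣F∣² S = subst (0ℚ <_) (sym (∣F∣² S)) (0<∏ {d} λ i → 0<ν (finToFun S i))

  ∣e∣² : ∀ S → ⟪ e S , e S ⟫ ≡ ⊗ᵛ d σ S * ⊗ᵛ d σ S * Q.⟪ F S , F S ⟫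
  ∣e∣² S = begin
    ⟪ e S , e S ⟫
      ≡⟨ trans (⟪e,e⟫ S S) (∏-cong {d} λ i → ₁.∣e∣² (finToFun S i)) ⟩
    ∏ {d} (λ i → σ (finToFun S i) * (σ (finToFun S i) * ν (finToFun S i)))
      ≡⟨ trans (∏-distrib-* d (λ i → σ (finToFun S i)) (λ i → σ (finToFun S i) * ν (finToFun S i)))
           (cong (⊗ᵛ d σ S *_) (∏-distrib-* d (λ i → σ (finToFun S i)) (λ i → ν (finToFun S i)))) ⟩
    ⊗ᵛ d σ S * (⊗ᵛ d σ S * ⊗ᵛ d ν S)
      ≡⟨ ℚ.*-assoc (⊗ᵛ d σ S) (⊗ᵛ d σ S) (⊗ᵛ d ν S) ⟨
    ⊗ᵛ d σ S * ⊗ᵛ d σ S * ⊗ᵛ d ν S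
      ≡⟨ cong (⊗ᵛ d σ S * ⊗ᵛ d σ S *_) (∣F∣² S) ⟨
    ⊗ᵛ d σ S * ⊗ᵛ d σ S * Q.⟪ F S , F S ⟫ ∎
    where open ≡-Reasoning

  C R : ℚ
  C = total ^ d
  R = (ι 4 * (M * (M + L))) ^ d

  sum-rows : sum rows ≡ C
  sum-rows = trans (sum-⊗ᵛ {2} d p) (cong (_^ d) ₁.sum-p)

  sum-columns : sum columns ≡ C
  sum-columns = trans (sum-⊗ᵛ {2} d q) (cong (_^ d) ₁.sum-q)

  0<C : 0ℚ < C
  0<C = 0<x^n d (0<+ (0<x*y (0<ι 3) (0<x*y 0<M 0<M)) (0≤x*x (M + L)))

  0<R : 0ℚ < R
  0<R = 0<x^n d (0<x*y (0<ι 4) (0<x*y 0<M (0<+ 0<M (ℚ.<⇒≤ 0<L))))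

  instance
    2^d≢0 : ℕ.NonZero (2 ℕ.^ d)
    2^d≢0 = ℕ.m^n≢0 2 d

  -- The squared norm averages the squares of the entries with total weight C, so some anchored box
  -- attains at least the average: this turns a bound in L² into one on the discrepancy.
  max-row : ∀ (h : ℚ^ (2 ℕ.^ d)) → ∃[ r ] ⟪ h , h ⟫ ≤ C * (h r * h r)
  max-row h = pick (sum-≤⇒∃≤ (λ r → rows r * ⟪ h , h ⟫) (λ r → rows r * (C * (h r * h r))) (ℚ.≤-reflexive (begin
      ∑[ r < 2 ℕ.^ d ] (rows r * ⟪ h , h ⟫)
        ≡⟨ trans (sum-weighted rows ⟪ h , h ⟫) (cong (_* ⟪ h , h ⟫) sum-rows) ⟩
      C * ⟪ h , h ⟫
        ≡⟨ *-distribˡ-sum C (λ r → rows r * (h r * h r)) ⟩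
      ∑[ r < 2 ℕ.^ d ] (C * (rows r * (h r * h r)))
        ≡⟨ sum-cong-≗ (λ r → solve 3 (λ c w z → c :* (w :* z) := w :* (c :* z)) refl C (rows r) (h r * h r)) ⟩
      ∑[ r < 2 ℕ.^ d ] (rows r * (C * (h r * h r))) ∎)))
    where
    open ≡-Reasoning
    pick : (∃[ r ] rows r * ⟪ h , h ⟫ ≤ rows r * (C * (h r * h r))) → ∃[ r ] ⟪ h , h ⟫ ≤ C * (h r * h r)
    pick (r , le) = r , *-cancelˡ-≤ (0<rows r) le

  Unbalanced : Subset (2 ℕ.^ d) → Set
  Unbalanced J = ∀ (χ : Colouring (2 ℕ.^ d)) → ∃[ r ]
    R * R ≤ ι (suc d) * ι (suc d) * (ι 80 * (C * (C * (ιℤ (colourSum χ (words d anchored r ∩ J)) * ιℤ (colourSum χ (words d anchored r ∩ J))))))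

  module _ (a : Fin (suc d)) (k : ℕ) (size≡ : ∑[ S < 2 ℕ.^ d ] 𝟙⟨ bucket a S ⟩ ≡ ι k)
    (heavy-a : R ≤ ι (suc d) * (level (toℕ a) * ι k)) where

    -- While at most half of the k singular directions are used up, the residual mass is at least
    -- τk/2; spread over columns of total weight C, it leaves some column with residual at least Λ =
    -- τk/(2C).
    λₐ τ Λ : ℚ
    λₐ = level (toℕ a)
    τ = λₐ * λₐ
    Λ = τ * ι k * (½ * inv C)

    0<λₐ : 0ℚ < λₐ
    0<λₐ = 0<x*y (0<x^n (d ∸ toℕ a) (0<σ 0F)) (0<x^n (toℕ a) (0<σ 1F))

    0<τ : 0ℚ < τ
    0<τ = 0<x*y 0<λₐ 0<λₐ

    0<ιk : 0ℚ < ι k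
    0<ιk = positive k refl
      where
      positive : ∀ j → j ≡ k → 0ℚ < ι k
      -- An empty class would carry no trace norm, against `heavy-a` and 0 < R.
      positive zero refl = contradiction
        (ℚ.<-≤-trans 0<R (ℚ.≤-trans heavy-a (ℚ.≤-reflexive (trans (cong (ι (suc d) *_) (ℚ.*-zeroʳ λₐ)) (ℚ.*-zeroʳ (ι (suc d)))))))
        (ℚ.<-irrefl refl)
      positive (suc j) refl = 0<ι (suc j)

    CΛ : C * Λ ≡ τ * (½ * ι k)
    CΛ = trans (solve 5 (λ c t k h i → c :* (t :* k :* (h :* i)) := t :* (h :* k) :* (c :* i)) refl C τ (ι k) ½ (inv C))
      (trans (cong (τ * (½ * ι k) *_) (*-inv (0<x⇒x≢0 0<C))) (ℚ.*-identityʳ _))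

    0<Λ : 0ℚ < Λ
    0<Λ = ℚ.*-cancelˡ-<-nonNeg C {{ℚ.nonNegative (ℚ.<⇒≤ 0<C)}}
      (subst₂ _<_ (sym (ℚ.*-zeroʳ C)) (sym CΛ) (0<x*y 0<τ (0<x*y (ℚ.positive⁻¹ ½) 0<ιk)))

    -- Rounding up keeps s ≥ k/2, while every t < s still satisfies 2t ≤ k, as the greedy choice
    -- needs.
    s : ℕ
    s = ⌈ k /2⌉

    enough : ∀ t → t ℕ.< s → sum columns * Λ ≤ τ * (∑[ S < 2 ℕ.^ d ] 𝟙⟨ bucket a S ⟩ - ι t)
    enough t t<s = subst₂ _≤_ (sym (trans (cong (_* Λ) sum-columns) CΛ)) (cong (λ z → τ * (z - ι t)) (sym size≡))
      (*-monoˡ-≤ (ℚ.<⇒≤ 0<τ) (≤-by (½ * (ι k - ι 2 * ι t)) (0≤x*y {½} (ℚ.≤ᵇ⇒≤ _) (x≤y⇒0≤y-x 2t≤k))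
        (solve 2 (λ k t → k :- t := con ½ :* k :+ con ½ :* (k :- con (ι 2) :* t)) refl (ι k) (ι t))))
      where
      2t≤k : ι 2 * ι t ≤ ι k
      2t≤k = subst (_≤ ι k) (ι-* 2 t) (ι-mono-≤ (ℕ.≤-pred (begin
        suc (2 ℕ.* t)                     ≤⟨ ℕ.n≤1+n _ ⟩
        suc (suc (2 ℕ.* t))               ≡⟨ cong suc (sym (ℕ.+-suc t (t ℕ.+ 0))) ⟩
        suc t ℕ.+ suc (t ℕ.+ 0)           ≡⟨ cong (λ z → suc t ℕ.+ suc z) (ℕ.+-identityʳ t) ⟩
        suc t ℕ.+ suc t                   ≤⟨ ℕ.+-mono-≤ t<s t<s ⟩
        ⌈ k /2⌉ ℕ.+ ⌈ k /2⌉               ≤⟨ ℕ.+-monoˡ-≤ ⌈ k /2⌉ (ℕ.⌊n/2⌋-mono (ℕ.≤-refl {suc k})) ⟩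
        ℕ.⌊ suc k /2⌋ ℕ.+ ⌈ k /2⌉         ≤⟨ ℕ.+-monoʳ-≤ ℕ.⌊ suc k /2⌋ (ℕ.⌈n/2⌉-mono (ℕ.n≤1+n k)) ⟩
        ℕ.⌊ suc k /2⌋ ℕ.+ ⌈ suc k /2⌉     ≡⟨ ℕ.⌊n/2⌋+⌈n/2⌉≡n (suc k) ⟩
        suc k ∎)))
        where open ℕ.≤-Reasoning

    ½k≤s : ½ * ι k ≤ ι s
    ½k≤s = *-cancelˡ-≤ (0<ι 2) (subst₂ _≤_ (solve 1 (λ k → k := con (ι 2) :* (con ½ :* k)) refl (ι k)) (ι-* 2 s) (ι-mono-≤ (begin
      k                          ≡⟨ ℕ.⌊n/2⌋+⌈n/2⌉≡n k ⟨
      ℕ.⌊ k /2⌋ ℕ.+ ⌈ k /2⌉      ≤⟨ ℕ.+-monoˡ-≤ ⌈ k /2⌉ (ℕ.⌊n/2⌋≤⌈n/2⌉ k) ⟩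
      s ℕ.+ s                    ≡⟨ cong (s ℕ.+_) (ℕ.+-identityʳ s) ⟨
      2 ℕ.* s ∎)))
      where open ℕ.≤-Reasoning

    ∣e∣²-bucket : ∀ S → bucket a S ≡ true → ⟪ e S , e S ⟫ ≡ τ * Q.⟪ F S , F S ⟫
    ∣e∣²-bucket S S∈ = trans (∣e∣² S) (cong (λ z → z * z * Q.⟪ F S , F S ⟫) (bucket-σ a S S∈))

    -- From R ≤ (d+1) λₐ k follows R² ≤ 4 (d+1)² (k/2) C Λ. Then k/2 ≤ s, and the two hypotheses
    -- bound sΛ by 20 C z, which gives 80 = 4 · 20.
    R²≤ : ∀ {h z} → ι s * Λ ≤ ι 20 * h → h ≤ C * z → R * R ≤ ι (suc d) * ι (suc d) * (ι 80 * (C * (C * z)))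
    R²≤ {h} {z} sΛ≤ h≤ = begin
      R * R
        ≤⟨ *-mono-≤ (ℚ.<⇒≤ 0<R) (ℚ.≤-trans (ℚ.<⇒≤ 0<R) heavy-a) heavy-a heavy-a ⟩
      ι (suc d) * (λₐ * ι k) * (ι (suc d) * (λₐ * ι k))
        ≡⟨ solve 3 (λ n l k → n :* (l :* k) :* (n :* (l :* k)) := n :* n :* (con (ι 4) :* (con ½ :* k :* (l :* l :* (con ½ :* k))))) refl (ι (suc d)) λₐ (ι k) ⟩
      ι (suc d) * ι (suc d) * (ι 4 * (½ * ι k * (τ * (½ * ι k))))
        ≡⟨ cong (λ y → ι (suc d) * ι (suc d) * (ι 4 * (½ * ι k * y))) CΛ ⟨
      ι (suc d) * ι (suc d) * (ι 4 * (½ * ι k * (C * Λ)))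
        ≤⟨ *-monoˡ-≤ 0≤n² (*-monoˡ-≤ (0≤ι 4) (*-monoʳ-≤ (0≤x*y (ℚ.<⇒≤ 0<C) (ℚ.<⇒≤ 0<Λ)) ½k≤s)) ⟩
      ι (suc d) * ι (suc d) * (ι 4 * (ι s * (C * Λ)))
        ≡⟨ cong (λ y → ι (suc d) * ι (suc d) * (ι 4 * y)) (solve 3 (λ s c l → s :* (c :* l) := c :* (s :* l)) refl (ι s) C Λ) ⟩
      ι (suc d) * ι (suc d) * (ι 4 * (C * (ι s * Λ)))
        ≤⟨ *-monoˡ-≤ 0≤n² (*-monoˡ-≤ (0≤ι 4) (*-monoˡ-≤ (ℚ.<⇒≤ 0<C) (ℚ.≤-trans sΛ≤ (*-monoˡ-≤ (0≤ι 20) h≤)))) ⟩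
      ι (suc d) * ι (suc d) * (ι 4 * (C * (ι 20 * (C * z))))
        ≡⟨ solve 3 (λ n c z → n :* (con (ι 4) :* (c :* (con (ι 20) :* (c :* z)))) := n :* (con (ι 80) :* (c :* (c :* z)))) refl (ι (suc d) * ι (suc d)) C z ⟩
      ι (suc d) * ι (suc d) * (ι 80 * (C * (C * z))) ∎
      where
      open ℚ.≤-Reasoning
      0≤n² : 0ℚ ≤ ι (suc d) * ι (suc d)
      0≤n² = 0≤x*x (ι (suc d))

    from-chain : Chain F⊥ e⊥ 0<∣F∣² (bucket a) 0<τ ∣e∣²-bucket Λ s → Σ[ J ∈ Subset (2 ℕ.^ d) ] Unbalanced J
    from-chain c = finish (unbalanced g (b ∘ x) g⊥ 0<Λ Λ≤ ⟪bᵢ,gᵢ⟫ ⟪bⱼ,gᵢ⟫)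
      where
      open Chain c
      -- A repeated column would have inner product with `g i` both equal to its positive squared
      -- norm and equal to 0.
      distinct : ∀ i j → i Fin.< j → x i ≢ x j
      distinct i j i<j xᵢ≡xⱼ = 0<x⇒x≢0 (ℚ.<-≤-trans 0<Λ (Λ≤ i))
        (trans (sym (⟪bᵢ,gᵢ⟫ i)) (trans (cong (λ y → ⟪ b y , g i ⟫) xᵢ≡xⱼ) (⟪bⱼ,gᵢ⟫ i j i<j)))
      finish : Σ[ B ∈ (Fin s → Bool) ] (∀ ε → ι s * Λ ≤ ι 20 * ⟪ lin (signed B ε) (b ∘ x) , lin (signed B ε) (b ∘ x) ⟫) →
        Σ[ J ∈ Subset (2 ℕ.^ d) ] Unbalanced J
      finish (B , large) = set , λ χ → row χ (max-row (lin (signed B (λ i → lookup χ (x i))) (b ∘ x)))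
        where
        open Image (image x B distinct)
        colour-sum : ∀ χ r → lin (signed B (λ i → lookup χ (x i))) (b ∘ x) r ≡ ιℤ (colourSum χ (words d anchored r ∩ set))
        colour-sum χ r = begin
          ∑[ i < s ] (𝟙⟨ B i ⟩ * sgn (lookup χ (x i)) * b (x i) r)
            ≡⟨ sum-cong-≗ (λ i → ℚ.*-assoc 𝟙⟨ B i ⟩ (sgn (lookup χ (x i))) (b (x i) r)) ⟩
          ∑[ i < s ] (𝟙⟨ B i ⟩ * (sgn (lookup χ (x i)) * b (x i) r))
            ≡⟨ sum-set (λ v → sgn (lookup χ v) * b v r) ⟨
          ∑[ v < 2 ℕ.^ d ] (𝟙⟨ lookup set v ⟩ * (sgn (lookup χ v) * b v r))
            ≡⟨ sum-cong-≗ (λ v → solve 3 (λ i s b → i :* (s :* b) := b :* (i :* s)) refl 𝟙⟨ lookup set v ⟩ (sgn (lookup χ v)) (b v r)) ⟩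
          ∑[ v < 2 ℕ.^ d ] (b v r * (𝟙⟨ lookup set v ⟩ * sgn (lookup χ v)))
            ≡⟨ ιℤ-colourSum χ (words d anchored r) set ⟨
          ιℤ (colourSum χ (words d anchored r ∩ set)) ∎
          where open ≡-Reasoning
        row : ∀ χ → (let h = lin (signed B (λ i → lookup χ (x i))) (b ∘ x) in ∃[ r ] ⟪ h , h ⟫ ≤ C * (h r * h r)) → ∃[ r ]
          R * R ≤ ι (suc d) * ι (suc d) * (ι 80 * (C * (C * (ιℤ (colourSum χ (words d anchored r ∩ set)) * ιℤ (colourSum χ (words d anchored r ∩ set))))))
        row χ (r , h≤) = r , R²≤ (large (λ i → lookup χ (x i))) (ℚ.≤-trans h≤ (ℚ.≤-reflexive (cong (λ z → C * (z * z)) (colour-sum χ r))))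

    unbalanced-set : Σ[ J ∈ Subset (2 ℕ.^ d) ] Unbalanced J
    unbalanced-set = from-chain (chain F⊥ e⊥ 0<∣F∣² (bucket a) 0<τ ∣e∣²-bucket 0<Λ s enough)

  hard-set : Σ[ J ∈ Subset (2 ℕ.^ d) ] Unbalanced J
  hard-set = from-heavy heavy
    where
    from-heavy : (∃[ a ] (σ 0F + σ 1F) ^ d ≤ ι (suc d) * (level (toℕ a) * ∑[ S < 2 ℕ.^ d ] 𝟙⟨ bucket a S ⟩)) → Σ[ J ∈ Subset (2 ℕ.^ d) ] Unbalanced J
    from-heavy (a , R≤) = from-size (sum-𝟙 (bucket a))
      where
      from-size : (∃[ k ] ∑[ S < 2 ℕ.^ d ] 𝟙⟨ bucket a S ⟩ ≡ ι k) → Σ[ J ∈ Subset (2 ℕ.^ d) ] Unbalanced J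
      from-size (k , size≡) = unbalanced-set a k size≡
        (subst₂ _≤_ (cong (_^ d) ₁.σ₀+σ₁) (cong (λ z → ι (suc d) * (level (toℕ a) * z)) size≡) R≤)

-- Extrema over finite set systems, and real boxes

-- Carries just the extrema of numerical functions; this passes from a letter to vectors, hence to
-- colourings and subsets, without listing them.
record Searchable (A : Set) : Set where
  field
    argmax : ∀ (f : A → ℕ) → Σ[ a ∈ A ] (∀ a′ → f a′ ℕ.≤ f a)
    argmin : ∀ (f : A → ℕ) → Σ[ a ∈ A ] (∀ a′ → f a ℕ.≤ f a′)

open Searchable

searchable-pair : ∀ {A : Set} (a b : A) → (∀ c → c ≡ a ⊎ c ≡ b) → Searchable A
searchable-pair a b cover .argmax f with ℕ.≤-total (f a) (f b)
... | inj₁ a≤b = b , λ c → [ (λ { refl → a≤b }) , (λ { refl → ℕ.≤-refl }) ]′ (cover c)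
... | inj₂ b≤a = a , λ c → [ (λ { refl → ℕ.≤-refl }) , (λ { refl → b≤a }) ]′ (cover c)
searchable-pair a b cover .argmin f with ℕ.≤-total (f a) (f b)
... | inj₁ a≤b = a , λ c → [ (λ { refl → ℕ.≤-refl }) , (λ { refl → a≤b }) ]′ (cover c)
... | inj₂ b≤a = b , λ c → [ (λ { refl → b≤a }) , (λ { refl → ℕ.≤-refl }) ]′ (cover c)

searchable-Vec : ∀ {A} → Searchable A → ∀ n → Searchable (V.Vec A n)
searchable-Vec S zero .argmax f = [] , λ { [] → ℕ.≤-refl }
searchable-Vec S zero .argmin f = [] , λ { [] → ℕ.≤-refl }
searchable-Vec S (suc n) .argmax f =
  let best = λ a → argmax (searchable-Vec S n) (λ v → f (a ∷ v))
      a , a-max = argmax S (λ a → f (a ∷ proj₁ (best a)))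
  in a ∷ proj₁ (best a) , λ { (a′ ∷ v) → ℕ.≤-trans (proj₂ (best a′) v) (a-max a′) }
searchable-Vec S (suc n) .argmin f =
  let best = λ a → argmin (searchable-Vec S n) (λ v → f (a ∷ v))
      a , a-min = argmin S (λ a → f (a ∷ proj₁ (best a)))
  in a ∷ proj₁ (best a) , λ { (a′ ∷ v) → ℕ.≤-trans (a-min a′) (proj₂ (best a′) v) }

searchable-Sign : Searchable Sign
searchable-Sign = searchable-pair Sign.+ Sign.- λ { Sign.+ → inj₁ refl ; Sign.- → inj₂ refl }

searchable-Bool : Searchable Bool
searchable-Bool = searchable-pair true false λ { true → inj₁ refl ; false → inj₂ refl }

argmax-Fin : ∀ {n} → .{{ℕ.NonZero n}} → (f : Fin n → ℕ) → Σ[ i ∈ Fin n ] (∀ j → f j ℕ.≤ f i)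
argmax-Fin {suc zero} f = zero , λ { zero → ℕ.≤-refl }
argmax-Fin {suc (suc n)} f with argmax-Fin (f ∘ suc)
... | i , i-max with ℕ.≤-total (f zero) (f (suc i))
...   | inj₁ 0≤i = suc i , λ { zero → 0≤i ; (suc j) → i-max j }
...   | inj₂ i≤0 = zero , λ { zero → ℕ.≤-refl ; (suc j) → ℕ.≤-trans (i-max j) i≤0 }

-- Membership in 𝓕 involves real bounds and is not decidable, so the maxima are taken over a finite
-- index set whose members exhaust 𝓕.
module Enumerated {n M} .{{_ : ℕ.NonZero M}} {𝓕 : SetSystem n} (E : Fin M → Subset n)
  (sound : ∀ c → 𝓕 (E c)) (complete : ∀ F → 𝓕 F → ∃[ c ] F ≡ E c) where

  imbalance : Colouring n → Subset n → Fin M → ℕ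
  imbalance x J c = ℤ.∣ colourSum x (E c ∩ J) ∣

  max-imbalance : ∀ x J → ∃[ k ] MaxImbalance (𝓕 ∣ˢ J) x k
  max-imbalance x J = let c , c-max = argmax-Fin (imbalance x J) in
    imbalance x J c , (E c ∩ J , (E c , sound c , refl) , refl) ,
    λ { k (G , (F , F∈ , refl) , refl) → let c′ , F≡ = complete F F∈ in
      subst (λ F → ℤ.∣ colourSum x (F ∩ J) ∣ ℕ.≤ imbalance x J c) (sym F≡) (c-max c′) }

  disc : ∀ J → ∃[ k ] Disc (𝓕 ∣ˢ J) k
  disc J = let x , x-min = argmin (searchable-Vec searchable-Sign n) (λ x → proj₁ (max-imbalance x J)) in
    proj₁ (max-imbalance x J) , (x , proj₂ (max-imbalance x J)) ,
    λ { k (x′ , _ , k-max) → ℕ.≤-trans (x-min x′) (k-max _ (proj₁ (proj₂ (max-imbalance x′ J)))) }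

  herdisc : ∃[ k ] HerDisc 𝓕 k
  herdisc = let J , J-max = argmax (searchable-Vec searchable-Bool n) (λ J → proj₁ (disc J)) in
    proj₁ (disc J) , (J , proj₂ (disc J)) ,
    λ { k (J′ , _ , k-min) → ℕ.≤-trans (k-min _ (proj₁ (proj₂ (disc J′)))) (J-max J′) }

  herdisc-upper : ∀ {h} {U : Pred ℕ 0ℓ} → (∀ {a b} → a ℕ.≤ b → U b → U a) → HerDisc 𝓕 h →
    (∀ J → Σ[ x ∈ Colouring n ] (∀ c → U (imbalance x J c))) → U h
  herdisc-upper {U = U} anti ((J , _ , h-min) , _) balanced =
    let x , U-x = balanced J
        k , k-max = max-imbalance x J
        (G , (F , F∈ , G≡) , k≡) , _ = k-max
        c , F≡ = complete F F∈
    in anti (h-min k (x , k-max))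
         (subst U (sym (trans k≡ (cong (λ G → ℤ.∣ colourSum x G ∣) (trans G≡ (cong (_∩ J) F≡))))) (U-x c))

  herdisc-lower : ∀ {h} {L : Pred ℕ 0ℓ} → (∀ {a b} → a ℕ.≤ b → L a → L b) → HerDisc 𝓕 h →
    ∀ J → (∀ x → ∃[ c ] L (imbalance x J c)) → L h
  herdisc-lower mono (_ , h-max) J unbalanced =
    let k , (x , k-max) , k-min = disc J
        c , L-c = unbalanced x
    in mono (ℕ.≤-trans (proj₂ k-max _ (E c ∩ J , (E c , sound c , refl) , refl)) (h-max k (J , (x , k-max) , k-min))) L-c

-- Traces of real boxes are words.

allᵇ⇒ : ∀ {n} (f : Fin n → Bool) → allᵇ f ≡ true → ∀ i → f i ≡ true
allᵇ⇒ {suc n} f eq i with f zero in f₀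
allᵇ⇒ {suc n} f eq zero | true = f₀
allᵇ⇒ {suc n} f eq (suc i) | true = allᵇ⇒ (f ∘ suc) eq i

⇒allᵇ : ∀ {n} (f : Fin n → Bool) → (∀ i → f i ≡ true) → allᵇ f ≡ true
⇒allᵇ {zero} f f≡ = refl
⇒allᵇ {suc n} f f≡ = trans (cong (_∧ allᵇ (f ∘ suc)) (f≡ zero)) (⇒allᵇ (f ∘ suc) (f≡ ∘ suc))

bool-ext : ∀ {a b : Bool} → (a ≡ true → b ≡ true) → (b ≡ true → a ≡ true) → a ≡ b
bool-ext {true} to from = sym (to refl)
bool-ext {false} {false} to from = refl
bool-ext {false} {true} to from = from refl

digit : ∀ {d} → Fin (2 ℕ.^ d) → Fin d → Fin 2
digit = finToFun

record IsProduct {d} (In : Fin d → Pred (Fin 2) 0ℓ) (F : Subset (2 ℕ.^ d)) : Set where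
  constructor isProduct
  field
    members : ∀ v → v ∈ F ⇔ (∀ i → In i (digit {d} v i))

open IsProduct

words-product : ∀ {A} d (ok : Fin A → Fin 2 → Bool) (In : Fin d → Pred (Fin 2) 0ℓ) c →
  (∀ i x → ok (finToFun c i) x ≡ true → In i x) → (∀ i x → In i x → ok (finToFun c i) x ≡ true) →
  IsProduct In (words d ok c)
words-product d ok In c to from = isProduct λ v → mk⇔
  (λ v∈ i → to i (digit v i) (allᵇ⇒ {d} _ (trans (sym (lookup∘tabulate _ v)) ([]=⇒lookup v∈)) i))
  (λ in-all → lookup⇒[]= v (words d ok c) (trans (lookup∘tabulate _ v) (⇒allᵇ {d} _ (λ i → from i (digit v i) (in-all i)))))

module _ {d} {In : Fin d → Pred (Fin 2) 0ℓ} {F : Subset (2 ℕ.^ d)} (F-product : IsProduct In F) where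

  product⇒words : ∀ {A} (ok : Fin A → Fin 2 → Bool) (letter : Fin d → Fin A) →
    (∀ i x → ok (letter i) x ≡ true → In i x) → (∀ i x → In i x → ok (letter i) x ≡ true) →
    F ≡ words d ok (funToFin letter)
  product⇒words ok letter to from = trans (sym (tabulate∘lookup F)) (tabulate-cong λ v → bool-ext
      (λ F∋v → ⇒allᵇ {d} _ λ i → trans (cong (λ a → ok a (digit v i)) (finToFun-funToFin letter i))
        (from i (digit v i) (Equivalence.to (members F-product v) (lookup⇒[]= v F F∋v) i)))
      (λ ok-v → []=⇒lookup (Equivalence.from (members F-product v) λ i → to i (digit v i)
        (trans (cong (λ a → ok a (digit v i)) (sym (finToFun-funToFin letter i))) (allᵇ⇒ {d} _ ok-v i)))))

  -- Membership in a factor is decided by changing one coordinate of a member v of F.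
  module _ (v : Fin (2 ℕ.^ d)) (v∈F : v ∈ F) where

    change : Fin d → Fin 2 → Fin (2 ℕ.^ d)
    change i x = funToFin (updateAt (digit v) i (const x))

    digit-change : ∀ i x j → digit (change i x) j ≡ updateAt (digit v) i (const x) j
    digit-change i x = finToFun-funToFin (updateAt (digit v) i (const x))

    -- The factors are given by comparisons of reals, which cannot be decided, whereas `F` is a
    -- vector of Booleans.
    test : Fin d → Fin 2 → Bool
    test i x = lookup F (change i x)

    test⇒In : ∀ i x → test i x ≡ true → In i x
    test⇒In i x t = subst (In i) (trans (digit-change i x i) (updateAt-updates i (digit v)))
      (Equivalence.to (members F-product (change i x)) (lookup⇒[]= (change i x) F t) i)

    In⇒test : ∀ i x → In i x → test i x ≡ true
    In⇒test i x x∈ = []=⇒lookup (Equivalence.from (members F-product (change i x)) λ j → subst (In j) (sym (digit-change i x j)) (at j))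
      where
      at : ∀ j → In j (updateAt (digit v) i (const x) j)
      at j with j ≟ i
      ... | yes refl = subst (In j) (sym (updateAt-updates j (digit v))) x∈
      ... | no j≢i = subst (In j) (sym (updateAt-minimal j i (digit v) j≢i)) (Equivalence.to (members F-product v) v∈F j)


≤ℚ⇒≤ℝ : ∀ {p q} → p ℚ.≤ q → fromℚ p ≤ℝ fromℚ q
≤ℚ⇒≤ℝ {p} {q} p≤q n = ℚ.≤-trans p≤q (subst (ℚ._≤ q ℚ.+ ((1/1+ n) ℚ.+ (1/1+ n))) (ℚ.+-identityʳ q)
  (ℚ.+-monoʳ-≤ q (ℚ.+-mono-≤ {0ℚ} {1/1+ n} 0≤ 0≤)))
  where
  0≤ : 0ℚ ℚ.≤ 1/1+ n
  0≤ = ℚ.nonNegative⁻¹ (1/1+ n) {{ℚ.normalize-nonNeg 1 (suc n)}}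

0≤ℝ0 : fromℕ 0 ≤ℝ fromℕ 0
0≤ℝ0 = ≤ℚ⇒≤ℝ {ℤ.+ 0 ℚ./ 1} {ℤ.+ 0 ℚ./ 1} ℚ.≤-refl

0≤ℝ1 : fromℕ 0 ≤ℝ fromℕ 1
0≤ℝ1 = ≤ℚ⇒≤ℝ {ℤ.+ 0 ℚ./ 1} {ℤ.+ 1 ℚ./ 1} (ℚ.≤ᵇ⇒≤ _)

1≤ℝ1 : fromℕ 1 ≤ℝ fromℕ 1
1≤ℝ1 = ≤ℚ⇒≤ℝ {ℤ.+ 1 ℚ./ 1} {ℤ.+ 1 ℚ./ 1} ℚ.≤-refl

1≰ℝ0 : ¬ fromℕ 1 ≤ℝ fromℕ 0
-- Index 2 is the first whose tolerance, 2/3, is below 1.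
1≰ℝ0 1≤0 = ℚ.≤⇒≤ᵇ (1≤0 2)

InInterval : ℝ → ℝ → Pred (Fin 2) 0ℓ
InInterval a b x = a ≤ℝ fromℕ (toℕ x) × fromℕ (toℕ x) ≤ℝ b

lo hi : Fin 4 → ℕ
lo 0F = 0
lo 1F = 1
lo 2F = 0
lo 3F = 1
hi 0F = 0
hi 1F = 1
hi 2F = 1
hi 3F = 0

interval⇒ : ∀ a x → interval a x ≡ true → InInterval (fromℕ (lo a)) (fromℕ (hi a)) x
interval⇒ 0F 0F _ = 0≤ℝ0 , 0≤ℝ0
interval⇒ 0F 1F ()
interval⇒ 1F 0F ()
interval⇒ 1F 1F _ = 1≤ℝ1 , 1≤ℝ1
interval⇒ 2F 0F _ = 0≤ℝ0 , 0≤ℝ1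
interval⇒ 2F 1F _ = 0≤ℝ1 , 1≤ℝ1
interval⇒ 3F _ ()

⇒interval : ∀ a x → InInterval (fromℕ (lo a)) (fromℕ (hi a)) x → interval a x ≡ true
⇒interval 0F 0F _ = refl
⇒interval 0F 1F (_ , 1≤0) = ⊥-elim (1≰ℝ0 1≤0)
⇒interval 1F 0F (1≤0 , _) = ⊥-elim (1≰ℝ0 1≤0)
⇒interval 1F 1F _ = refl
⇒interval 2F _ _ = refl
⇒interval 3F 0F (1≤0 , _) = ⊥-elim (1≰ℝ0 1≤0)
⇒interval 3F 1F (_ , 1≤0) = ⊥-elim (1≰ℝ0 1≤0)

anchored⇒ : ∀ a x → anchored a x ≡ true → InInterval (fromℕ 0) (fromℕ (toℕ a)) x
anchored⇒ 0F 0F _ = 0≤ℝ0 , 0≤ℝ0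
anchored⇒ 0F 1F ()
anchored⇒ 1F 0F _ = 0≤ℝ0 , 0≤ℝ1
anchored⇒ 1F 1F _ = 0≤ℝ1 , 1≤ℝ1

⇒anchored : ∀ a x → InInterval (fromℕ 0) (fromℕ (toℕ a)) x → anchored a x ≡ true
⇒anchored 0F 0F _ = refl
⇒anchored 0F 1F (_ , 1≤0) = ⊥-elim (1≰ℝ0 1≤0)
⇒anchored 1F _ _ = refl

𝓒-sound : ∀ d c → 𝓒 d (words d interval c)
𝓒-sound d c = (λ i → fromℕ (lo (finToFun c i))) , (λ i → fromℕ (hi (finToFun c i))) ,
  members (words-product d interval (λ i → InInterval (fromℕ (lo (finToFun c i))) (fromℕ (hi (finToFun c i)))) c
    (λ i → interval⇒ (finToFun c i)) (λ i → ⇒interval (finToFun c i)))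

𝓐-sound : ∀ d c → 𝓐 d (words d anchored c)
𝓐-sound d c = (λ i → fromℕ (toℕ (finToFun {2} c i))) , (λ i → 0≤ (finToFun c i)) ,
  members (words-product d anchored (λ i → InInterval (fromℕ 0) (fromℕ (toℕ (finToFun {2} c i)))) c
    (λ i → anchored⇒ (finToFun c i)) (λ i → ⇒anchored (finToFun c i)))
  where
  0≤ : ∀ (a : Fin 2) → fromℕ 0 ≤ℝ fromℕ (toℕ a)
  0≤ 0F = 0≤ℝ0
  0≤ 1F = 0≤ℝ1

letter : Bool → Bool → Fin 4
letter true false = 0F
letter false true = 1F
letter true true = 2F
letter false false = 3F

interval-letter : ∀ (t : Fin 2 → Bool) x → interval (letter (t 0F) (t 1F)) x ≡ t x
interval-letter t 0F with t 0F | t 1F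
... | true  | true  = refl
... | true  | false = refl
... | false | true  = refl
... | false | false = refl
interval-letter t 1F with t 0F | t 1F
... | true  | true  = refl
... | true  | false = refl
... | false | true  = refl
... | false | false = refl

nonempty⇒words : ∀ {d} {In : Fin d → Pred (Fin 2) 0ℓ} {F} → IsProduct In F → ∀ v → v ∈ F → ∃[ c ] F ≡ words d interval c
nonempty⇒words {d} F-product v v∈F = funToFin letters , product⇒words F-product interval letters
    (λ i x → test⇒In F-product v v∈F i x ∘ trans (sym (interval-letter (test F-product v v∈F i) x)))
    (λ i x → trans (interval-letter (test F-product v v∈F i) x) ∘ In⇒test F-product v v∈F i x)
  where
  letters : Fin d → Fin 4
  letters i = letter (test F-product v v∈F i 0F) (test F-product v v∈F i 1F)

empty⇒words : ∀ d (F : Subset (2 ℕ.^ suc d)) → (∀ v → lookup F v ≢ true) → ∃[ c ] F ≡ words (suc d) interval c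
empty⇒words d F F∌ = c , trans (sym (tabulate∘lookup F)) (tabulate-cong λ v → bool-ext
    (λ F∋v → contradiction F∋v (F∌ v))
    (λ ok-v → contradiction (trans (sym (first-letter v)) (allᵇ⇒ {suc d} (λ i → interval (finToFun c i) (digit {suc d} v i)) ok-v zero)) λ ()))
  where
  c : Fin (4 ℕ.^ suc d)
  c = funToFin {suc d} (λ _ → 3F)
  first-letter : ∀ v → interval (finToFun {4} {suc d} c zero) (digit {suc d} v zero) ≡ false
  first-letter v = cong (λ a → interval a (digit {suc d} v zero)) (finToFun-funToFin {suc d} (λ _ → 3F) zero)

-- Emptiness is decided on `F`. A nonempty trace supplies the base point from which its letters are
-- read off; an empty one is the word with the empty letter everywhere.
𝓒-complete : ∀ d F → 𝓒 d F → ∃[ c ] F ≡ words d interval c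
𝓒-complete d F (a , b , F-trace) = by-cases (any? (λ v → lookup F v Bool.≟ true))
  where
  F-product : IsProduct (λ i → InInterval (a i) (b i)) F
  F-product = isProduct F-trace
  empty-trace : ∀ d {F : Subset (2 ℕ.^ d)} (a b : ℝ^ d) → IsTrace (Box a b) F → (∀ v → lookup F v ≢ true) → ∃[ c ] F ≡ words d interval c
  -- In dimension 0 a box has no constraints, so its trace is never empty; there is also no position
  -- for an empty letter.
  empty-trace zero a b F-trace F∌ = contradiction ([]=⇒lookup (Equivalence.from (F-trace zero) λ ())) (F∌ zero)
  empty-trace (suc d) {F} _ _ _ F∌ = empty⇒words d F F∌
  by-cases : Dec (∃[ v ] lookup F v ≡ true) → ∃[ c ] F ≡ words d interval c
  by-cases (yes (v , F∋v)) = nonempty⇒words F-product v (lookup⇒[]= v F F∋v)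
  by-cases (no F∌) = empty-trace d a b F-trace (λ v F∋v → F∌ (v , F∋v))

anchored-letter : ∀ (t : Fin 2 → Bool) → t 0F ≡ true → ∀ x → anchored (if t 1F then 1F else 0F) x ≡ t x
anchored-letter t t₀ 0F with t 1F
... | true = sym t₀
... | false = sym t₀
anchored-letter t t₀ 1F with t 1F
... | true = refl
... | false = refl

-- An anchored box contains the origin because the bounds are nonnegative. Its trace is therefore
-- never empty, the origin is a base point, and two letters suffice.
𝓐-complete : ∀ d F → 𝓐 d F → ∃[ c ] F ≡ words d anchored c
𝓐-complete d F (b , 0≤b , F-trace) = funToFin letters , product⇒words F-product anchored letters
    (λ i x → test⇒In F-product origin origin∈F i x ∘ trans (sym (anchored-letter (t i) (t₀ i) x)))
    (λ i x → trans (anchored-letter (t i) (t₀ i) x) ∘ In⇒test F-product origin origin∈F i x)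
  where
  F-product : IsProduct (λ i → InInterval (fromℕ 0) (b i)) F
  F-product = isProduct F-trace
  origin : Fin (2 ℕ.^ d)
  origin = funToFin {d} (λ _ → 0F)
  origin∈F : origin ∈ F
  origin∈F = Equivalence.from (F-trace origin) λ i →
    subst (InInterval (fromℕ 0) (b i)) (sym (finToFun-funToFin {d} (λ _ → 0F) i)) (0≤ℝ0 , 0≤b i)
  t : Fin d → Fin 2 → Bool
  t = test F-product origin origin∈F
  t₀ : ∀ i → t i 0F ≡ true
  t₀ i = In⇒test F-product origin origin∈F i 0F (0≤ℝ0 , 0≤b i)
  letters : Fin d → Fin 2
  letters i = if t i 1F then 1F else 0F

-- Assembling the growth rate.

hard-set-ℕ : ∀ d m l .{{_ : ℕ.NonZero m}} .{{_ : ℕ.NonZero l}} → Σ[ J ∈ Subset (2 ℕ.^ d) ]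
  (∀ (x : Colouring (2 ℕ.^ d)) → ∃[ r ] LowerWitness m l d ℤ.∣ colourSum x (words d anchored r ∩ J) ∣)
hard-set-ℕ d m l = from hard-set
  where
  open LowerBound d (ι m) (ι l) (0<ι m) (0<ι l)
  n c : ℕ
  n = m ℕ.+ l
  c = 3 ℕ.* (m ℕ.* m) ℕ.+ n ℕ.* n
  ι-R : ι ((4 ℕ.* (m ℕ.* n)) ℕ.^ d) ≡ R
  ι-R = trans (ι-^ (4 ℕ.* (m ℕ.* n)) d) (cong (_^ d) (trans (ι-* 4 (m ℕ.* n))
    (cong (ι 4 *_) (trans (ι-* m n) (cong (ι m *_) (ι-+ m l))))))
  ι-C : ι (c ℕ.^ d) ≡ C
  ι-C = trans (ι-^ c d) (cong (_^ d) (trans (ι-+ (3 ℕ.* (m ℕ.* m)) (n ℕ.* n)) (cong₂ _+_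
    (trans (ι-* 3 (m ℕ.* m)) (cong (ι 3 *_) (ι-* m m)))
    (trans (ι-* n n) (cong₂ _*_ (ι-+ m l) (ι-+ m l))))))
  witness : ∀ z → R * R ≤ ι (suc d) * ι (suc d) * (ι 80 * (C * (C * (ιℤ z * ιℤ z)))) → LowerWitness m l d ℤ.∣ z ∣
  witness z R²≤ = ι-cancel-≤ (subst₂ _≤_
    (sym (trans (ι-* r r) (cong₂ _*_ ι-R ι-R)))
    (sym (trans (ι-* (suc d ℕ.* suc d) (80 ℕ.* (Cₙ ℕ.* (Cₙ ℕ.* a²)))) (cong₂ _*_ (ι-* (suc d) (suc d))
      (trans (ι-* 80 (Cₙ ℕ.* (Cₙ ℕ.* a²))) (cong (ι 80 *_) (trans (ι-* Cₙ (Cₙ ℕ.* a²)) (cong₂ _*_ ι-C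
        (trans (ι-* Cₙ a²) (cong₂ _*_ ι-C (trans (ι-* ℤ.∣ z ∣ ℤ.∣ z ∣) (ι∣z∣² z)))))))))))
    R²≤)
    where
    r Cₙ a² : ℕ
    r = (4 ℕ.* (m ℕ.* n)) ℕ.^ d
    Cₙ = c ℕ.^ d
    a² = ℤ.∣ z ∣ ℕ.* ℤ.∣ z ∣
  from : Σ[ J ∈ Subset (2 ℕ.^ d) ] Unbalanced J → Σ[ J ∈ Subset (2 ℕ.^ d) ]
    (∀ (x : Colouring (2 ℕ.^ d)) → ∃[ r ] LowerWitness m l d ℤ.∣ colourSum x (words d anchored r ∩ J) ∣)
  from (J , unbalanced) = J , λ x → let r , R²≤ = unbalanced x in r , witness (colourSum x (words d anchored r ∩ J)) R²≤

𝓐⊆𝓒 : ∀ d F → 𝓐 d F → 𝓒 d F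
𝓐⊆𝓒 d F (b , _ , F-trace) = (λ _ → fromℕ 0) , b , F-trace

-- Stated for any enumerated system between 𝓐 and 𝓒: every member is a subcube, so the balanced
-- colourings apply, and every anchored box is a member, so the hard subset applies.
module Growth (𝓕 : ∀ d → SetSystem (2 ℕ.^ d)) (A : ℕ) .{{_ : ℕ.NonZero A}}
  (E : ∀ d → Fin (A ℕ.^ d) → Subset (2 ℕ.^ d))
  (sound : ∀ d c → 𝓕 d (E d c)) (complete : ∀ d F → 𝓕 d F → ∃[ c ] F ≡ E d c)
  (𝓐⊆𝓕 : ∀ d F → 𝓐 d F → 𝓕 d F) (𝓕⊆𝓒 : ∀ d F → 𝓕 d F → 𝓒 d F) where

  module Enum d = Enumerated {{ℕ.m^n≢0 A d}} {𝓕 = 𝓕 d} (E d) (sound d) (complete d)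

  h : ℕ → ℕ
  h d = proj₁ (Enum.herdisc d)

  h-herdisc : ∀ d → HerDisc (𝓕 d) (h d)
  h-herdisc d = proj₂ (Enum.herdisc d)

  h-upper : ∀ d q → UpperWitness d q (h d)
  h-upper d q = Enum.herdisc-upper d {U = UpperWitness d q}
    (λ a≤b → ℕ.≤-trans (ℕ.^-monoˡ-≤ (suc q) (ℕ.*-monoˡ-≤ (3 ℕ.^ d) (ℕ.*-mono-≤ a≤b a≤b)))) (h-herdisc d)
    λ J → let x , bound = balanced-colouring d q J in x , λ c →
      let c′ , E≡ = 𝓒-complete d (E d c) (𝓕⊆𝓒 d (E d c) (sound d c))
      in subst (λ F → UpperWitness d q ℤ.∣ colourSum x (F ∩ J) ∣) (sym E≡) (bound c′)

  h-lower : ∀ d m l .{{_ : ℕ.NonZero m}} .{{_ : ℕ.NonZero l}} → LowerWitness m l d (h d)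
  h-lower d m l = let J , unbalanced = hard-set-ℕ d m l in Enum.herdisc-lower d {L = LowerWitness m l d}
    (λ a≤b R²≤ → ℕ.≤-trans R²≤ (ℕ.*-monoʳ-≤ (suc d ℕ.* suc d) (ℕ.*-monoʳ-≤ 80 (ℕ.*-monoʳ-≤ (c ℕ.^ d) (ℕ.*-monoʳ-≤ (c ℕ.^ d) (ℕ.*-mono-≤ a≤b a≤b))))))
    (h-herdisc d) J λ x →
      let r , R²≤ = unbalanced x
          c′ , F≡ = complete d (words d anchored r) (𝓐⊆𝓕 d (words d anchored r) (𝓐-sound d r))
      in c′ , subst (λ F → LowerWitness m l d ℤ.∣ colourSum x (F ∩ J) ∣) F≡ R²≤
    where
    c : ℕ
    c = 3 ℕ.* (m ℕ.* m) ℕ.+ (m ℕ.+ l) ℕ.* (m ℕ.+ l)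

  growth : Is2^[c₀d+o[d]] h
  growth (suc κ) = D₁ ℕ.⊔ D₂ , λ d D≤d →
      proj₂ lower d (ℕ.≤-trans (ℕ.m≤m⊔n D₁ D₂) D≤d) (h d)
        (h-lower d _ _ {{ℕ.>-nonZero (ℕ.≤-trans (ℕ.s≤s ℕ.z≤n) (proj₁ (pell-large (2 ℕ.* suc κ))))}}
          {{ℕ.>-nonZero (proj₂ (pell-large (2 ℕ.* suc κ)))}}) ,
      proj₂ upper d (ℕ.≤-trans (ℕ.m≤n⊔m D₁ D₂) D≤d) (h d) (h-upper d (suc (2 ℕ.* κ)))
    where
    lower = lower-arithmetic (suc κ)
    upper = upper-arithmetic κ
    D₁ = proj₁ lower
    D₂ = proj₁ upper

  result : ∃[ h ] ((∀ d → HerDisc (𝓕 d) (h d)) × Is2^[c₀d+o[d]] h)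
  result = h , h-herdisc , growth

theorem6p1 : (∃[ h ] ((∀ d → HerDisc (𝓒 d) (h d)) × Is2^[c₀d+o[d]] h))
    × (∃[ h ] ((∀ d → HerDisc (𝓐 d) (h d)) × Is2^[c₀d+o[d]] h))
theorem6p1 =
  Growth.result 𝓒 4 (λ d → words d interval) 𝓒-sound 𝓒-complete 𝓐⊆𝓒 (λ _ _ F∈ → F∈) ,
  Growth.result 𝓐 2 (λ d → words d anchored) 𝓐-sound 𝓐-complete (λ _ _ F∈ → F∈) 𝓐⊆𝓒
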